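{- Given a CNF formula $\phi$ and a $(t^+,t^-)$-labeling parse tree of the signed formula graph $F_\phi$, there is an algorithm that counts the number of satisfying assignments of $\phi$ in time $$\mathcal O\big(t^3\cdot 2^{3t(t+1)/2}\cdot|\phi|\big)\qquad\text{where } t=\max(t^+,t^-).$$
   Context: **Conventions.** For a CNF formula $\phi$ with variable set $W$ (the variables occurring in $\phi$) and clause set $C$, an assignment is a map $\nu:W\to\{0,1\}$; it is satisfying if it satisfies every clause. $|\phi|$ denotes the size of $\phi$. **Signed formula graph.** A signed graph $G$ is a graph with two (disjoint) edge sets $E^+(G),E^-(G)$ on one vertex set; $G^+,G^-$ denote the simple graphs on $V(G)$ with edge sets $E^+(G)$, $E^-(G)$. The signed graph $F_\phi$ has vertex set $W\cup C$; for $w\in W$, $c\in C$, $wc\in E^+(F_\phi)$ iff the literal $w$ occurs in $c$, and $wc\in E^-(F_\phi)$ iff the literal $\neg w$ occurs in $c$. **Labeling parse trees.** A $t$-labeled graph is a graph $G$ with a map $lab:V(G)\to 2^{[t]}$, $[t]=\{1,\dots,t\}$; labels are identified with row vectors in $\mathrm{GF}(2)^t$. A $t$-relabeling $f$ is a linear map $\mathrm{GF}(2)^t\to\mathrm{GF}(2)^t$ given by a $t\times t$ binary matrix $R_f$, acting on labels by $v\mapsto vR_f$. Given $t$-relabelings $g,f_1,f_2$, the composition operator $\otimes[g\,|\,f_1,f_2]$ maps $t$-labeled graphs $\bar G_1=(G_1,lab^1)$, $\bar G_2=(G_2,lab^2)$ to the $t$-labeled graph obtained from the disjoint union of $G_1$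 and $G_2$ by adding every edge $uv$ ($u\in V(G_1)$, $v\in V(G_2)$) with $lab^1(u)\cdot g(lab^2(v))=1$ over $\mathrm{GF}(2)$, with new labels $lab(v)=f_i(lab^i(v))$ for $v\in V(G_i)$, $i=1,2$. The nullary operator $\odot$ creates a single new vertex with label $\{1\}$. A $t$-labeling parse tree is a finite rooted ordered subcubic tree (all degrees at most 3), with root degree at most 2, whose leaves carry $\odot$ and whose internal nodes carry $t$-labeling composition operators; it generates the graph obtained by successively applying the operators from the leaves to the root. A $(t^+,t^-)$-labeling parse tree of a signed graph $G$ is a pair $(T^+,T^-)$ where $T^+$ is a $t^+$-labeling parse tree generating $G^+$, $T^-$ is a $t^-$-labeling parse tree generating $G^-$, and the underlying rooted ordered trees of $T^+$ and $T^-$ are identical (each common leaf creating the same vertex of $G$ in both). -}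

module Defs where

open import Data.Bool.Base using (Bool; true; false; _∧_; _xor_; if_then_else_)
import Data.Bool.Properties as Bool
open import Data.Empty using (⊥)
open import Data.Fin.Base using (Fin; zero; toℕ)
open import Data.Fin.Subset using (Subset; ⁅_⁆)
open import Data.List.Base using (List; []; _∷_; _++_; map; concatMap; length; filter)
open import Data.List.Membership.Propositional using (_∈_)
open import Data.List.Relation.Unary.Any using (Any; any?)
open import Data.Nat.Base using (ℕ; zero; suc; _+_; _*_; _∸_; NonZero; _≡ᵇ_)
open import Data.Nat.ListAction using (sum)
open import Data.Product.Base using (∃; _×_; _,_)
open import Data.Sum.Base using (_⊎_; inj₁; inj₂; [_,_]′)
open import Data.Unit.Base using (⊤)
open import Data.Vec.Base as Vec using (Vec; []; _∷_; lookup; toList)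
open import Data.Vec.Relation.Unary.All using (All; all?)
open import Function.Base using (_∘_)
open import Function.Bundles using (_↔_; _⇔_; Inverse)
open import Relation.Binary.PropositionalEquality using (_≡_; _≢_)
open import Relation.Nullary.Decidable using (Dec)
open import Relation.Nullary.Negation using (¬_)

------------------------------------------------------------------------
-- CNF formulas

data Literal (n : ℕ) : Set where
  pos neg : Fin n → Literal n

-- `occurring` makes Fin #vars exactly the set of variables occurring in
-- the formula.  Empty clauses, repeated clauses, and clauses containing
-- both w and ¬ w are all allowed.
record CNF : Set where
  field
    #vars     : ℕ
    #clauses  : ℕ
    clauses   : Vec (List (Literal #vars)) #clauses
    occurring : ∀ w → ∃ λ c → pos w ∈ lookup clauses c ⊎ neg w ∈ lookup clauses c

open CNF public

-- Number of clauses plus number of literal occurrences.  This dominates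
-- #vars, because every variable occurs.
size : CNF → ℕ
size φ = #clauses φ + sum (map length (toList (clauses φ)))

Assignment : ℕ → Set
Assignment n = Vec Bool n

LiteralTrue : ∀ {n} → Assignment n → Literal n → Set
LiteralTrue ν (pos w) = lookup ν w ≡ true
LiteralTrue ν (neg w) = lookup ν w ≡ false

Satisfies : (φ : CNF) → Assignment (#vars φ) → Set
Satisfies φ ν = All (Any (LiteralTrue ν)) (clauses φ)

literalTrue? : ∀ {n} (ν : Assignment n) (l : Literal n) → Dec (LiteralTrue ν l)
literalTrue? ν (pos w) = lookup ν w Bool.≟ true
literalTrue? ν (neg w) = lookup ν w Bool.≟ false

satisfies? : (φ : CNF) (ν : Assignment (#vars φ)) → Dec (Satisfies φ ν)
satisfies? φ ν = all? (any? (literalTrue? ν)) (clauses φ)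

-- Each assignment exactly once.
assignments : ∀ n → List (Assignment n)
assignments zero    = [] ∷ []
assignments (suc n) = map (false ∷_) (assignments n) ++ map (true ∷_) (assignments n)

#SAT : CNF → ℕ
#SAT φ = length (filter (satisfies? φ) (assignments (#vars φ)))

------------------------------------------------------------------------
-- Graphs and signed graphs

record Graph (V : Set) : Set₁ where
  field
    Edge   : V → V → Set
    sym    : ∀ {u v} → Edge u v → Edge v u
    irrefl : ∀ {v} → ¬ Edge v v

open Graph public

-- The two edge sets are kept apart by their sign: a positive and a negative
-- edge are never the same edge, but they may join the same two vertices
-- (as happens in a formula graph for a clause containing both w and ¬ w).
record SignedGraph (V : Set) : Set₁ where
  field
    G⁺ G⁻ : Graph V

open SignedGraph public

Vertex : CNF → Set
Vertex φ = Fin (#vars φ) ⊎ Fin (#clauses φ)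

incidence : {W C : Set} → (W → C → Set) → Graph (W ⊎ C)
incidence {W} {C} R = record
  { Edge   = E
  ; sym    = λ {u} {v} → E-sym u v
  ; irrefl = λ {v} → E-irrefl v
  }
  where
  E : W ⊎ C → W ⊎ C → Set
  E (inj₁ w) (inj₂ c) = R w c
  E (inj₂ c) (inj₁ w) = R w c
  E (inj₁ _) (inj₁ _) = ⊥
  E (inj₂ _) (inj₂ _) = ⊥

  E-sym : ∀ u v → E u v → E v u
  E-sym (inj₁ _) (inj₂ _) e = e
  E-sym (inj₂ _) (inj₁ _) e = e

  E-irrefl : ∀ v → ¬ E v v
  E-irrefl (inj₁ _) ()
  E-irrefl (inj₂ _) ()

formulaGraph : (φ : CNF) → SignedGraph (Vertex φ)
formulaGraph φ = record
  { G⁺ = incidence (λ w c → pos w ∈ lookup (clauses φ) c)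
  ; G⁻ = incidence (λ w c → neg w ∈ lookup (clauses φ) c)
  }

------------------------------------------------------------------------
-- Labels: GF(2) is Bool with _xor_ as addition and _∧_ as multiplication,
-- and Subset t = Vec Bool t is read as the row vectors in GF(2)^t.

Label : ℕ → Set
Label = Subset

infixl 7 _·_ _·ᴹ_
infixl 6 _⊕_

_⊕_ : ∀ {t} → Label t → Label t → Label t
_⊕_ = Vec.zipWith _xor_

_·_ : ∀ {t} → Label t → Label t → Bool
u · v = Vec.foldr _ _xor_ false (Vec.zipWith _∧_ u v)

-- A matrix is the vector of its rows.
Matrix : ℕ → ℕ → Set
Matrix m n = Vec (Label n) m

Relabeling : ℕ → Set
Relabeling t = Matrix t t

_·ᴹ_ : ∀ {m n} → Label m → Matrix m n → Label n
[]      ·ᴹ []      = Vec.replicate _ false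
(b ∷ v) ·ᴹ (r ∷ R) = Vec.map (b ∧_) r ⊕ v ·ᴹ R

-- The element 1 of [t] is zero : Fin t.
⁅1⁆ : ∀ t → .{{NonZero t}} → Label t
⁅1⁆ (suc _) = ⁅ zero ⁆

------------------------------------------------------------------------
-- Labeling parse trees

-- Composition is binary, so the underlying rooted ordered subcubic trees
-- are the full binary trees.
data Shape : Set where
  leaf : Shape
  node : Shape → Shape → Shape

Leaf : Shape → Set
Leaf leaf       = ⊤
Leaf (node l r) = Leaf l ⊎ Leaf r

data ParseTree (t : ℕ) : Shape → Set where
  ⊙         : .{{NonZero t}} → ParseTree t leaf
  ⊗[_∣_,_]  : ∀ {l r} (g f₁ f₂ : Relabeling t) →
              ParseTree t l → ParseTree t r → ParseTree t (node l r)

record LabeledGraph (t : ℕ) (V : Set) : Set₁ where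
  field
    graph : Graph V
    lab   : V → Label t

open LabeledGraph public

single : ∀ {t} → Label t → LabeledGraph t ⊤
single ℓ = record
  { graph = record { Edge = λ _ _ → ⊥ ; sym = λ () ; irrefl = λ () }
  ; lab   = λ _ → ℓ
  }

compose : ∀ {t} {V₁ V₂ : Set} (g f₁ f₂ : Relabeling t) →
          LabeledGraph t V₁ → LabeledGraph t V₂ → LabeledGraph t (V₁ ⊎ V₂)
compose {t} {V₁} {V₂} g f₁ f₂ Ḡ₁ Ḡ₂ = record
  { graph = record
      { Edge   = E
      ; sym    = λ {u} {v} → E-sym u v
      ; irrefl = λ {v} → E-irrefl v
      }
  ; lab   = [ (λ v → lab Ḡ₁ v ·ᴹ f₁) , (λ v → lab Ḡ₂ v ·ᴹ f₂) ]′
  }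
  where
  Cross : V₁ → V₂ → Set
  Cross u v = lab Ḡ₁ u · (lab Ḡ₂ v ·ᴹ g) ≡ true

  E : V₁ ⊎ V₂ → V₁ ⊎ V₂ → Set
  E (inj₁ u) (inj₁ v) = Edge (graph Ḡ₁) u v
  E (inj₂ u) (inj₂ v) = Edge (graph Ḡ₂) u v
  E (inj₁ u) (inj₂ v) = Cross u v
  E (inj₂ v) (inj₁ u) = Cross u v

  E-sym : ∀ u v → E u v → E v u
  E-sym (inj₁ _) (inj₁ _) = sym (graph Ḡ₁)
  E-sym (inj₂ _) (inj₂ _) = sym (graph Ḡ₂)
  E-sym (inj₁ _) (inj₂ _) e = e
  E-sym (inj₂ _) (inj₁ _) e = e

  E-irrefl : ∀ v → ¬ E v v
  E-irrefl (inj₁ _) = irrefl (graph Ḡ₁)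
  E-irrefl (inj₂ _) = irrefl (graph Ḡ₂)

generate : ∀ {t s} → ParseTree t s → LabeledGraph t (Leaf s)
generate {t} ⊙                     = single (⁅1⁆ t)
generate (⊗[ g ∣ f₁ , f₂ ] T₁ T₂) = compose g f₁ f₂ (generate T₁) (generate T₂)

-- T generates G, where the leaf x creates the vertex name x of G.
Generates : ∀ {t s} {V : Set} → ParseTree t s → (Leaf s → V) → Graph V → Set
Generates T name G =
  ∀ x y → Edge (graph (generate T)) x y ⇔ Edge G (name x) (name y)

-- Sharing `shape` and `vertex` makes the two underlying trees, and the
-- vertices created by their leaves, identical.
record SignedParseTree (t⁺ t⁻ : ℕ) {V : Set} (G : SignedGraph V) : Set where
  field
    shape      : Shape
    vertex     : Leaf shape ↔ V
    T⁺         : ParseTree t⁺ shape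
    T⁻         : ParseTree t⁻ shape
    generates⁺ : Generates T⁺ (Inverse.to vertex) (G⁺ G)
    generates⁻ : Generates T⁻ (Inverse.to vertex) (G⁻ G)

open SignedParseTree public

------------------------------------------------------------------------
-- The machine model: structured programs for a unit-cost random access
-- machine, with finitely many named memories, each an unbounded array of
-- naturals with indirect addressing.  A scalar variable is a cell 0.
--
-- The memories come in two kinds.  Index memories provide + and ∸, and alone
-- govern addressing and control flow.  Counter memories hold the (long)
-- numbers being counted, and provide + and *, but never flow back into index
-- memories.  Each arithmetic operation costs one step, as is implicit in a
-- bound linear in |φ|.  Keeping * away from indices and tests excludes the
-- well-known shortcuts by which unit-cost arithmetic on huge numbers
-- encodes exponentially many evaluations in one word.

Name : Set
Name = ℕ

infixl 6 _+ᵉ_ _∸ᵉ_ _+ᶜ_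
infixl 7 _*ᶜ_
infix  9 _[_]ᵉ _[_]ᶜ

data Exp : Set where
  lit   : ℕ → Exp
  _[_]ᵉ : Name → Exp → Exp
  _+ᵉ_  : Exp → Exp → Exp
  _∸ᵉ_  : Exp → Exp → Exp

data CExp : Set where
  lit   : ℕ → CExp
  _[_]ᶜ : Name → Exp → CExp
  _+ᶜ_  : CExp → CExp → CExp
  _*ᶜ_  : CExp → CExp → CExp

infix  4 _[_]≔ᵉ_ _[_]≔ᶜ_
infixr 3 _⨾_

data Program : Set where
  skip          : Program
  _[_]≔ᵉ_       : Name → Exp → Exp → Program
  _[_]≔ᶜ_       : Name → Exp → CExp → Program
  _⨾_           : Program → Program → Program
  IF_THEN_ELSE_ : Exp → Program → Program → Program
  WHILE_DO_     : Exp → Program → Program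

Memory : Set
Memory = Name → ℕ → ℕ

record State : Set where
  constructor ⟪_,_⟫
  field
    index   : Memory
    counter : Memory

open State public

write : Memory → Name → ℕ → ℕ → Memory
write M a i v b j = if (b ≡ᵇ a) ∧ (j ≡ᵇ i) then v else M b j

⟦_⟧ᵉ : Exp → State → ℕ
⟦ lit k ⟧ᵉ     σ = k
⟦ a [ e ]ᵉ ⟧ᵉ  σ = index σ a (⟦ e ⟧ᵉ σ)
⟦ e₁ +ᵉ e₂ ⟧ᵉ  σ = ⟦ e₁ ⟧ᵉ σ + ⟦ e₂ ⟧ᵉ σ
⟦ e₁ ∸ᵉ e₂ ⟧ᵉ  σ = ⟦ e₁ ⟧ᵉ σ ∸ ⟦ e₂ ⟧ᵉ σ

⟦_⟧ᶜ : CExp → State → ℕ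
⟦ lit k ⟧ᶜ     σ = k
⟦ a [ e ]ᶜ ⟧ᶜ  σ = counter σ a (⟦ e ⟧ᵉ σ)
⟦ e₁ +ᶜ e₂ ⟧ᶜ  σ = ⟦ e₁ ⟧ᶜ σ + ⟦ e₂ ⟧ᶜ σ
⟦ e₁ *ᶜ e₂ ⟧ᶜ  σ = ⟦ e₁ ⟧ᶜ σ * ⟦ e₂ ⟧ᶜ σ

costᵉ : Exp → ℕ
costᵉ (lit _)    = 1
costᵉ (_ [ e ]ᵉ) = 1 + costᵉ e
costᵉ (e₁ +ᵉ e₂) = 1 + costᵉ e₁ + costᵉ e₂
costᵉ (e₁ ∸ᵉ e₂) = 1 + costᵉ e₁ + costᵉ e₂

costᶜ : CExp → ℕ
costᶜ (lit _)    = 1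
costᶜ (_ [ e ]ᶜ) = 1 + costᵉ e
costᶜ (e₁ +ᶜ e₂) = 1 + costᶜ e₁ + costᶜ e₂
costᶜ (e₁ *ᶜ e₂) = 1 + costᶜ e₁ + costᶜ e₂

-- ⟨ P , σ ⟩⇓[ n ] σ′ : started in σ, P halts in σ′ after exactly n steps.
-- A test succeeds when its value is nonzero.
infix 2 ⟨_,_⟩⇓[_]_

data ⟨_,_⟩⇓[_]_ : Program → State → ℕ → State → Set where

  ⇓skip : ∀ {σ} → ⟨ skip , σ ⟩⇓[ 1 ] σ

  ⇓index : ∀ {σ a i e} →
    ⟨ a [ i ]≔ᵉ e , σ ⟩⇓[ 1 + costᵉ i + costᵉ e ]
      ⟪ write (index σ) a (⟦ i ⟧ᵉ σ) (⟦ e ⟧ᵉ σ) , counter σ ⟫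

  ⇓counter : ∀ {σ a i e} →
    ⟨ a [ i ]≔ᶜ e , σ ⟩⇓[ 1 + costᵉ i + costᶜ e ]
      ⟪ index σ , write (counter σ) a (⟦ i ⟧ᵉ σ) (⟦ e ⟧ᶜ σ) ⟫

  ⇓seq : ∀ {σ σ₁ σ₂ P Q m n} →
    ⟨ P , σ ⟩⇓[ m ] σ₁ → ⟨ Q , σ₁ ⟩⇓[ n ] σ₂ →
    ⟨ P ⨾ Q , σ ⟩⇓[ m + n ] σ₂

  ⇓then : ∀ {σ σ₁ e P Q n} → ⟦ e ⟧ᵉ σ ≢ 0 → ⟨ P , σ ⟩⇓[ n ] σ₁ →
    ⟨ IF e THEN P ELSE Q , σ ⟩⇓[ 1 + costᵉ e + n ] σ₁

  ⇓else : ∀ {σ σ₁ e P Q n} → ⟦ e ⟧ᵉ σ ≡ 0 → ⟨ Q , σ ⟩⇓[ n ] σ₁ →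
    ⟨ IF e THEN P ELSE Q , σ ⟩⇓[ 1 + costᵉ e + n ] σ₁

  ⇓stop : ∀ {σ e P} → ⟦ e ⟧ᵉ σ ≡ 0 →
    ⟨ WHILE e DO P , σ ⟩⇓[ 1 + costᵉ e ] σ

  ⇓loop : ∀ {σ σ₁ σ₂ e P m n} → ⟦ e ⟧ᵉ σ ≢ 0 →
    ⟨ P , σ ⟩⇓[ m ] σ₁ → ⟨ WHILE e DO P , σ₁ ⟩⇓[ n ] σ₂ →
    ⟨ WHILE e DO P , σ ⟩⇓[ 1 + costᵉ e + m + n ] σ₂

------------------------------------------------------------------------
-- Input and output.  The i-th input list is stored from cell 0 of the i-th
-- index memory; every other cell is initially 0.

cell : List ℕ → ℕ → ℕ
cell []       _       = 0
cell (x ∷ _)  zero    = x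
cell (_ ∷ xs) (suc j) = cell xs j

memory : List (List ℕ) → Memory
memory []         _       = λ _ → 0
memory (xs ∷ _)   zero    = cell xs
memory (_ ∷ xss)  (suc a) = memory xss a

initial : List (List ℕ) → State
initial xss = ⟪ memory xss , (λ _ _ → 0) ⟫

output : State → ℕ
output σ = counter σ 0 0

encodeLiteral : ∀ {n} → Literal n → ℕ
encodeLiteral (pos w) = 2 * toℕ w
encodeLiteral (neg w) = 1 + 2 * toℕ w

encodeFormula : CNF → List ℕ
encodeFormula φ =
  concatMap (λ c → length c ∷ map encodeLiteral c) (toList (clauses φ))

encodeVertex : (φ : CNF) → Vertex φ → ℕ
encodeVertex φ (inj₁ w) = toℕ w
encodeVertex φ (inj₂ c) = #vars φ + toℕ c

encodeMatrix : ∀ {m n} → Matrix m n → List ℕ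
encodeMatrix R = concatMap (map (λ b → if b then 1 else 0) ∘ toList) (toList R)

-- Postfix notation: 1 v is a leaf creating the vertex v, and a 2 followed by
-- the matrices of g, f₁, f₂ is an internal node.
encodeTree : ∀ {t s} → (Leaf s → ℕ) → ParseTree t s → List ℕ
encodeTree code ⊙ = 1 ∷ code _ ∷ []
encodeTree code (⊗[ g ∣ f₁ , f₂ ] T₁ T₂) =
  encodeTree (code ∘ inj₁) T₁ ++ encodeTree (code ∘ inj₂) T₂ ++
  2 ∷ encodeMatrix g ++ encodeMatrix f₁ ++ encodeMatrix f₂

encode : ∀ {t⁺ t⁻} (φ : CNF) → SignedParseTree t⁺ t⁻ (formulaGraph φ) → List (List ℕ)
encode {t⁺} {t⁻} φ T =
  (t⁺ ∷ t⁻ ∷ #vars φ ∷ #clauses φ ∷ []) ∷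
  encodeFormula φ ∷
  encodeTree code (T⁺ T) ∷
  encodeTree code (T⁻ T) ∷ []
  where
  code : Leaf (shape T) → ℕ
  code x = encodeVertex φ (Inverse.to (vertex T) x)

{-# OPTIONS --safe #-}

-- Dynamic programming along the parse trees, both signs together.  Labels are
-- pairs in V = GF(2)^t⁺ × GF(2)^t⁻; a true variable contributes (its positive
-- label , 0), a false one (0 , its negative label), and at a composition it
-- satisfies a clause with label r iff its contribution u, transported by the
-- relabelings, has u ∙ r = 1.  Hence a set U of contributions matters only
-- through its annihilator ann U = { r | u ∙ r = 0 for all u in U }, a product of
-- two subspaces.  The table of a node counts, for A and B, the assignments below
-- it whose contributions have the annihilator of A and which satisfy all clauses
-- below it with the help of outside contributions B.  By adjointness annihilators
-- are pulled back along the relabelings, so if there are N annihilators, a node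
-- takes N³ steps.  A subspace of GF(2)^t of codimension k is the kernel of a
-- parity check matrix; these are counted by Gaussian binomials, which are at most
-- 4 · 2^(k (t - k)), and so N = O(2^(t (t + 1) / 2)).  An annihilator is addressed
-- by its key, the number whose binary digits are its characteristic function.

module Submission where

open import Defs hiding (sym)
import Data.Bool.Properties as Bool
import Data.List.Relation.Unary.Unique.Propositional.Properties as Unique
import Data.Vec.Relation.Unary.All as VecAll
open import Data.Bool.Base using (Bool; true; false; _∧_; _∨_; not; if_then_else_; _xor_)
open import Data.Bool.Properties using (∧-comm; ∧-assoc; ∧-distribˡ-xor; xor-assoc; xor-comm; not-involutive; xor-same; ∧-zeroʳ; ∧-identityʳ; xor-identityʳ)
open import Data.Empty using (⊥)
open import Data.Fin.Base using (Fin; zero; suc; toℕ)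
open import Data.Fin.Properties using (injective⇒≤; toℕ<n; toℕ-injective)
open import Data.List.Base as List using (List; []; _∷_; _++_; map; length; filter; cartesianProduct; cartesianProductWith)
open import Data.List.Membership.Propositional using (_∈_; find; lose)
open import Data.List.Membership.Propositional.Properties using (∈-lookup; ∈-map⁺; ∈-map⁻; ∈-++⁺ˡ; ∈-++⁺ʳ; ∈-filter⁺; ∈-filter⁻; ∈-cartesianProduct⁺; ∈-cartesianProduct⁻; ∈-cartesianProductWith⁺; ∈-allFin)
open import Data.List.Properties using (length-++; ++-assoc; ++-identityʳ; length-map; length-tabulate)
open import Data.List.Relation.Unary.All as All using (All; []; _∷_)
open import Data.List.Relation.Unary.All.Properties using (++⁺; map⁺)
open import Data.List.Relation.Unary.AllPairs using ([]; _∷_)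
open import Data.List.Relation.Unary.Any as Any using (Any; here; there)
open import Data.List.Relation.Unary.Any.Properties using (lookup-index)
open import Data.List.Relation.Unary.Unique.Propositional using (Unique)
open import Data.Nat.Base hiding (_/_)
open import Data.Nat.DivMod using (_/_; m*n/n≡m; /-monoˡ-≤; m/n*n≤m)
open import Data.Nat.ListAction using (sum)
open import Data.Nat.Properties
open import Data.Nat.Tactic.RingSolver using (solve-∀)
open import Data.Product.Base using (∃; _×_; _,_; proj₁; proj₂; Σ-syntax)
open import Data.Sum.Base using (_⊎_; inj₁; inj₂)
open import Data.Unit.Base using (tt)
open import Data.Vec.Base as Vec using (Vec; []; _∷_)
open import Data.Vec.Properties using (tabulate-cong; tabulate∘lookup; lookup∘tabulate)
open import Function.Base using (_∘_)
open import Function.Bundles using (Inverse; Equivalence; _⇔_)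
open import Relation.Binary.PropositionalEquality using (_≡_; _≢_; refl; sym; trans; cong; cong₂; subst; subst₂; module ≡-Reasoning)
open import Relation.Nullary.Decidable.Core using (yes; no)
open import Relation.Nullary.Negation using (¬_; contradiction)

open VecAll using ([]; _∷_)

-- Programs with bounded loops

-- The machine shapes the proof. Index memories can only add and subtract, so halves and parities
-- are tabulated, a key is multiplied by `Q` once, by `q` doublings, and matrix products are
-- assembled bit by bit. Keys are doubly exponential in the label size, but at unit cost they serve
-- as sparse addresses in a blank memory: sets are compared and looked up in one step, and only
-- cells of enumerated keys are visited.
--
-- One program must serve all label sizes. Every loop except the one over the tokens is bounded by
-- the number `t⁺ + t⁻` of coordinates or by a single number `y` that dominates both the number `q`
-- of label pairs and the number N of annihilators. Costs are therefore polynomials in two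
-- variables, and what has to be checked is that their degrees do not exceed 3. The operation tables
-- of a node take about N * N * q matrix evaluations, so they fit under the same bound as the
-- combination of the children.
--
-- Guessing the outside contributions is what makes the counts multiply: once the annihilators of
-- both siblings and of the outside are fixed, the clauses on the two sides impose independent
-- conditions.

data Poly : Set where
  con     : ℕ → Poly
  𝕋 𝕐     : Poly
  _⊞_ _⊠_ : Poly → Poly → Poly

infixl 6 _⊞_
infixl 7 _⊠_

Env : Set
Env = ℕ × ℕ

⟦_⟧ : Poly → Env → ℕ
⟦ con k ⟧ _ = k
⟦ 𝕋 ⟧ (t , _) = t
⟦ 𝕐 ⟧ (_ , y) = y
⟦ p ⊞ p′ ⟧ ρ = ⟦ p ⟧ ρ + ⟦ p′ ⟧ ρ
⟦ p ⊠ p′ ⟧ ρ = ⟦ p ⟧ ρ * ⟦ p′ ⟧ ρ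

-- At `(1 , 1)` a polynomial takes the sum of its coefficients. Together with the degrees this
-- bounds it at all positive arguments, so comparing running times becomes a computation.
coeff deg𝕋 deg𝕐 : Poly → ℕ
coeff p = ⟦ p ⟧ (1 , 1)

deg𝕋 (con _) = 0
deg𝕋 𝕋 = 1
deg𝕋 𝕐 = 0
deg𝕋 (p ⊞ p′) = deg𝕋 p ⊔ deg𝕋 p′
deg𝕋 (p ⊠ p′) = deg𝕋 p + deg𝕋 p′

deg𝕐 (con _) = 0
deg𝕐 𝕋 = 0
deg𝕐 𝕐 = 1
deg𝕐 (p ⊞ p′) = deg𝕐 p ⊔ deg𝕐 p′
deg𝕐 (p ⊠ p′) = deg𝕐 p + deg𝕐 p′

module _ {t y : ℕ} .{{_ : NonZero t}} .{{_ : NonZero y}} where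

  poly-bound : ∀ p {a b} → deg𝕋 p ≤ a → deg𝕐 p ≤ b → ⟦ p ⟧ (t , y) ≤ coeff p * (t ^ a * y ^ b)
  poly-bound (con k) {a} {b} _ _ = begin
    k                        ≡⟨ *-identityʳ k ⟨
    k * 1                    ≤⟨ *-monoʳ-≤ k (*-mono-≤ (m^n>0 t a) (m^n>0 y b)) ⟩
    k * (t ^ a * y ^ b)      ∎
    where open ≤-Reasoning
  poly-bound 𝕋 {suc a} {b} _ _ = begin
    t                              ≡⟨ trans (cong (_+ 0) (*-identityʳ (t * 1))) (trans (+-identityʳ _) (*-identityʳ t)) ⟨
    1 * (t * 1 * 1)                ≤⟨ *-monoʳ-≤ 1 (*-mono-≤ (*-monoʳ-≤ t (m^n>0 t a)) (m^n>0 y b)) ⟩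
    1 * (t * t ^ a * y ^ b)        ∎
    where open ≤-Reasoning
  poly-bound 𝕐 {a} {suc b} _ _ = begin
    y                              ≡⟨ trans (+-identityʳ _) (trans (*-identityˡ (y * 1)) (*-identityʳ y)) ⟨
    1 * (1 * (y * 1))              ≤⟨ *-monoʳ-≤ 1 (*-mono-≤ (m^n>0 t a) (*-monoʳ-≤ y (m^n>0 y b))) ⟩
    1 * (t ^ a * (y * y ^ b))      ∎
    where open ≤-Reasoning
  poly-bound (p ⊞ p′) {a} {b} da db = begin
    ⟦ p ⟧ (t , y) + ⟦ p′ ⟧ (t , y)   ≤⟨ +-mono-≤ (poly-bound p (≤-trans (m≤m⊔n _ _) da) (≤-trans (m≤m⊔n _ _) db))
                                                 (poly-bound p′ (≤-trans (m≤n⊔m (deg𝕋 p) _) da) (≤-trans (m≤n⊔m (deg𝕐 p) _) db)) ⟩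
    coeff p * X + coeff p′ * X       ≡⟨ *-distribʳ-+ X (coeff p) (coeff p′) ⟨
    (coeff p + coeff p′) * X         ∎
    where open ≤-Reasoning
          X = t ^ a * y ^ b
  poly-bound (p ⊠ p′) {a} {b} da db = begin
    ⟦ p ⟧ (t , y) * ⟦ p′ ⟧ (t , y)
      ≤⟨ *-mono-≤ (poly-bound p ≤-refl ≤-refl) (poly-bound p′ ≤-refl ≤-refl) ⟩
    (coeff p * (t ^ deg𝕋 p * y ^ deg𝕐 p)) * (coeff p′ * (t ^ deg𝕋 p′ * y ^ deg𝕐 p′))
      ≡⟨ regroup (coeff p) (coeff p′) (t ^ deg𝕋 p) (y ^ deg𝕐 p) (t ^ deg𝕋 p′) (y ^ deg𝕐 p′) ⟩
    coeff p * coeff p′ * ((t ^ deg𝕋 p * t ^ deg𝕋 p′) * (y ^ deg𝕐 p * y ^ deg𝕐 p′))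
      ≡⟨ cong₂ (λ u v → coeff p * coeff p′ * (u * v)) (^-distribˡ-+-* t (deg𝕋 p) _) (^-distribˡ-+-* y (deg𝕐 p) _) ⟨
    coeff p * coeff p′ * (t ^ (deg𝕋 p + deg𝕋 p′) * y ^ (deg𝕐 p + deg𝕐 p′))
      ≤⟨ *-monoʳ-≤ (coeff p * coeff p′) (*-mono-≤ (^-monoʳ-≤ t da) (^-monoʳ-≤ y db)) ⟩
    coeff p * coeff p′ * (t ^ a * y ^ b) ∎
    where open ≤-Reasoning
          regroup : ∀ c d u v w z → (c * (u * v)) * (d * (w * z)) ≡ c * d * ((u * w) * (v * z))
          regroup = solve-∀

infixr 3 _⨟_

-- The source language of the whole solver except its loop over the tokens. Each `for` declares an a
-- priori bound on its number of rounds, from which `cost` is read off the syntax.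
data Cmd : Set where
  nop  : Cmd
  put  : Name → Exp → Exp → Cmd
  putᶜ : Name → Exp → CExp → Cmd
  _⨟_  : Cmd → Cmd → Cmd
  ifte : Exp → Cmd → Cmd → Cmd
  for  : Name → Exp → Poly → Cmd → Cmd

infix 10 !_
!_ : Name → Exp
! a = a [ lit 0 ]ᵉ

compile : Cmd → Program
compile nop = skip
compile (put a i e) = a [ i ]≔ᵉ e
compile (putᶜ a i e) = a [ i ]≔ᶜ e
compile (C ⨟ D) = compile C ⨾ compile D
compile (ifte e C D) = IF e THEN compile C ELSE compile D
compile (for x e _ C) =
  x [ lit 0 ]≔ᵉ lit 0 ⨾
  WHILE (e ∸ᵉ ! x) DO (compile C ⨾ x [ lit 0 ]≔ᵉ (! x +ᵉ lit 1))

-- The branches of a conditional are added rather than maximized, which keeps the cost a polynomial.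
cost : Cmd → Poly
cost nop = con 1
cost (put a i e) = con (1 + costᵉ i + costᵉ e)
cost (putᶜ a i e) = con (1 + costᵉ i + costᶜ e)
cost (C ⨟ D) = cost C ⊞ cost D
cost (ifte e C D) = con (1 + costᵉ e) ⊞ (cost C ⊞ cost D)
-- Initialising the counter costs 3, each test `4 + costᵉ e`, each increment 6.
cost (for x e ν C) = con (7 + costᵉ e) ⊞ ν ⊠ (con (10 + costᵉ e) ⊞ cost C)

-- Frame conditions.

writes writesᶜ : Name → Program → Bool
writes b skip = false
writes b (a [ _ ]≔ᵉ _) = b ≡ᵇ a
writes b (_ [ _ ]≔ᶜ _) = false
writes b (P ⨾ Q) = writes b P ∨ writes b Q
writes b (IF _ THEN P ELSE Q) = writes b P ∨ writes b Q
writes b (WHILE _ DO P) = writes b P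

writesᶜ b skip = false
writesᶜ b (_ [ _ ]≔ᵉ _) = false
writesᶜ b (a [ _ ]≔ᶜ _) = b ≡ᵇ a
writesᶜ b (P ⨾ Q) = writesᶜ b P ∨ writesᶜ b Q
writesᶜ b (IF _ THEN P ELSE Q) = writesᶜ b P ∨ writesᶜ b Q
writesᶜ b (WHILE _ DO P) = writesᶜ b P

∨-falseˡ : ∀ {a b} → a ∨ b ≡ false → a ≡ false
∨-falseˡ {false} _ = refl

∨-falseʳ : ∀ a {b} → a ∨ b ≡ false → b ≡ false
∨-falseʳ false eq = eq

-- A frame condition decided by syntax: for the concrete programs below, `writes` evaluates to a
-- Boolean, and the side conditions are closed by `refl`.
record Keep (P : Program) (σ σ′ : State) : Set where
  constructor keeps
  field
    ix : ∀ b → writes b P ≡ false → ∀ j → index σ′ b j ≡ index σ b j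
    ct : ∀ b → writesᶜ b P ≡ false → ∀ j → counter σ′ b j ≡ counter σ b j

open Keep public

keep-refl : ∀ {P σ} → Keep P σ σ
keep-refl = keeps (λ _ _ _ → refl) (λ _ _ _ → refl)

keep-trans : ∀ {P σ σ′ σ″} → Keep P σ σ′ → Keep P σ′ σ″ → Keep P σ σ″
keep-trans k l = keeps (λ b w j → trans (ix l b w j) (ix k b w j)) (λ b w j → trans (ct l b w j) (ct k b w j))

keep-mono : ∀ {P Q σ σ′} → (∀ b → writes b Q ≡ false → writes b P ≡ false) →
            (∀ b → writesᶜ b Q ≡ false → writesᶜ b P ≡ false) → Keep P σ σ′ → Keep Q σ σ′
keep-mono f g k = keeps (λ b w → ix k b (f b w)) (λ b w → ct k b (g b w))

write-other : ∀ M a i v b j → (b ≡ᵇ a) ≡ false → write M a i v b j ≡ M b j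
write-other M a i v b j eq rewrite eq = refl

keep : ∀ {P σ n σ′} → ⟨ P , σ ⟩⇓[ n ] σ′ → Keep P σ σ′
keep ⇓skip = keep-refl
keep (⇓index {σ} {a} {i} {e}) = keeps (λ b w j → write-other (index σ) a _ _ b j w) (λ _ _ _ → refl)
keep (⇓counter {σ} {a}) = keeps (λ _ _ _ → refl) (λ b w j → write-other (counter σ) a _ _ b j w)
keep (⇓seq {P = P} {Q} d d′) =
  keep-trans (keep-mono (λ _ → ∨-falseˡ) (λ _ → ∨-falseˡ) (keep d))
             (keep-mono (λ b → ∨-falseʳ (writes b P)) (λ b → ∨-falseʳ (writesᶜ b P)) (keep d′))
keep (⇓then _ d) = keep-mono (λ _ → ∨-falseˡ) (λ _ → ∨-falseˡ) (keep d)
keep (⇓else {P = P} _ d) = keep-mono (λ b → ∨-falseʳ (writes b P)) (λ b → ∨-falseʳ (writesᶜ b P)) (keep d)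
keep (⇓stop _) = keep-refl
keep (⇓loop _ d d′) = keep-trans (keep-mono (λ _ w → w) (λ _ w → w) (keep d)) (keep d′)

indep : Program → Exp → Bool
indep P (lit _) = true
indep P (a [ e ]ᵉ) = not (writes a P) ∧ indep P e
indep P (e +ᵉ e′) = indep P e ∧ indep P e′
indep P (e ∸ᵉ e′) = indep P e ∧ indep P e′

∧-trueˡ : ∀ {a b} → a ∧ b ≡ true → a ≡ true
∧-trueˡ {true} _ = refl

∧-trueʳ : ∀ a {b} → a ∧ b ≡ true → b ≡ true
∧-trueʳ true eq = eq

not-true : ∀ {a} → not a ≡ true → a ≡ false
not-true {false} _ = refl

keep-exp : ∀ {P σ σ′} e → Keep P σ σ′ → indep P e ≡ true → ⟦ e ⟧ᵉ σ′ ≡ ⟦ e ⟧ᵉ σ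
keep-exp (lit _) k i = refl
keep-exp {P} {σ} {σ′} (a [ e ]ᵉ) k i =
  trans (ix k a (not-true (∧-trueˡ i)) _) (cong (index σ a) (keep-exp e k (∧-trueʳ (not (writes a P)) i)))
keep-exp {P} (e +ᵉ e′) k i = cong₂ _+_ (keep-exp e k (∧-trueˡ i)) (keep-exp e′ k (∧-trueʳ (indep P e) i))
keep-exp {P} (e ∸ᵉ e′) k i = cong₂ _∸_ (keep-exp e k (∧-trueˡ i)) (keep-exp e′ k (∧-trueʳ (indep P e) i))

infixl 8 _⟨_#_≔_⟩ _⟨_≔_⟩ _⟨_#_≔ᶜ_⟩

_⟨_#_≔_⟩ : State → Name → ℕ → ℕ → State
σ ⟨ a # i ≔ v ⟩ = ⟪ write (index σ) a i v , counter σ ⟫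

_⟨_≔_⟩ : State → Name → ℕ → State
σ ⟨ a ≔ v ⟩ = σ ⟨ a # 0 ≔ v ⟩

_⟨_#_≔ᶜ_⟩ : State → Name → ℕ → ℕ → State
σ ⟨ a # i ≔ᶜ v ⟩ = ⟪ index σ , write (counter σ) a i v ⟫

-- A program logic for runs with time bounds.

module Runs (ρ : Env) where

  -- A total-correctness triple with a time bound; in place of a precondition, the initial state is
  -- given explicitly.
  record Runs (C : Cmd) (σ : State) (Q : State → Set) : Set where
    constructor runs
    field
      {steps} : ℕ
      {final} : State
      exec    : ⟨ compile C , σ ⟩⇓[ steps ] final
      bound   : steps ≤ ⟦ cost C ⟧ ρ
      post    : Q final

  open Runs public

  r-nop : ∀ {σ Q} → Q σ → Runs nop σ Q
  r-nop q = runs ⇓skip ≤-refl q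

  r-put : ∀ {a i e σ Q} → Q (σ ⟨ a # ⟦ i ⟧ᵉ σ ≔ ⟦ e ⟧ᵉ σ ⟩) → Runs (put a i e) σ Q
  r-put q = runs ⇓index ≤-refl q

  r-putᶜ : ∀ {a i e σ Q} → Q (σ ⟨ a # ⟦ i ⟧ᵉ σ ≔ᶜ ⟦ e ⟧ᶜ σ ⟩) → Runs (putᶜ a i e) σ Q
  r-putᶜ q = runs ⇓counter ≤-refl q

  r-seq : ∀ {C D σ Q R} → Runs C σ R →
          (∀ σ′ → Keep (compile C) σ σ′ → R σ′ → Runs D σ′ Q) → Runs (C ⨟ D) σ Q
  r-seq (runs d b r) f with runs d′ b′ q ← f _ (keep d) r = runs (⇓seq d d′) (+-mono-≤ b b′) q

  r-put⨟ : ∀ {a i e D σ Q} → Runs D (σ ⟨ a # ⟦ i ⟧ᵉ σ ≔ ⟦ e ⟧ᵉ σ ⟩) Q → Runs (put a i e ⨟ D) σ Q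
  r-put⨟ (runs d b q) = runs (⇓seq ⇓index d) (+-monoʳ-≤ _ b) q

  r-if : ∀ {e C D σ Q} → (⟦ e ⟧ᵉ σ ≢ 0 → Runs C σ Q) → (⟦ e ⟧ᵉ σ ≡ 0 → Runs D σ Q) → Runs (ifte e C D) σ Q
  r-if {e} {C} {D} {σ} f g with ⟦ e ⟧ᵉ σ in eq
  ... | zero with runs d b q ← g refl = runs (⇓else eq d) (+-monoʳ-≤ (1 + costᵉ e) (≤-trans b (m≤n+m _ (⟦ cost C ⟧ ρ)))) q
  ... | suc _ with runs d b q ← f (λ ()) =
          runs (⇓then (λ z → contradiction (trans (sym eq) z) λ ()) d) (+-monoʳ-≤ (1 + costᵉ e) (≤-trans b (m≤m+n _ _))) q

  r-conseq : ∀ {C σ Q R} → Runs C σ R → (∀ σ′ → Keep (compile C) σ σ′ → R σ′ → Q σ′) → Runs C σ Q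
  r-conseq (runs d b r) f = runs d b (f _ (keep d) r)

  -- The value of `e` is constant during the loop and the body leaves `x` alone, so the body runs
  -- exactly `n` times. The invariant speaks of states whose counter is already set, hence the
  -- update of `x` in the premise for `suc k`. Every round may also use the frame since the start of
  -- the loop.
  r-for : ∀ {x e ν C σ Q n} (I : ℕ → State → Set) →
          indep (compile (for x e ν C)) e ≡ true → writes x (compile C) ≡ false →
          ⟦ e ⟧ᵉ σ ≡ n → n ≤ ⟦ ν ⟧ ρ →
          I 0 (σ ⟨ x ≔ 0 ⟩) →
          (∀ k σ′ → k < n → Keep (compile (for x e ν C)) σ σ′ → index σ′ x 0 ≡ k → I k σ′ →
             Runs C σ′ (λ σ″ → I (suc k) (σ″ ⟨ x ≔ suc k ⟩))) →
          (∀ σ′ → Keep (compile (for x e ν C)) σ σ′ → I n σ′ → Q σ′) →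
          Runs (for x e ν C) σ Q
  r-for {x} {e} {ν} {C} {σ} {Q} {n} I ind wx en n≤ν init step fin =
    let (m , σ′ , d , b , kp , i) = loop n 0 (+-identityʳ n) (σ ⟨ x ≔ 0 ⟩) keep-incr (write-self (index σ) 0) init
    in runs (⇓seq ⇓index d) (total b) (fin σ′ kp i)
    where
    P = compile (for x e ν C)
    B = ⟦ cost C ⟧ ρ
    c = costᵉ e

    ≡ᵇ-refl : ∀ k → (k ≡ᵇ k) ≡ true
    ≡ᵇ-refl zero = refl
    ≡ᵇ-refl (suc k) = ≡ᵇ-refl k

    write-self : ∀ M v → write M x 0 v x 0 ≡ v
    write-self M v rewrite ≡ᵇ-refl x = refl

    keep-incr : ∀ {τ v} → Keep P τ (τ ⟨ x ≔ v ⟩)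
    keep-incr {τ} = keeps (λ b w j → write-other (index τ) x _ _ b j (∨-falseˡ w)) (λ _ _ _ → refl)

    keep-body : ∀ {τ τ′} → Keep (compile C) τ τ′ → Keep P τ τ′
    keep-body = keep-mono (λ b w → ∨-falseˡ (∨-falseʳ (b ≡ᵇ x) w)) (λ b w → ∨-falseˡ w)

    step-cost : ∀ r m m′ → m ≤ B → m′ ≤ r * (c + 10 + B) + (c + 4) →
                (1 + (1 + c + 2) + (m + 6) + m′) ≤ suc r * (c + 10 + B) + (c + 4)
    step-cost r m m′ hm hm′ = begin
      1 + (1 + c + 2) + (m + 6) + m′                             ≤⟨ +-mono-≤ (+-monoʳ-≤ (1 + (1 + c + 2)) (+-monoˡ-≤ 6 hm)) hm′ ⟩
      1 + (1 + c + 2) + (B + 6) + (r * (c + 10 + B) + (c + 4))   ≡⟨ regroup c B (r * (c + 10 + B)) ⟩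
      suc r * (c + 10 + B) + (c + 4)                             ∎
      where open ≤-Reasoning
            regroup : ∀ c B z → 1 + (1 + c + 2) + (B + 6) + (z + (c + 4)) ≡ c + 10 + B + z + (c + 4)
            regroup = solve-∀

    loop : ∀ r k → r + k ≡ n → ∀ τ → Keep P σ τ → index τ x 0 ≡ k → I k τ →
           Σ[ m ∈ ℕ ] Σ[ τ′ ∈ State ] (⟨ WHILE (e ∸ᵉ ! x) DO (compile C ⨾ x [ lit 0 ]≔ᵉ (! x +ᵉ lit 1)) , τ ⟩⇓[ m ] τ′)
             × m ≤ r * (c + 10 + B) + (c + 4) × Keep P σ τ′ × I n τ′
    loop zero k refl τ kp xk i = _ , τ , ⇓stop test , ≤-reflexive (cost-eq c) , kp , i
      where
      test : ⟦ e ∸ᵉ ! x ⟧ᵉ τ ≡ 0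
      test rewrite keep-exp e kp ind | en | xk = n∸n≡0 k
      cost-eq : ∀ c → 1 + (1 + c + 2) ≡ c + 4
      cost-eq = solve-∀
    loop (suc r) k eq τ kp xk i
      with runs {m} {τ₁} d b i′ ← step k τ (subst (k <_) eq (s≤s (m≤n+m k r))) kp xk i
      with kp₁ ← keep-trans kp (keep-body (keep d))
      with xk₁ ← trans (ix (keep d) x wx 0) xk
      with bump ← trans (cong (_+ 1) xk₁) (+-comm k 1)
      with m′ , τ′ , d′ , b′ , kp′ , i″ ←
             loop r (suc k) (trans (+-suc r k) eq) (τ₁ ⟨ x ≔ suc k ⟩) (keep-trans kp₁ keep-incr) (write-self (index τ₁) (suc k)) i′
      = _ , τ′ , ⇓loop test (⇓seq d ⇓index) (subst (λ v → ⟨ WHILE (e ∸ᵉ ! x) DO (compile C ⨾ x [ lit 0 ]≔ᵉ (! x +ᵉ lit 1)) , τ₁ ⟨ x ≔ v ⟩ ⟩⇓[ m′ ] τ′) (sym bump) d′)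
        , step-cost r m m′ b b′ , kp′ , i″
      where
      test : ⟦ e ∸ᵉ ! x ⟧ᵉ τ ≢ 0
      test rewrite keep-exp e kp ind | en | xk | sym eq = λ z → m+1+n≢0 0 (trans (sym (m+n∸n≡m (suc r) k)) z)

    total : ∀ {m} → m ≤ n * (c + 10 + B) + (c + 4) → 3 + m ≤ 7 + c + ⟦ ν ⟧ ρ * (10 + c + B)
    total {m} h = begin
      3 + m                                   ≤⟨ +-monoʳ-≤ 3 h ⟩
      3 + (n * (c + 10 + B) + (c + 4))        ≤⟨ +-monoʳ-≤ 3 (+-monoˡ-≤ (c + 4) (*-monoˡ-≤ (c + 10 + B) n≤ν)) ⟩
      3 + (⟦ ν ⟧ ρ * (c + 10 + B) + (c + 4))  ≡⟨ regroup c B (⟦ ν ⟧ ρ) ⟩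
      7 + c + ⟦ ν ⟧ ρ * (10 + c + B)          ∎
      where open ≤-Reasoning
            regroup : ∀ c B v → 3 + (v * (c + 10 + B) + (c + 4)) ≡ 7 + c + v * (10 + c + B)
            regroup = solve-∀

-- Binary numbers

bit : Bool → ℕ
bit b = if b then 1 else 0

bit-injective : ∀ {a b} → bit a ≡ bit b → a ≡ b
bit-injective {false} {false} _ = refl
bit-injective {true}  {true}  _ = refl

bit≤1 : ∀ b → bit b ≤ 1
bit≤1 false = z≤n
bit≤1 true  = ≤-refl

bit-∧ : ∀ a b → (bit a + bit b) ∸ 1 ≡ bit (a ∧ b)
bit-∧ false false = refl
bit-∧ false true  = refl
bit-∧ true  false = refl
bit-∧ true  true  = refl

bit-xor : ∀ a b → (bit a ∸ bit b) + (bit b ∸ bit a) ≡ bit (a xor b)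
bit-xor false false = refl
bit-xor false true  = refl
bit-xor true  false = refl
bit-xor true  true  = refl

bit-not : ∀ a → 1 ∸ bit a ≡ bit (not a)
bit-not false = refl
bit-not true  = refl

-- These recursions for parity and half are the ones by which `halfTable` fills its tables, since
-- the machine has no division.
odd : ℕ → Bool
odd zero    = false
odd (suc n) = not (odd n)

half : ℕ → ℕ
half zero    = 0
half (suc n) = half n + bit (odd n)

odd-half : ∀ n → n ≡ bit (odd n) + (half n + half n)
odd-half zero = refl
odd-half (suc n) with odd n | odd-half n
... | false | eq = trans (cong suc eq) (cong suc (sym (cong₂ _+_ (+-identityʳ (half n)) (+-identityʳ (half n)))))
... | true  | eq = trans (cong suc eq) (shuffle (half n))
  where shuffle : ∀ h → suc (suc (h + h)) ≡ h + 1 + (h + 1)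
        shuffle = solve-∀

half≤ : ∀ n → half n ≤ n
half≤ n = begin
  half n                            ≤⟨ m≤m+n (half n) (half n) ⟩
  half n + half n                   ≤⟨ m≤n+m _ (bit (odd n)) ⟩
  bit (odd n) + (half n + half n)   ≡⟨ odd-half n ⟨
  n                                 ∎
  where open ≤-Reasoning

odd-double : ∀ m → odd (m + m) ≡ false
odd-double zero = refl
odd-double (suc m) rewrite +-suc m m = trans (not-involutive _) (odd-double m)

odd-bit+ : ∀ b m → odd (bit b + (m + m)) ≡ b
odd-bit+ false m = odd-double m
odd-bit+ true  m = cong not (odd-double m)

half-double : ∀ m → half (m + m) ≡ m
half-double zero = refl
half-double (suc m) rewrite +-suc m m | odd-double m | +-identityʳ (half (m + m)) = trans (+-comm _ 1) (cong suc (half-double m))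

half-bit+ : ∀ b m → half (bit b + (m + m)) ≡ m
half-bit+ false m = half-double m
half-bit+ true  m rewrite odd-double m = trans (+-identityʳ _) (half-double m)

halves : ℕ → ℕ → ℕ
halves zero    x = x
halves (suc k) x = half (halves k x)

halves≤ : ∀ k x → halves k x ≤ x
halves≤ zero    x = ≤-refl
halves≤ (suc k) x = ≤-trans (half≤ _) (halves≤ k x)

bitAt : ℕ → ℕ → Bool
bitAt x k = odd (halves k x)

binary : ℕ → (ℕ → Bool) → ℕ
binary zero    f = 0
binary (suc n) f = binary n f + bit (f n) * 2 ^ n

private
  carry : ∀ c b p m → c + b * p + 2 * p * m ≡ c + p * (b + (m + m))
  carry = solve-∀

-- In the induction the top digit moves into the tail: `m` becomes `bit (f n) + (m + m)`. This is
-- why both statements allow an arbitrary tail above digit `n`; the tail later holds the second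
-- component of a label pair.
halves-binary : ∀ n f m → halves n (binary n f + 2 ^ n * m) ≡ m
bitAt-binary  : ∀ n f m {k} → k < n → bitAt (binary n f + 2 ^ n * m) k ≡ f k

halves-binary zero    f m = +-identityʳ m
halves-binary (suc n) f m rewrite carry (binary n f) (bit (f n)) (2 ^ n) m | halves-binary n f (bit (f n) + (m + m)) =
  half-bit+ (f n) m

bitAt-binary (suc n) f m {k} k<sn rewrite carry (binary n f) (bit (f n)) (2 ^ n) m with m≤n⇒m<n∨m≡n (≤-pred k<sn)
... | inj₁ k<n = bitAt-binary n f _ k<n
... | inj₂ refl = trans (cong odd (halves-binary n f (bit (f n) + (m + m)))) (odd-bit+ (f n) m)

binary-cong : ∀ n {f g} → (∀ {k} → k < n → f k ≡ g k) → binary n f ≡ binary n g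
binary-cong zero    h = refl
binary-cong (suc n) h = cong₂ (λ x b → x + bit b * 2 ^ n) (binary-cong n (λ k<n → h (m<n⇒m<1+n k<n))) (h ≤-refl)

binary-expand : ∀ n r → r ≡ binary n (bitAt r) + 2 ^ n * halves n r
binary-expand zero    r = sym (+-identityʳ r)
binary-expand (suc n) r = begin
  r                                             ≡⟨ binary-expand n r ⟩
  c + 2 ^ n * halves n r                        ≡⟨ cong (λ z → c + 2 ^ n * z) (odd-half (halves n r)) ⟩
  c + 2 ^ n * (bit (bitAt r n) + (h + h))       ≡⟨ carry c (bit (bitAt r n)) (2 ^ n) h ⟨
  c + bit (bitAt r n) * 2 ^ n + 2 * 2 ^ n * h   ∎
  where open ≡-Reasoning
        c = binary n (bitAt r)
        h = halves (suc n) r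

binary<2^n : ∀ n f → binary n f < 2 ^ n
binary<2^n zero    f = ≤-refl
binary<2^n (suc n) f = begin-strict
  binary n f + bit (f n) * 2 ^ n   <⟨ +-mono-<-≤ (binary<2^n n f) (*-monoˡ-≤ (2 ^ n) (bit≤1 (f n))) ⟩
  2 ^ n + 1 * 2 ^ n                ≡⟨⟩
  2 * 2 ^ n                        ∎
  where open ≤-Reasoning

halves-zero : ∀ n {r} → r < 2 ^ n → halves n r ≡ 0
halves-zero n {r} r< with halves n r | binary-expand n r
... | zero  | _  = refl
... | suc h | eq = contradiction r< (≤⇒≯ (begin
  2 ^ n                                      ≤⟨ m≤m*n (2 ^ n) (suc h) ⟩
  2 ^ n * suc h                              ≤⟨ m≤n+m _ (binary n (bitAt r)) ⟩
  binary n (bitAt r) + 2 ^ n * suc h         ≡⟨ eq ⟨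
  r                                          ∎))
  where open ≤-Reasoning

at : ∀ {n} → Vec Bool n → ℕ → Bool
at []      _       = false
at (b ∷ v) zero    = b
at (b ∷ v) (suc k) = at v k

tab : ∀ n → (ℕ → Bool) → Vec Bool n
tab zero    f = []
tab (suc n) f = f 0 ∷ tab n (f ∘ suc)

at-tab : ∀ n f {k} → k < n → at (tab n f) k ≡ f k
at-tab (suc n) f {zero}  _       = refl
at-tab (suc n) f {suc k} (s≤s h) = at-tab n (f ∘ suc) h

vec-ext : ∀ {n} {u v : Vec Bool n} → (∀ {k} → k < n → at u k ≡ at v k) → u ≡ v
vec-ext {u = []}    {[]}    h = refl
vec-ext {u = _ ∷ _} {_ ∷ _} h = cong₂ _∷_ (h (s≤s z≤n)) (vec-ext (λ k<n → h (s≤s k<n)))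

vec : ∀ n → ℕ → Vec Bool n
vec n r = tab n (bitAt r)

code : ∀ {n} → Vec Bool n → ℕ
code {n} v = binary n (at v)

vec-code+ : ∀ {n} (v : Vec Bool n) m → vec n (code v + 2 ^ n * m) ≡ v
vec-code+ {n} v m = vec-ext (λ k<n → trans (at-tab n _ k<n) (bitAt-binary n (at v) m k<n))

vec-code : ∀ {n} (v : Vec Bool n) → vec n (code v) ≡ v
vec-code {n} v = trans (cong (vec n) (sym (trans (cong (code v +_) (*-zeroʳ (2 ^ n))) (+-identityʳ _)))) (vec-code+ v 0)

code-vec : ∀ n r → code (vec n r) ≡ binary n (bitAt r)
code-vec n r = binary-cong n (at-tab n _)

-- Sets of numbers below n, coded by Horner's rule

-- Unlike in `binary`, the value read last is the least significant digit, so a key can be built by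
-- doubling while its set is scanned upwards.
horner : ℕ → (ℕ → Bool) → ℕ
horner zero    f = 0
horner (suc n) f = horner n f + horner n f + bit (f n)

double+bit-injective : ∀ {x y a b} → x + x + bit a ≡ y + y + bit b → x ≡ y × a ≡ b
double+bit-injective {x} {y} {a} {b} eq = trans (sym (half-bit+ a x)) (trans (cong half eq′) (half-bit+ b y))
                                        , trans (sym (odd-bit+ a x)) (trans (cong odd eq′) (odd-bit+ b y))
  where eq′ : bit a + (x + x) ≡ bit b + (y + y)
        eq′ = trans (+-comm (bit a) _) (trans eq (+-comm _ (bit b)))

horner-injective : ∀ n {f g} → horner n f ≡ horner n g → ∀ {r} → r < n → f r ≡ g r
horner-injective (suc n) {f} {g} eq {r} r< with double+bit-injective {horner n f} {horner n g} {f n} {g n} eq | m≤n⇒m<n∨m≡n (≤-pred r<)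
... | e , _ | inj₁ r<n = horner-injective n e r<n
... | _ , e | inj₂ refl = e

horner-cong : ∀ n {f g} → (∀ {r} → r < n → f r ≡ g r) → horner n f ≡ horner n g
horner-cong zero    h = refl
horner-cong (suc n) h = cong₂ (λ x b → x + x + bit b) (horner-cong n (λ r<n → h (m<n⇒m<1+n r<n))) (h ≤-refl)

horner<2^n : ∀ n f → horner n f < 2 ^ n
horner<2^n zero    f = ≤-refl
horner<2^n (suc n) f = begin
  suc (h + h + bit (f n))   ≤⟨ s≤s (+-monoʳ-≤ (h + h) (bit≤1 (f n))) ⟩
  suc (h + h + 1)           ≡⟨ shuffle h ⟩
  suc h + (suc h + 0)       ≤⟨ +-mono-≤ h< (+-monoˡ-≤ 0 h<) ⟩
  2 * 2 ^ n                 ∎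
  where open ≤-Reasoning
        h = horner n f
        h< = horner<2^n n f
        shuffle : ∀ h → suc (h + h + 1) ≡ suc h + (suc h + 0)
        shuffle = solve-∀

-- Uniqueness of quotient and remainder; it makes two-dimensional addresses free of collisions.
*+-injective : ∀ {Q a b r s} → r < Q → s < Q → a * Q + r ≡ b * Q + s → a ≡ b × r ≡ s
*+-injective {Q} {zero}  {zero}  _  _  eq = refl , eq
*+-injective {Q} {zero}  {suc b} {r} {s} r< _ eq = contradiction r< (≤⇒≯ (begin
  Q                  ≤⟨ m≤m+n Q (b * Q + s) ⟩
  Q + (b * Q + s)    ≡⟨ +-assoc Q _ s ⟨
  suc b * Q + s      ≡⟨ eq ⟨
  r                  ∎))
  where open ≤-Reasoning
*+-injective {Q} {suc a} {zero}  {r} {s} _ s< eq = contradiction s< (≤⇒≯ (begin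
  Q                  ≤⟨ m≤m+n Q (a * Q + r) ⟩
  Q + (a * Q + r)    ≡⟨ +-assoc Q _ r ⟨
  suc a * Q + r      ≡⟨ eq ⟩
  s                  ∎))
  where open ≤-Reasoning
*+-injective {Q} {suc a} {suc b} {r} {s} r< s< eq
  with e , e′ ← *+-injective {Q} {a} {b} r< s< (+-cancelˡ-≡ Q _ _ (trans (sym (+-assoc Q _ r)) (trans eq (+-assoc Q _ s))))
  = cong suc e , e′

-- Linear algebra over GF(2)

xsum : ℕ → (ℕ → Bool) → Bool
xsum zero    f = false
xsum (suc n) f = xsum n f xor f n

xsum-head : ∀ n f → xsum (suc n) f ≡ f 0 xor xsum n (f ∘ suc)
xsum-head zero    f = sym (xor-identityʳ (f 0))
xsum-head (suc n) f = trans (cong (_xor f (suc n)) (xsum-head n f)) (xor-assoc (f 0) _ _)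

xsum-cong : ∀ n {f g} → (∀ {k} → k < n → f k ≡ g k) → xsum n f ≡ xsum n g
xsum-cong zero    h = refl
xsum-cong (suc n) h = cong₂ _xor_ (xsum-cong n (λ k<n → h (m<n⇒m<1+n k<n))) (h ≤-refl)

·-xsum : ∀ {n} (u v : Label n) → u · v ≡ xsum n (λ k → at u k ∧ at v k)
·-xsum [] [] = refl
·-xsum {suc n} (a ∷ u) (b ∷ v) = trans (cong ((a ∧ b) xor_) (·-xsum u v)) (sym (xsum-head n (λ k → at (a ∷ u) k ∧ at (b ∷ v) k)))

·-comm : ∀ {n} (u v : Label n) → u · v ≡ v · u
·-comm [] [] = refl
·-comm (a ∷ u) (b ∷ v) = cong₂ _xor_ (∧-comm a b) (·-comm u v)

xor-interchange : ∀ a b c d → (a xor b) xor (c xor d) ≡ (a xor c) xor (b xor d)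
xor-interchange false b c d = trans (sym (xor-assoc b c d)) (trans (cong (_xor d) (xor-comm b c)) (xor-assoc c b d))
xor-interchange true false c d = sym (not-xor c d)
  where not-xor : ∀ c d → not c xor d ≡ not (c xor d)
        not-xor false d = refl
        not-xor true  d = sym (not-involutive d)
xor-interchange true true false d = sym (not-involutive d)
xor-interchange true true true  d = refl

·-distribˡ-⊕ : ∀ {n} (u v w : Label n) → u · (v ⊕ w) ≡ (u · v) xor (u · w)
·-distribˡ-⊕ [] [] [] = refl
·-distribˡ-⊕ (a ∷ u) (b ∷ v) (c ∷ w) =
  trans (cong₂ _xor_ (∧-distribˡ-xor a b c) (·-distribˡ-⊕ u v w)) (xor-interchange (a ∧ b) (a ∧ c) (u · v) (u · w))

·-scale : ∀ {n} (u v : Label n) b → u · Vec.map (b ∧_) v ≡ b ∧ (u · v)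
·-scale [] [] b = sym (∧-zeroʳ b)
·-scale (a ∷ u) (c ∷ v) b = trans (cong₂ _xor_ (swap a b c) (·-scale u v b)) (sym (∧-distribˡ-xor b (a ∧ c) (u · v)))
  where swap : ∀ a b c → a ∧ (b ∧ c) ≡ b ∧ (a ∧ c)
        swap a b c = trans (sym (∧-assoc a b c)) (trans (cong (_∧ c) (∧-comm a b)) (∧-assoc b a c))

·-zeroʳ : ∀ {n} (u : Label n) → u · Vec.replicate n false ≡ false
·-zeroʳ [] = refl
·-zeroʳ (a ∷ u) = cong₂ _xor_ (∧-zeroʳ a) (·-zeroʳ u)

zeroˡ-· : ∀ {n} (v : Label n) → Vec.replicate n false · v ≡ false
zeroˡ-· v = trans (·-comm _ v) (·-zeroʳ v)

infixl 7 _·ᵀ_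

_·ᵀ_ : ∀ {m n} → Label n → Matrix m n → Label m
v ·ᵀ R = Vec.map (_· v) R

·ᵀ-adjoint : ∀ {m n} (u : Label m) (R : Matrix m n) (v : Label n) → (v ·ᵀ R) · u ≡ v · (u ·ᴹ R)
·ᵀ-adjoint [] [] v = sym (·-zeroʳ v)
·ᵀ-adjoint (b ∷ u) (r ∷ R) v = begin
  ((r · v) ∧ b) xor (v ·ᵀ R) · u                   ≡⟨ cong₂ _xor_ (trans (∧-comm _ b) (cong (b ∧_) (·-comm r v))) (·ᵀ-adjoint u R v) ⟩
  (b ∧ (v · r)) xor v · (u ·ᴹ R)                   ≡⟨ cong (_xor v · (u ·ᴹ R)) (·-scale v r b) ⟨
  (v · Vec.map (b ∧_) r) xor v · (u ·ᴹ R)          ≡⟨ ·-distribˡ-⊕ v _ _ ⟨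
  v · (Vec.map (b ∧_) r ⊕ u ·ᴹ R)                  ∎
  where open ≡-Reasoning

entry : ∀ {m n} → Matrix m n → ℕ → ℕ → Bool
entry []      _       l = false
entry (r ∷ R) zero    l = at r l
entry (r ∷ R) (suc k) l = entry R k l

at-⊕ : ∀ {n} (u v : Label n) l → at (u ⊕ v) l ≡ at u l xor at v l
at-⊕ [] [] l = refl
at-⊕ (_ ∷ _) (_ ∷ _) zero = refl
at-⊕ (_ ∷ u) (_ ∷ v) (suc l) = at-⊕ u v l

at-scale : ∀ {n} b (u : Label n) l → at (Vec.map (b ∧_) u) l ≡ b ∧ at u l
at-scale b [] l = sym (∧-zeroʳ b)
at-scale b (_ ∷ _) zero = refl
at-scale b (_ ∷ u) (suc l) = at-scale b u l

at-zero : ∀ n l → at (Vec.replicate n false) l ≡ false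
at-zero zero l = refl
at-zero (suc n) zero = refl
at-zero (suc n) (suc l) = at-zero n l

at-·ᴹ : ∀ {m n} (v : Label m) (R : Matrix m n) l → at (v ·ᴹ R) l ≡ xsum m (λ k → at v k ∧ entry R k l)
at-·ᴹ {n = n} [] [] l = at-zero n l
at-·ᴹ {suc m} (b ∷ v) (r ∷ R) l = begin
  at (Vec.map (b ∧_) r ⊕ v ·ᴹ R) l                                   ≡⟨ at-⊕ (Vec.map (b ∧_) r) (v ·ᴹ R) l ⟩
  at (Vec.map (b ∧_) r) l xor at (v ·ᴹ R) l                          ≡⟨ cong₂ _xor_ (at-scale b r l) (at-·ᴹ v R l) ⟩
  (b ∧ at r l) xor xsum m (λ k → at v k ∧ entry R k l)               ≡⟨ xsum-head m (λ k → at (b ∷ v) k ∧ entry (r ∷ R) k l) ⟨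
  xsum (suc m) (λ k → at (b ∷ v) k ∧ entry (r ∷ R) k l)              ∎
  where open ≡-Reasoning

at-·ᵀ : ∀ {m n} (v : Label n) (R : Matrix m n) {l} → l < m → at (v ·ᵀ R) l ≡ xsum n (λ k → at v k ∧ entry R l k)
at-·ᵀ {n = n} v (r ∷ R) {zero} _ = trans (·-comm r v) (·-xsum v r)
at-·ᵀ v (r ∷ R) {suc l} (s≤s h) = at-·ᵀ v R h

-- The flag selects the transpose. With both products in one operation, passing to the adjoint is
-- just negation of the flag.
mul : ∀ {t} → Bool → Relabeling t → Label t → Label t
mul tr R v = if tr then v ·ᵀ R else v ·ᴹ R

entryᵀ : ∀ {t} → Bool → Relabeling t → ℕ → ℕ → Bool
entryᵀ tr R k l = if tr then entry R l k else entry R k l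

at-mul : ∀ {t} tr (R : Relabeling t) v {l} → l < t → at (mul tr R v) l ≡ xsum t (λ k → at v k ∧ entryᵀ tr R k l)
at-mul false R v {l} _  = at-·ᴹ v R l
at-mul true  R v     l< = at-·ᵀ v R l<

mul-adjoint : ∀ {t} tr (R : Relabeling t) u v → mul tr R u · v ≡ u · mul (not tr) R v
mul-adjoint false R u v = trans (·-comm _ v) (trans (sym (·ᵀ-adjoint u R v)) (·-comm _ u))
mul-adjoint true  R u v = ·ᵀ-adjoint v R u

-- Memory frames

≡ᵇ-reflexive : ∀ k → (k ≡ᵇ k) ≡ true
≡ᵇ-reflexive zero    = refl
≡ᵇ-reflexive (suc k) = ≡ᵇ-reflexive k

-- Stated for the bare test on addresses, because `write` reduces to it as soon as both memory names
-- are the same numeral.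
at-write : ∀ j i {v x w : ℕ} → (j ≡ i → v ≡ w) → (j ≢ i → x ≡ w) → (if j ≡ᵇ i then v else x) ≡ w
at-write zero    zero    f g = f refl
at-write zero    (suc i) f g = g λ ()
at-write (suc j) zero    f g = g λ ()
at-write (suc j) (suc i) f g = at-write j i (λ e → f (cong suc e)) (λ n → g (λ e → n (suc-injective e)))

at-write≡ : ∀ j {v x : ℕ} → (if j ≡ᵇ j then v else x) ≡ v
at-write≡ j = at-write j j (λ _ → refl) (λ n → contradiction refl n)

above : ℕ → Program → Bool
above K skip = true
above K (a [ _ ]≔ᵉ _) = K ≤ᵇ a
above K (_ [ _ ]≔ᶜ _) = true
above K (P ⨾ Q) = above K P ∧ above K Q
above K (IF _ THEN P ELSE Q) = above K P ∧ above K Q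
above K (WHILE _ DO P) = above K P

<ᵇ-≤ᵇ-≢ : ∀ b K a → (b <ᵇ K) ≡ true → (K ≤ᵇ a) ≡ true → (b ≡ᵇ a) ≡ false
<ᵇ-≤ᵇ-≢ zero    (suc K) (suc a) _ _ = refl
<ᵇ-≤ᵇ-≢ (suc b) (suc K) (suc a) p q = <ᵇ-≤ᵇ-≢ b K a p (shift K q)
  where shift : ∀ K → (K <ᵇ suc a) ≡ true → (K ≤ᵇ a) ≡ true
        shift zero    _ = refl
        shift (suc K) q = q

above-writes : ∀ {K} P b → above K P ≡ true → (b <ᵇ K) ≡ true → writes b P ≡ false
above-writes skip b _ _ = refl
above-writes {K} (a [ _ ]≔ᵉ _) b q p = <ᵇ-≤ᵇ-≢ b K a p q
above-writes (_ [ _ ]≔ᶜ _) b _ _ = refl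
above-writes {K} (P ⨾ Q) b q p = cong₂ _∨_ (above-writes P b (∧-trueˡ q) p) (above-writes Q b (∧-trueʳ (above K P) q) p)
above-writes {K} (IF _ THEN P ELSE Q) b q p = cong₂ _∨_ (above-writes P b (∧-trueˡ q) p) (above-writes Q b (∧-trueʳ (above K P) q) p)
above-writes (WHILE _ DO P) b q p = above-writes P b q p

-- The memories are numbered so that one threshold protects a whole invariant: the input lies below
-- 4, `Basic` below 7, `Fam` below 12, `Ready` below 15, and `Loaded` below 16.
record Agree (K : ℕ) (σ σ′ : State) : Set where
  constructor agrees
  field low : ∀ b → (b <ᵇ K) ≡ true → ∀ j → index σ′ b j ≡ index σ b j

open Agree public

keep-agree : ∀ K {P σ σ′} → above K P ≡ true → Keep P σ σ′ → Agree K σ σ′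
keep-agree K {P} q k = agrees λ b p → ix k b (above-writes P b q p)

agree-put : ∀ {K σ a i v} → (K ≤ᵇ a) ≡ true → Agree K σ (σ ⟨ a # i ≔ v ⟩)
agree-put {K} {σ} {a} p = agrees λ b q j → write-other (index σ) a _ _ b j (<ᵇ-≤ᵇ-≢ b K a q p)

agree-trans : ∀ {K σ σ′ σ″} → Agree K σ σ′ → Agree K σ′ σ″ → Agree K σ σ″
agree-trans f g = agrees λ b p j → trans (low g b p j) (low f b p j)

<ᵇ-weaken : ∀ b m n → (b <ᵇ m) ≡ true → (b <ᵇ (m + n)) ≡ true
<ᵇ-weaken zero    (suc m) n _ = refl
<ᵇ-weaken (suc b) (suc m) n p = <ᵇ-weaken b m n p

agree-weaken : ∀ K n {σ σ′} → Agree (K + n) σ σ′ → Agree K σ σ′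
agree-weaken K n a = agrees λ b p → low a b (<ᵇ-weaken b K n p)

token-agree : ∀ s {σ σ′} → Agree 4 σ σ′ → ∀ j → index σ′ (2 + bit s) j ≡ index σ (2 + bit s) j
token-agree false f = low f 2 refl
token-agree true  f = low f 3 refl

module Dims (t⁺ t⁻ : ℕ) where

  τ q : ℕ
  τ = t⁺ + t⁻
  q = 2 ^ τ

  dim : Bool → ℕ
  dim s = if s then t⁻ else t⁺

  dim≤τ : ∀ s → dim s ≤ τ
  dim≤τ false = m≤m+n t⁺ t⁻
  dim≤τ true  = m≤n+m t⁻ t⁺

-- Sets of labels cut out by orthogonality conditions

module Labels (t⁺ t⁻ : ℕ) where

  open Dims t⁺ t⁻

  V : Set
  V = Label t⁺ × Label t⁻

  infixl 7 _∙_
  _∙_ : V → V → Bool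
  (u , v) ∙ (u′ , v′) = (u · u′) xor (v · v′)

  vector : ℕ → V
  vector r = vec t⁺ r , vec t⁻ (halves t⁺ r)

  number : V → ℕ
  number (u , v) = code u + 2 ^ t⁺ * code v

  number<q : ∀ v → number v < q
  number<q (u , v) = begin-strict
    code u + 2 ^ t⁺ * code v      <⟨ +-monoˡ-< _ (binary<2^n t⁺ (at u)) ⟩
    2 ^ t⁺ + 2 ^ t⁺ * code v      ≡⟨ *-suc (2 ^ t⁺) (code v) ⟨
    2 ^ t⁺ * suc (code v)         ≤⟨ *-monoʳ-≤ (2 ^ t⁺) (binary<2^n t⁻ (at v)) ⟩
    2 ^ t⁺ * 2 ^ t⁻               ≡⟨ ^-distribˡ-+-* 2 t⁺ t⁻ ⟨
    2 ^ (t⁺ + t⁻)                 ∎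
    where open ≤-Reasoning

  vector-number : ∀ v → vector (number v) ≡ v
  vector-number (u , v) = cong₂ _,_ (vec-code+ u (code v)) (trans (cong (vec t⁻) (halves-binary t⁺ (at u) (code v))) (vec-code v))

  ann : List V → V → Bool
  ann []      r = true
  ann (u ∷ U) r = ann U r ∧ not (u ∙ r)

  char : List V → ℕ → Bool
  char U r = ann U (vector r)

  key : List V → ℕ
  key U = horner q (char U)

  infix 4 _≈_
  record _≈_ (U U′ : List V) : Set where
    constructor by
    field on : ∀ v → ann U v ≡ ann U′ v

  open _≈_ public

  ≈⇒key : ∀ {U U′} → U ≈ U′ → key U ≡ key U′
  ≈⇒key h = horner-cong q (λ {r} _ → on h (vector r))

  -- Every label pair has a number below `q`, so the `q` digits of a key determine the whole
  -- annihilator.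
  key⇒≈ : ∀ {U U′} → key U ≡ key U′ → U ≈ U′
  key⇒≈ {U} {U′} eq = by λ v → subst (λ v → ann U v ≡ ann U′ v) (vector-number v) (horner-injective q eq (number<q v))

  ∷-≈ : ∀ {u U U′} → U ≈ U′ → (u ∷ U) ≈ (u ∷ U′)
  ∷-≈ {u} h = by λ v → cong (_∧ not (u ∙ v)) (on h v)

  ∧-swap : ∀ a b c → (a ∧ b) ∧ c ≡ (a ∧ c) ∧ b
  ∧-swap a b c = trans (∧-assoc a b c) (trans (cong (a ∧_) (∧-comm b c)) (sym (∧-assoc a c b)))

  ann-++ : ∀ U U′ r → ann (U ++ U′) r ≡ ann U r ∧ ann U′ r
  ann-++ [] U′ r = refl
  ann-++ (u ∷ U) U′ r = trans (cong (_∧ not (u ∙ r)) (ann-++ U U′ r)) (∧-swap (ann U r) (ann U′ r) _)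

  -- Both kinds of edges incident with a variable of known value are seen
  -- through a single sign: + for true, − for false.
  data Pure : V → Set where
    pure⁺ : ∀ u → Pure (u , Vec.replicate t⁻ false)
    pure⁻ : ∀ v → Pure (Vec.replicate t⁺ false , v)

  nth : List (List V) → ℕ → List V
  nth []      _       = []
  nth (U ∷ _) zero    = U
  nth (_ ∷ L) (suc i) = nth L i

  HasKey : List (List V) → ℕ → Set
  HasKey L k = ∃ λ i → i < length L × key (nth L i) ≡ k

  Distinct : List (List V) → Set
  Distinct L = ∀ {i j} → i < length L → j < length L → key (nth L i) ≡ key (nth L j) → i ≡ j

  AllPure : List (List V) → Set
  AllPure L = ∀ {i} → i < length L → All Pure (nth L i)

  record _⊑_ (L L′ : List (List V)) : Set where
    constructor ext
    field
      longer : length L ≤ length L′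
      same   : ∀ {i} → i < length L → nth L′ i ≡ nth L i

  open _⊑_ public

  ⊑-refl : ∀ {L} → L ⊑ L
  ⊑-refl = ext ≤-refl (λ _ → refl)

  ⊑-trans : ∀ {L L′ L″} → L ⊑ L′ → L′ ⊑ L″ → L ⊑ L″
  ⊑-trans (ext l s) (ext l′ s′) = ext (≤-trans l l′) (λ i< → trans (s′ (<-≤-trans i< l)) (s i<))

  hasKey-⊑ : ∀ {L L′ k} → L ⊑ L′ → HasKey L k → HasKey L′ k
  hasKey-⊑ e (i , i< , eq) = i , <-≤-trans i< (longer e) , trans (cong key (same e i<)) eq

  length-∷ʳ : ∀ L (U : List V) → length (L ++ U ∷ []) ≡ suc (length L)
  length-∷ʳ [] U = refl
  length-∷ʳ (_ ∷ L) U = cong suc (length-∷ʳ L U)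

  nth-∷ʳ : ∀ L U → nth (L ++ U ∷ []) (length L) ≡ U
  nth-∷ʳ [] U = refl
  nth-∷ʳ (_ ∷ L) U = nth-∷ʳ L U

  ⊑-∷ʳ : ∀ L U → L ⊑ (L ++ U ∷ [])
  ⊑-∷ʳ L U = ext (subst (length L ≤_) (sym (length-∷ʳ L U)) (n≤1+n _)) (go L)
    where go : ∀ L {i} → i < length L → nth (L ++ U ∷ []) i ≡ nth L i
          go (_ ∷ L) {zero} _ = refl
          go (_ ∷ L) {suc i} (s≤s h) = go L h

  ∷ʳ-case : ∀ L U {i} → i < length (L ++ U ∷ []) → i < length L ⊎ i ≡ length L
  ∷ʳ-case L U i< = m≤n⇒m<n∨m≡n (≤-pred (subst (_ <_) (length-∷ʳ L U) i<))

  distinct-∷ʳ : ∀ L U → Distinct L → ¬ HasKey L (key U) → Distinct (L ++ U ∷ [])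
  distinct-∷ʳ L U d new {i} {j} i< j< eq with ∷ʳ-case L U i< | ∷ʳ-case L U j<
  ... | inj₁ i<′  | inj₁ j<′  = d i<′ j<′ (trans (cong key (sym (same (⊑-∷ʳ L U) i<′))) (trans eq (cong key (same (⊑-∷ʳ L U) j<′))))
  ... | inj₁ i<′  | inj₂ refl = contradiction (i , i<′ , trans (cong key (sym (same (⊑-∷ʳ L U) i<′))) (trans eq (cong key (nth-∷ʳ L U)))) new
  ... | inj₂ refl | inj₁ j<′  = contradiction (j , j<′ , trans (cong key (sym (same (⊑-∷ʳ L U) j<′))) (trans (sym eq) (cong key (nth-∷ʳ L U)))) new
  ... | inj₂ refl | inj₂ refl = refl

  allPure-∷ʳ : ∀ L U → AllPure L → All Pure U → AllPure (L ++ U ∷ [])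
  allPure-∷ʳ L U p pU i< with ∷ʳ-case L U i<
  ... | inj₁ i<′  = subst (All Pure) (sym (same (⊑-∷ʳ L U) i<′)) (p i<′)
  ... | inj₂ refl = subst (All Pure) (sym (nth-∷ʳ L U)) pU

  Complete : (V → Set) → List (List V) → Set
  Complete P L = ∀ {U} → All P U → HasKey L (key U)

  complete-mono : ∀ {P P′ : V → Set} L → (∀ {v} → P v → P′ v) → Complete P′ L → Complete P L
  complete-mono L f c pU = c (All.map f pU)

  ∧-absorb : ∀ a b → (a ∧ b) ∧ b ≡ a ∧ b
  ∧-absorb false b     = refl
  ∧-absorb true  false = refl
  ∧-absorb true  true  = refl

  -- Repeated constraints are redundant, so u is needed at most once.
  split : ∀ {P : V → Set} {u U} → All (λ v → P v ⊎ v ≡ u) U → ∃ λ U′ → All P U′ × (U ≈ U′ ⊎ U ≈ (u ∷ U′))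
  split [] = [] , [] , inj₁ (by λ _ → refl)
  split {u = u} {v ∷ U} (inj₁ p ∷ pU) with split pU
  ... | U′ , pU′ , inj₁ h = v ∷ U′ , p ∷ pU′ , inj₁ (∷-≈ {v} h)
  ... | U′ , pU′ , inj₂ h = v ∷ U′ , p ∷ pU′ , inj₂ (by λ w → trans (cong (_∧ not (v ∙ w)) (on h w)) (∧-swap (ann U′ w) _ _))
  split {u = u} (inj₂ refl ∷ pU) with split pU
  ... | U′ , pU′ , inj₁ h = U′ , pU′ , inj₂ (∷-≈ {u} h)
  ... | U′ , pU′ , inj₂ h = U′ , pU′ , inj₂ (by λ w → trans (cong (_∧ not (u ∙ w)) (on h w)) (∧-absorb (ann U′ w) _))

  -- By `split`, up to its annihilator a set over the enlarged supply is an old set, possibly with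
  -- one `u` in front. One pass over the old list therefore restores completeness.
  complete-step : ∀ {P L L′} u → L ⊑ L′ → Complete P L → (∀ {i} → i < length L → HasKey L′ (key (u ∷ nth L i))) →
                  Complete (λ v → P v ⊎ v ≡ u) L′
  complete-step {P} {L} {L′} u e c step pU with split pU
  ... | U′ , pU′ , inj₁ h = subst (HasKey L′) (sym (≈⇒key h)) (hasKey-⊑ e (c pU′))
  ... | U′ , pU′ , inj₂ h with c pU′
  ...   | i , i< , eq = subst (HasKey L′) (trans (≈⇒key {u ∷ nth L i} {u ∷ U′} (∷-≈ {u} (key⇒≈ eq))) (sym (≈⇒key h))) (step i<)

-- The program

-- Index memories, with q = 2 ^ (t⁺ + t⁻) and Q = 2 ^ q (cell 0 unless said
-- otherwise): 4 q; 5, 6 tables of half and odd; 7 number of enumerated sets;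
-- 8 their keys; 9 key ↦ key * Q; 10 characteristic functions, at key * Q + r;
-- 11 keys seen; 12 Q * Q; 13 2 ^ t⁺ and (cell 1) the key of []; 14 squares of
-- t⁺ and t⁻; 15 positions in the two trees; 16 stack of table offsets; 17 its
-- height; 18 offset of the next table; 80, 81, 82 tables of joinOp, leftOp,
-- rightOp.  The others are local to a loop.  Counter memory 1 holds the tables
-- of the dynamic program, 0 the result.

-- Vectors are coded with the least significant bit first, the positive
-- component before the negative one; `s : Bool` is the sign, `true` being −.

infix 5 _≔_
_≔_ : Name → Exp → Cmd
a ≔ e = put a (lit 0) e

xorᵉ : Exp → Exp → Exp
xorᵉ d e = (d ∸ᵉ e) +ᵉ (e ∸ᵉ d)

andᵉ : Exp → Exp → Exp
andᵉ d e = (d +ᵉ e) ∸ᵉ lit 1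

bit-xorᵉ : ∀ {d e} a b → d ≡ bit a → e ≡ bit b → (d ∸ e) + (e ∸ d) ≡ bit (a xor b)
bit-xorᵉ a b refl refl = bit-xor a b

bit-andᵉ : ∀ {d e} a b → d ≡ bit a → e ≡ bit b → (d + e) ∸ 1 ≡ bit (a ∧ b)
bit-andᵉ a b refl refl = bit-∧ a b

dimᵉ : Bool → Exp
dimᵉ s = 0 [ lit (bit s) ]ᵉ

twice : ∀ a p → a * p + a * p ≡ a * (2 * p)
twice = solve-∀

double : Exp → Poly → Cmd
double e ν = for 31 e ν (30 ≔ ! 30 +ᵉ ! 30)

halfTable : Cmd
halfTable = for 22 (! 4) 𝕐
  ( put 5 (! 22 +ᵉ lit 1) (5 [ ! 22 ]ᵉ +ᵉ 6 [ ! 22 ]ᵉ)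
  ⨟ put 6 (! 22 +ᵉ lit 1) (lit 1 ∸ᵉ 6 [ ! 22 ]ᵉ) )

dotStep : Bool → Cmd
dotStep s = for 63 (dimᵉ s) 𝕋
  ( 62 ≔ xorᵉ (! 62) (andᵉ (6 [ ! 60 ]ᵉ) (6 [ ! 61 ]ᵉ))
  ⨟ 60 ≔ 5 [ ! 60 ]ᵉ
  ⨟ 61 ≔ 5 [ ! 61 ]ᵉ )

offsetᵉ : Bool → ℕ → Exp
offsetᵉ s zero    = lit 0
offsetᵉ s (suc μ) = offsetᵉ s μ +ᵉ 14 [ lit (bit s) ]ᵉ

-- Matrices are stored row by row. To multiply by the transpose, this loop and the one in `evalRows`
-- exchange their strides `lit 1` and `dimᵉ s`.
evalEntry : Bool → Bool → Cmd
evalEntry s tr = for 58 (dimᵉ s) 𝕋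
  ( 57 ≔ xorᵉ (! 57) (andᵉ (6 [ ! 55 ]ᵉ) ((2 + bit s) [ ! 56 ]ᵉ))
  ⨟ 55 ≔ 5 [ ! 55 ]ᵉ
  ⨟ 56 ≔ ! 56 +ᵉ (if tr then lit 1 else dimᵉ s) )

evalRows : Bool → Bool → Cmd
evalRows s tr = for 54 (dimᵉ s) 𝕋
  ( 55 ≔ ! 50
  ⨟ 56 ≔ ! 53
  ⨟ 57 ≔ lit 0
  ⨟ evalEntry s tr
  -- Product of a bit and the current power of 2 by lookup: memory 52 holds 0 in cell 0 and the
  -- power in cell 1.
  ⨟ 51 ≔ ! 51 +ᵉ 52 [ ! 57 ]ᵉ
  ⨟ put 52 (lit 1) (52 [ lit 1 ]ᵉ +ᵉ 52 [ lit 1 ]ᵉ)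
  ⨟ 53 ≔ ! 53 +ᵉ (if tr then dimᵉ s else lit 1) )

evalStep : Bool → ℕ → Bool → Cmd
evalStep s μ tr =
    53 ≔ 15 [ lit (bit s) ]ᵉ +ᵉ offsetᵉ s μ
  ⨟ evalRows s tr
  -- Drops the digits of the component just processed. The power in memory 52 carries on, so the two
  -- result components are concatenated.
  ⨟ for 58 (dimᵉ s) 𝕋 (50 ≔ 5 [ ! 50 ]ᵉ)

-- Adds the vector in memory 65 to the set whose characteristic function starts at offset 64 of
-- memory 10; memories 67 and 66 receive the characteristic function and the key of the new set.
candidate : Cmd
candidate =
    66 ≔ lit 0
  ⨟ for 68 (! 4) 𝕐
      ( 60 ≔ ! 65
      ⨟ 61 ≔ ! 68
      ⨟ 62 ≔ lit 0
      ⨟ dotStep false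
      ⨟ dotStep true
      ⨟ put 67 (! 68) (andᵉ (10 [ ! 64 +ᵉ ! 68 ]ᵉ) (lit 1 ∸ᵉ ! 62))
      ⨟ 66 ≔ ! 66 +ᵉ ! 66 +ᵉ 67 [ ! 68 ]ᵉ )

insert : Cmd
insert =
    30 ≔ ! 66
  -- `q` doublings multiply the key by `Q`.
  ⨟ double (! 4) 𝕐
  ⨟ put 9 (! 66) (! 30)
  ⨟ for 72 (! 4) 𝕐 (put 10 (! 30 +ᵉ ! 72) (67 [ ! 72 ]ᵉ))
  ⨟ ifte (11 [ ! 66 ]ᵉ) nop
      ( put 8 (! 7) (! 66)
      ⨟ put 11 (! 66) (lit 1)
      ⨟ 7 ≔ ! 7 +ᵉ lit 1 )

extendAll : Cmd
extendAll =
    -- The length is frozen: a set inserted during this pass already contains the vector.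
    69 ≔ ! 7
  ⨟ for 70 (! 69) 𝕐
      ( 71 ≔ 8 [ ! 70 ]ᵉ
      ⨟ 64 ≔ 9 [ ! 71 ]ᵉ
      ⨟ candidate
      ⨟ insert )

enumerate : Cmd
enumerate =
    66 ≔ lit 0
  -- The empty set imposes no constraint, so its annihilator contains every vector.
  ⨟ for 68 (! 4) 𝕐 (put 67 (! 68) (lit 1) ⨟ 66 ≔ ! 66 +ᵉ ! 66 +ᵉ lit 1)
  ⨟ put 13 (lit 1) (! 66)
  ⨟ insert
  ⨟ 65 ≔ lit 0
  ⨟ for 73 (! 13) 𝕐 (extendAll ⨟ 65 ≔ ! 65 +ᵉ lit 1)
  ⨟ 65 ≔ lit 0
  -- The multiples of `2 ^ t⁺` are the numbers of the vectors whose positive component is 0.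
  ⨟ for 73 (! 29) 𝕐 (extendAll ⨟ 65 ≔ ! 65 +ᵉ ! 13)

square : Bool → Cmd
square s = for 31 (dimᵉ s) 𝕋 (put 14 (lit (bit s)) (14 [ lit (bit s) ]ᵉ +ᵉ dimᵉ s))

powerOf2 : Name → Exp → Poly → Cmd
powerOf2 a e ν = 30 ≔ lit 1 ⨟ double e ν ⨟ a ≔ ! 30

powers : Cmd
powers =
    powerOf2 13 (dimᵉ false) 𝕋
  ⨟ powerOf2 29 (dimᵉ true) 𝕋
  ⨟ 30 ≔ lit 1
  ⨟ double (! 4) 𝕐
  ⨟ double (! 4) 𝕐
  ⨟ 12 ≔ ! 30

setup : Cmd
setup =
    powerOf2 4 (dimᵉ false +ᵉ dimᵉ true) 𝕋
  ⨟ halfTable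
  ⨟ powers
  ⨟ square false
  ⨟ square true
  ⨟ enumerate

evalAt : ℕ → Bool → Cmd
evalAt μ tr =
    50 ≔ ! 47
  ⨟ 51 ≔ lit 0
  ⨟ put 52 (lit 0) (lit 0)
  ⨟ put 52 (lit 1) (lit 1)
  ⨟ evalStep false μ tr
  ⨟ evalStep true μ tr

keyLoop : ℕ → Bool → ℕ → Bool → Cmd
keyLoop μ tr μ′ tr′ = for 47 (! 4) 𝕐
  ( evalAt μ tr
  ⨟ 48 ≔ 10 [ ! 41 +ᵉ ! 51 ]ᵉ
  ⨟ evalAt μ′ tr′
  ⨟ 46 ≔ ! 46 +ᵉ ! 46 +ᵉ andᵉ (! 48) (10 [ ! 45 +ᵉ ! 51 ]ᵉ) )

tableRow : ℕ → ℕ → Bool → ℕ → Bool → Cmd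
tableRow m μ tr μ′ tr′ = for 43 (! 7) 𝕐
  ( 44 ≔ 8 [ ! 43 ]ᵉ
  ⨟ 45 ≔ 9 [ ! 44 ]ᵉ
  ⨟ 46 ≔ lit 0
  ⨟ keyLoop μ tr μ′ tr′
  ⨟ put (80 + m) (! 41 +ᵉ ! 44) (! 46) )

table : ℕ → ℕ → Bool → ℕ → Bool → Cmd
table m μ tr μ′ tr′ = for 40 (! 7) 𝕐
  ( 41 ≔ 9 [ 8 [ ! 40 ]ᵉ ]ᵉ
  ⨟ tableRow m μ tr μ′ tr′ )

combineRow : Cmd
combineRow = for 47 (! 7) 𝕐
  ( 48 ≔ 8 [ ! 47 ]ᵉ
  ⨟ 49 ≔ 9 [ ! 48 ]ᵉ
  ⨟ putᶜ 1 (! 18 +ᵉ ! 46 +ᵉ ! 48)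
      (1 [ ! 18 +ᵉ ! 46 +ᵉ ! 48 ]ᶜ +ᶜ
       1 [ ! 20 +ᵉ ! 42 +ᵉ 81 [ ! 49 +ᵉ ! 44 ]ᵉ ]ᶜ *ᶜ 1 [ ! 21 +ᵉ ! 45 +ᵉ 82 [ ! 49 +ᵉ ! 41 ]ᵉ ]ᶜ) )

combineRows : Cmd
combineRows = for 43 (! 7) 𝕐
  ( 44 ≔ 8 [ ! 43 ]ᵉ
  ⨟ 45 ≔ 9 [ ! 44 ]ᵉ
  ⨟ 46 ≔ 9 [ 80 [ ! 42 +ᵉ ! 44 ]ᵉ ]ᵉ
  ⨟ combineRow )

-- The three nested loops run over the contributions i of the left subtree, j of the right one, and
-- the outside set k. The left table is read at i and `leftOp` of k and j, the right one at j and
-- `rightOp` of k and i; the product is added at `joinOp` of i and j, and k.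
combine : Cmd
combine = for 40 (! 7) 𝕐
  ( 41 ≔ 8 [ ! 40 ]ᵉ
  ⨟ 42 ≔ 9 [ ! 41 ]ᵉ
  ⨟ combineRows )

addRow : Cmd
addRow = for 47 (! 7) 𝕐
  ( 48 ≔ 8 [ ! 47 ]ᵉ
  ⨟ putᶜ 1 (! 18 +ᵉ ! 46 +ᵉ ! 48) (1 [ ! 18 +ᵉ ! 46 +ᵉ ! 48 ]ᶜ +ᶜ lit 1) )

addKey : Exp → Cmd
addKey u =
    65 ≔ u
  ⨟ 64 ≔ 9 [ 13 [ lit 1 ]ᵉ ]ᵉ
  ⨟ candidate
  ⨟ 46 ≔ 9 [ ! 66 ]ᵉ
  ⨟ addRow

-- The numbers 1 and `2 ^ t⁺` code the contributions ({1}, 0) of a true and (0, {1}) of a false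
-- variable.
variableLeaf : Cmd
variableLeaf = addKey (lit 1) ⨟ addKey (! 13)

clauseRow : Cmd
clauseRow = for 47 (! 7) 𝕐
  ( 48 ≔ 8 [ ! 47 ]ᵉ
  ⨟ ifte (10 [ 9 [ ! 48 ]ᵉ +ᵉ ! 41 ]ᵉ) nop
      (putᶜ 1 (! 18 +ᵉ ! 46 +ᵉ ! 48) (1 [ ! 18 +ᵉ ! 46 +ᵉ ! 48 ]ᶜ +ᶜ lit 1)) )

clauseLeaf : Cmd
clauseLeaf =
    46 ≔ 9 [ 13 [ lit 1 ]ᵉ ]ᵉ
  -- The number of ({1}, {1}), the label pair of a new clause vertex.
  ⨟ 41 ≔ lit 1 +ᵉ ! 13
  ⨟ clauseRow

push : Cmd
push =
    put 16 (! 17) (! 18)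
  ⨟ 17 ≔ ! 17 +ᵉ lit 1
  ⨟ 18 ≔ ! 18 +ᵉ ! 12

advance : Bool → Exp → Cmd
advance s e = put 15 (lit (bit s)) (15 [ lit (bit s) ]ᵉ +ᵉ e)

leafCmd : Cmd
leafCmd =
    -- Exactly the vertex codes below the number of variables belong to variables.
    ifte (0 [ lit 2 ]ᵉ ∸ᵉ 2 [ 15 [ lit 0 ]ᵉ +ᵉ lit 1 ]ᵉ) variableLeaf clauseLeaf
  ⨟ advance false (lit 2)
  ⨟ advance true (lit 2)
  ⨟ push

nodeTables : Cmd
nodeTables =
    -- The transposition flags are opposite to those of `joinOp`, `leftOp` and `rightOp`: a map
    -- applied to contributions is evaluated as its adjoint on the argument of the annihilator.
    table 0 1 true 2 true
  ⨟ table 1 1 false 0 true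
  ⨟ table 2 2 false 0 false

nodeCmd : Cmd
nodeCmd =
    advance false (lit 1)
  ⨟ advance true (lit 1)
  ⨟ 20 ≔ 16 [ ! 17 ∸ᵉ lit 2 ]ᵉ
  ⨟ 21 ≔ 16 [ ! 17 ∸ᵉ lit 1 ]ᵉ
  ⨟ nodeTables
  ⨟ combine
  ⨟ advance false (offsetᵉ false 3)
  ⨟ advance true (offsetᵉ true 3)
  ⨟ 17 ≔ ! 17 ∸ᵉ lit 2
  ⨟ push

body : Cmd
body = ifte (2 [ 15 [ lit 0 ]ᵉ ]ᵉ ∸ᵉ lit 1) nodeCmd leafCmd

-- Tokens are 1 or 2, and cells beyond the input are 0, so the value 0 signals the end of the tree.
tokenᵉ : Exp
tokenᵉ = 2 [ 15 [ lit 0 ]ᵉ ]ᵉ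

-- Nothing lies outside the root, so only the column of `key []` matters, summed over all
-- contributions of the whole tree.
readout : Cmd
readout = for 47 (! 7) 𝕐
  (putᶜ 0 (lit 0) (0 [ lit 0 ]ᶜ +ᶜ 1 [ 16 [ lit 0 ]ᵉ +ᵉ 9 [ 8 [ ! 47 ]ᵉ ]ᵉ +ᵉ 13 [ lit 1 ]ᵉ ]ᶜ))

solver : Program
solver = compile setup ⨾ (WHILE tokenᵉ DO compile body) ⨾ compile readout

-- Counting

write-same : ∀ M a i v j → write M a i v a j ≡ (if j ≡ᵇ i then v else M a j)
write-same M a i v j rewrite ≡ᵇ-reflexive a = refl

sumN : ℕ → (ℕ → ℕ) → ℕ
sumN zero    f = 0
sumN (suc n) f = sumN n f + f n

ind : ℕ → ℕ → ℕ
ind a b = if a ≡ᵇ b then 1 else 0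

ind-same : ∀ a → ind a a ≡ 1
ind-same a rewrite ≡ᵇ-reflexive a = refl

ind-differ : ∀ {a b} → a ≢ b → ind a b ≡ 0
ind-differ {zero}  {zero}  ne = contradiction refl ne
ind-differ {zero}  {suc b} ne = refl
ind-differ {suc a} {zero}  ne = refl
ind-differ {suc a} {suc b} ne = ind-differ {a} {b} (λ e → ne (cong suc e))

sumN-cong : ∀ n {f g} → (∀ {k} → k < n → f k ≡ g k) → sumN n f ≡ sumN n g
sumN-cong zero    h = refl
sumN-cong (suc n) h = cong₂ _+_ (sumN-cong n (λ k< → h (m<n⇒m<1+n k<))) (h ≤-refl)

sumN-*ˡ : ∀ n c {f} → c * sumN n f ≡ sumN n (λ k → c * f k)
sumN-*ˡ zero    c = *-zeroʳ c
sumN-*ˡ (suc n) c {f} = trans (*-distribˡ-+ c (sumN n f) (f n)) (cong (_+ c * f n) (sumN-*ˡ n c))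

sumN-zero : ∀ n {f} → (∀ {k} → k < n → f k ≡ 0) → sumN n f ≡ 0
sumN-zero zero    h = refl
sumN-zero (suc n) h = cong₂ _+_ (sumN-zero n (λ k< → h (m<n⇒m<1+n k<))) (h ≤-refl)

sumN-pick : ∀ {n i c} (p g : ℕ → ℕ) → i < n → p i ≡ c → (∀ {j} → j < n → p j ≡ c → j ≡ i) → sumN n (λ k → ind c (p k) * g k) ≡ g i
sumN-pick {suc n} {i} {c} p g i< e u with m≤n⇒m<n∨m≡n (≤-pred i<)
... | inj₁ i<n rewrite sumN-pick {n} p g i<n e (λ j< → u (m<n⇒m<1+n j<))
                     | ind-differ {c} {p n} (λ e′ → <⇒≢ i<n (sym (u ≤-refl (sym e′)))) = +-identityʳ _
... | inj₂ refl = trans (cong₂ _+_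
        (sumN-zero n (λ {k} k< → cong (_* g k) (ind-differ {c} {p k} (λ e′ → <⇒≢ k< (u (m<n⇒m<1+n k<) (sym e′))))))
        (trans (cong (_* g n) (trans (cong (ind c) e) (ind-same c))) (+-identityʳ (g n)))) refl

ind-sym : ∀ a b → ind a b ≡ ind b a
ind-sym zero    zero    = refl
ind-sym zero    (suc b) = refl
ind-sym (suc a) zero    = refl
ind-sym (suc a) (suc b) = ind-sym a b

-- Sums over assignments to the leaves of a tree.

Asg : Shape → Set
Asg leaf       = Bool
Asg (node l r) = Asg l × Asg r

-- Clause leaves carry the dummy value false.
sumA : ∀ s → (Leaf s → Bool) → (Asg s → ℕ) → ℕ
sumA leaf       κ f = if κ tt then f true + f false else f false
sumA (node l r) κ f = sumA l (κ ∘ inj₁) λ a → sumA r (κ ∘ inj₂) λ b → f (a , b)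

sumA-cong : ∀ s κ {f g} → (∀ a → f a ≡ g a) → sumA s κ f ≡ sumA s κ g
sumA-cong leaf κ h with κ tt
... | true  = cong₂ _+_ (h true) (h false)
... | false = h false
sumA-cong (node l r) κ h = sumA-cong l _ λ a → sumA-cong r _ λ b → h (a , b)

sumA-+ : ∀ s κ {f g} → sumA s κ (λ a → f a + g a) ≡ sumA s κ f + sumA s κ g
sumA-+ leaf κ {f} {g} with κ tt
... | true  = shuffle (f true) (g true) (f false) (g false)
  where shuffle : ∀ a b c d → a + b + (c + d) ≡ a + c + (b + d)
        shuffle = solve-∀
... | false = refl
sumA-+ (node l r) κ = trans (sumA-cong l _ λ a → sumA-+ r _) (sumA-+ l _)

sumA-0 : ∀ s κ → sumA s κ (λ _ → 0) ≡ 0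
sumA-0 leaf κ with κ tt
... | true  = refl
... | false = refl
sumA-0 (node l r) κ = trans (sumA-cong l _ λ a → sumA-0 r _) (sumA-0 l _)

sumA-*ˡ : ∀ s κ c {f} → c * sumA s κ f ≡ sumA s κ (λ a → c * f a)
sumA-*ˡ leaf κ c {f} with κ tt
... | true  = *-distribˡ-+ c (f true) (f false)
... | false = refl
sumA-*ˡ (node l r) κ c = trans (sumA-*ˡ l _ c) (sumA-cong l _ λ a → sumA-*ˡ r _ c)

sumA-*ʳ : ∀ s κ c {f} → sumA s κ f * c ≡ sumA s κ (λ a → f a * c)
sumA-*ʳ s κ c {f} = trans (*-comm (sumA s κ f) c) (trans (sumA-*ˡ s κ c) (sumA-cong s κ (λ a → *-comm c (f a))))

sumN-sumA : ∀ n s κ {f : ℕ → Asg s → ℕ} → sumN n (λ i → sumA s κ (f i)) ≡ sumA s κ (λ a → sumN n (λ i → f i a))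
sumN-sumA zero    s κ = sym (sumA-0 s κ)
sumN-sumA (suc n) s κ {f} = trans (cong (_+ sumA s κ (f n)) (sumN-sumA n s κ)) (sym (sumA-+ s κ))

bit-* : ∀ a b → bit a * bit b ≡ bit (a ∧ b)
bit-* false b = refl
bit-* true  b = +-identityʳ (bit b)

val : ∀ {s} → Asg s → Leaf s → Bool
val {leaf}     a       tt       = a
val {node l r} (a , b) (inj₁ x) = val a x
val {node l r} (a , b) (inj₂ x) = val b x

module _ {A B : Set} where

  unique-lookup-injective : ∀ {xs : List A} → Unique xs → ∀ {i j} → List.lookup xs i ≡ List.lookup xs j → i ≡ j
  unique-lookup-injective (_ ∷ _)  {zero}  {zero}  _ = refl
  unique-lookup-injective (px ∷ _) {zero}  {suc j} e = contradiction e (All.lookup px (∈-lookup j))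
  unique-lookup-injective (px ∷ _) {suc i} {zero}  e = contradiction (sym e) (All.lookup px (∈-lookup i))
  unique-lookup-injective (_ ∷ u)  {suc i} {suc j} e = cong suc (unique-lookup-injective u e)

  -- Pigeonhole principle for positions: an index of `xs` is sent to an index at which its image
  -- occurs in `ys`.
  unique-≤ : ∀ {xs : List A} {ys : List B} → Unique xs → (f : A → B) →
             (∀ {x x′} → x ∈ xs → x′ ∈ xs → f x ≡ f x′ → x ≡ x′) → (∀ {x} → x ∈ xs → f x ∈ ys) → length xs ≤ length ys
  unique-≤ {xs} {ys} u f inj mem = injective⇒≤ {f = λ i → Any.index (mem (∈-lookup {xs = xs} i))} λ {i} {j} e →
    unique-lookup-injective u (inj (∈-lookup i) (∈-lookup j)
      (trans (lookup-index (mem (∈-lookup i))) (trans (cong (List.lookup ys) e) (sym (lookup-index (mem (∈-lookup j)))))))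

sumL : ∀ {A : Set} → (A → ℕ) → List A → ℕ
sumL f []       = 0
sumL f (x ∷ xs) = f x + sumL f xs

sumL-++ : ∀ {A : Set} (f : A → ℕ) xs {ys} → sumL f (xs ++ ys) ≡ sumL f xs + sumL f ys
sumL-++ f []       = refl
sumL-++ f (x ∷ xs) = trans (cong (f x +_) (sumL-++ f xs)) (sym (+-assoc (f x) _ _))

sumL-map : ∀ {A B : Set} (f : B → ℕ) (g : A → B) xs → sumL f (map g xs) ≡ sumL (f ∘ g) xs
sumL-map f g []       = refl
sumL-map f g (x ∷ xs) = cong (f (g x) +_) (sumL-map f g xs)

sumL-cong : ∀ {A : Set} {f g : A → ℕ} → (∀ x → f x ≡ g x) → ∀ xs → sumL f xs ≡ sumL g xs
sumL-cong h []       = refl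
sumL-cong h (x ∷ xs) = cong₂ _+_ (h x) (sumL-cong h xs)

sumL-product : ∀ {A B : Set} (f : A × B → ℕ) xs ys → sumL f (cartesianProduct xs ys) ≡ sumL (λ x → sumL (λ y → f (x , y)) ys) xs
sumL-product f []       ys = refl
sumL-product f (x ∷ xs) ys = trans (sumL-++ f (map (x ,_) ys)) (cong₂ _+_ (sumL-map f (x ,_) ys) (sumL-product f xs ys))

sumL-filter : ∀ {A : Set} (p : A → Bool) xs → sumL (bit ∘ p) xs ≡ length (filter (λ x → p x Bool.≟ true) xs)
sumL-filter p [] = refl
sumL-filter p (x ∷ xs) with p x
... | true  = cong suc (sumL-filter p xs)
... | false = sumL-filter p xs

allAsg : ∀ s → (Leaf s → Bool) → List (Asg s)
allAsg leaf       κ = if κ tt then true ∷ false ∷ [] else false ∷ []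
allAsg (node l r) κ = cartesianProduct (allAsg l (κ ∘ inj₁)) (allAsg r (κ ∘ inj₂))

sumA-list : ∀ s κ f → sumA s κ f ≡ sumL f (allAsg s κ)
sumA-list leaf κ f with κ tt
... | true  = cong (f true +_) (sym (+-identityʳ _))
... | false = sym (+-identityʳ _)
sumA-list (node l r) κ f = trans (sumA-list l _ _) (trans (sumL-cong (λ a → sumA-list r _ _) (allAsg l _)) (sym (sumL-product f (allAsg l _) (allAsg r _))))

allAsg-unique : ∀ s κ → Unique (allAsg s κ)
allAsg-unique leaf κ with κ tt
... | true  = ((λ ()) ∷ []) ∷ [] ∷ []
... | false = [] ∷ []
allAsg-unique (node l r) κ = Unique.cartesianProduct⁺ (allAsg-unique l _) (allAsg-unique r _)

build : ∀ s → (Leaf s → Bool) → Asg s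
build leaf       f = f tt
build (node l r) f = build l (f ∘ inj₁) , build r (f ∘ inj₂)

val-build : ∀ s f x → val (build s f) x ≡ f x
val-build leaf       f tt       = refl
val-build (node l r) f (inj₁ x) = val-build l _ x
val-build (node l r) f (inj₂ x) = val-build r _ x

build-val : ∀ s {f} (a : Asg s) → (∀ x → f x ≡ val a x) → build s f ≡ a
build-val leaf       a       h = h tt
build-val (node l r) (a , b) h = cong₂ _,_ (build-val l a (h ∘ inj₁)) (build-val r b (h ∘ inj₂))

∈-allAsg⁺ : ∀ s κ a → (∀ x → κ x ≡ false → val a x ≡ false) → a ∈ allAsg s κ
∈-allAsg⁺ leaf κ a h with κ tt in k | a
... | true  | true  = here refl
... | true  | false = there (here refl)
... | false | _     = here (h tt k)
∈-allAsg⁺ (node l r) κ (a , b) h = ∈-cartesianProduct⁺ (∈-allAsg⁺ l _ a (λ x → h (inj₁ x))) (∈-allAsg⁺ r _ b (λ x → h (inj₂ x)))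

∈-allAsg⁻ : ∀ s κ {a} → a ∈ allAsg s κ → ∀ x → κ x ≡ false → val a x ≡ false
∈-allAsg⁻ leaf κ m tt k with κ tt
∈-allAsg⁻ leaf κ (here refl) tt k | false = refl
∈-allAsg⁻ (node l r) κ m (inj₁ x) k = ∈-allAsg⁻ l _ (proj₁ (∈-cartesianProduct⁻ (allAsg l _) (allAsg r _) m)) x k
∈-allAsg⁻ (node l r) κ m (inj₂ x) k = ∈-allAsg⁻ r _ (proj₂ (∈-cartesianProduct⁻ (allAsg l _) (allAsg r _) m)) x k

assignments-unique : ∀ n → Unique (assignments n)
assignments-unique zero    = [] ∷ []
assignments-unique (suc n) = Unique.++⁺ (Unique.map⁺ (λ { refl → refl }) (assignments-unique n)) (Unique.map⁺ (λ { refl → refl }) (assignments-unique n))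
  (λ (m , m′) → disjoint (∈-map⁻ (false ∷_) m) (∈-map⁻ (true ∷_) m′))
  where disjoint : ∀ {v : Vec Bool (suc n)} → ∃ (λ u → u ∈ assignments n × v ≡ false ∷ u) → ∃ (λ u → u ∈ assignments n × v ≡ true ∷ u) → ⊥
        disjoint (_ , _ , refl) (_ , _ , ())

∈-assignments : ∀ {n} (v : Vec Bool n) → v ∈ assignments n
∈-assignments []          = here refl
∈-assignments (false ∷ v) = ∈-++⁺ˡ (∈-map⁺ (false ∷_) (∈-assignments v))
∈-assignments (true ∷ v)  = ∈-++⁺ʳ (map (false ∷_) (assignments _)) (∈-map⁺ (true ∷_) (∈-assignments v))

isVariable : ∀ {A B : Set} → A ⊎ B → Bool
isVariable (inj₁ _) = true
isVariable (inj₂ _) = false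

isVariable⁻ : ∀ {A B : Set} (v : A ⊎ B) → isVariable v ≡ true → ∃ λ a → v ≡ inj₁ a
isVariable⁻ (inj₁ a) _ = a , refl

isClause⁻ : ∀ {A B : Set} (v : A ⊎ B) → isVariable v ≡ false → ∃ λ b → v ≡ inj₂ b
isClause⁻ (inj₂ b) _ = b , refl

-- Counting subspaces of GF(2)^t: each is the kernel of a parity check matrix
-- built column by column, a new column being either a new pivot (flat) or an
-- arbitrary combination of the earlier pivots (coset).

flat : ∀ {t k} → (Label t → Label k) → Label (suc t) → Label (suc k)
flat f (b ∷ v) = b ∷ f v

coset : ∀ {t k} → Label k → (Label t → Label k) → Label (suc t) → Label k
coset w f (b ∷ v) = f v ⊕ Vec.map (b ∧_) w

checks : ∀ t k → List (Label t → Label k)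
checks zero    zero    = (λ v → v) ∷ []
checks zero    (suc k) = []
checks (suc t) zero    = cartesianProductWith coset (assignments 0) (checks t 0)
checks (suc t) (suc k) = map flat (checks t k) ++ cartesianProductWith coset (assignments (suc k)) (checks t (suc k))

null : ∀ {k} → Label k → Bool
null []      = true
null (b ∷ v) = not b ∧ null v

record Subspace {t} (A : Label t → Bool) : Set where
  field
    contains-0 : A (Vec.replicate t false) ≡ true
    closed     : ∀ {u v} → A u ≡ true → A v ≡ true → A (u ⊕ v) ≡ true

open Subspace

⊕-self : ∀ {t} (v : Label t) → v ⊕ v ≡ Vec.replicate t false
⊕-self []      = refl
⊕-self (b ∷ v) = cong₂ _∷_ (xor-same b) (⊕-self v)

⊕-zeroʳ : ∀ {t} (v : Label t) → v ⊕ Vec.replicate t false ≡ v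
⊕-zeroʳ []      = refl
⊕-zeroʳ (b ∷ v) = cong₂ _∷_ (xor-identityʳ b) (⊕-zeroʳ v)

⊕-assoc : ∀ {t} (u v w : Label t) → (u ⊕ v) ⊕ w ≡ u ⊕ (v ⊕ w)
⊕-assoc [] [] [] = refl
⊕-assoc (a ∷ u) (b ∷ v) (c ∷ w) = cong₂ _∷_ (xor-assoc a b c) (⊕-assoc u v w)

⊕-interchange : ∀ {t} (u v w z : Label t) → (u ⊕ v) ⊕ (w ⊕ z) ≡ (u ⊕ w) ⊕ (v ⊕ z)
⊕-interchange [] [] [] [] = refl
⊕-interchange (a ∷ u) (b ∷ v) (c ∷ w) (d ∷ z) = cong₂ _∷_ (xor-interchange a b c d) (⊕-interchange u v w z)

scale-false : ∀ {t} (v : Label t) → Vec.map (false ∧_) v ≡ Vec.replicate t false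
scale-false []      = refl
scale-false (b ∷ v) = cong (false ∷_) (scale-false v)

scale-true : ∀ {t} (v : Label t) → Vec.map (true ∧_) v ≡ v
scale-true []      = refl
scale-true (b ∷ v) = cong (b ∷_) (scale-true v)

scale-xor : ∀ {t} a b (v : Label t) → Vec.map ((a xor b) ∧_) v ≡ Vec.map (a ∧_) v ⊕ Vec.map (b ∧_) v
scale-xor a b []      = refl
scale-xor a b (c ∷ v) = cong₂ _∷_ (distrib a b c) (scale-xor a b v)
  where distrib : ∀ a b c → (a xor b) ∧ c ≡ (a ∧ c) xor (b ∧ c)
        distrib false b c = refl
        distrib true false c = sym (xor-identityʳ c)
        distrib true true c = sym (xor-same c)

Linear : ∀ {t k} → (Label t → Label k) → Set
Linear f = ∀ u v → f (u ⊕ v) ≡ f u ⊕ f v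

flat-linear : ∀ {t k} {f : Label t → Label k} → Linear f → Linear (flat f)
flat-linear l (a ∷ u) (b ∷ v) = cong ((a xor b) ∷_) (l u v)

coset-linear : ∀ {t k} w {f : Label t → Label k} → Linear f → Linear (coset w f)
coset-linear w {f} l (a ∷ u) (b ∷ v) = trans (cong₂ _⊕_ (l u v) (scale-xor a b w)) (⊕-interchange (f u) (f v) _ _)

bool-ext : ∀ {a b} → (a ≡ true → b ≡ true) → (b ≡ true → a ≡ true) → a ≡ b
bool-ext {false} {false} f g = refl
bool-ext {false} {true}  f g = g refl
bool-ext {true}          f g = sym (f refl)

checks-coset : ∀ {t k} w {f} → f ∈ checks t k → coset w f ∈ checks (suc t) k
checks-coset {t} {zero}  w m = ∈-cartesianProductWith⁺ coset (∈-assignments w) m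
checks-coset {t} {suc k} w m = ∈-++⁺ʳ (map flat (checks t k)) (∈-cartesianProductWith⁺ coset (∈-assignments w) m)

-- Induction applies to the slice of vectors with leading coordinate 0. If some `true ∷ w` lies in
-- `A`, then `true ∷ v` does iff `v ⊕ w` is in the slice, so the new column is `f w`; otherwise the
-- leading coordinate itself becomes a check. Linearity is carried along for the first case.
kernel-form : ∀ {t} {A : Label t → Bool} → Subspace A →
              ∃ λ k → k ≤ t × ∃ λ f → f ∈ checks t k × Linear f × ∀ v → A v ≡ null (f v)
kernel-form {zero} S = 0 , z≤n , (λ v → v) , here refl , (λ u v → refl) , λ { [] → contains-0 S }
kernel-form {suc t} {A} S
  with k , k≤t , f , m , l , e ← kernel-form {t} {A ∘ (false ∷_)} (record { contains-0 = contains-0 S ; closed = closed S })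
  with Any.any? (λ w → A (true ∷ w) Bool.≟ true) (assignments t)
... | yes h with w , _ , aw ← find h = k , m≤n⇒m≤1+n k≤t , coset (f w) f , checks-coset (f w) m , coset-linear (f w) l , kernel
  where
  kernel : ∀ v → A v ≡ null (coset (f w) f v)
  kernel (false ∷ v) = trans (e v) (cong null (sym (trans (cong (f v ⊕_) (scale-false (f w))) (⊕-zeroʳ (f v)))))
  kernel (true ∷ v) = trans (bool-ext
    (λ av → closed S av aw)
    (λ a → subst (λ z → A (true ∷ z) ≡ true) (trans (⊕-assoc v w w) (trans (cong (v ⊕_) (⊕-self w)) (⊕-zeroʳ v))) (closed S a aw)))
    (trans (e (v ⊕ w)) (cong null (trans (l v w) (cong (f v ⊕_) (sym (scale-true (f w)))))))
... | no none = suc k , s≤s k≤t , flat f , ∈-++⁺ˡ (∈-map⁺ flat m) , flat-linear l , kernel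
  where
  kernel : ∀ v → A v ≡ null (flat f v)
  kernel (false ∷ v) = e v
  kernel (true ∷ v) with A (true ∷ v) in eq
  ... | false = refl
  ... | true = contradiction (lose (∈-assignments v) eq) none

kernelsBelow : ∀ t → ℕ → List (Label t → Bool)
kernelsBelow t zero    = []
kernelsBelow t (suc n) = kernelsBelow t n ++ map (null ∘_) (checks t n)

∈-kernelsBelow : ∀ {t k n f} → k < n → f ∈ checks t k → (null ∘ f) ∈ kernelsBelow t n
∈-kernelsBelow {t} {n = suc n} k< m with m≤n⇒m<n∨m≡n (≤-pred k<)
... | inj₁ k<n  = ∈-++⁺ˡ (∈-kernelsBelow k<n m)
... | inj₂ refl = ∈-++⁺ʳ (kernelsBelow t n) (∈-map⁺ (null ∘_) m)

-- The Gaussian binomial coefficient, by its q-Pascal rule.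
gauss : ℕ → ℕ → ℕ
gauss zero    zero    = 1
gauss zero    (suc k) = 0
gauss (suc t) zero    = gauss t 0
gauss (suc t) (suc k) = gauss t k + 2 ^ suc k * gauss t (suc k)

length-assignments : ∀ n → length (assignments n) ≡ 2 ^ n
length-assignments zero    = refl
length-assignments (suc n) = trans (length-++ (map (false ∷_) (assignments n)))
  (cong₂ _+_ (trans (length-map (false ∷_) (assignments n)) (length-assignments n))
    (trans (length-map (true ∷_) (assignments n)) (trans (length-assignments n) (sym (+-identityʳ _)))))

length-product : ∀ {A B C : Set} (f : A → B → C) xs ys → length (cartesianProductWith f xs ys) ≡ length xs * length ys
length-product f []       ys = refl
length-product f (x ∷ xs) ys = trans (length-++ (map (f x) ys)) (cong₂ _+_ (length-map (f x) ys) (length-product f xs ys))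

length-checks : ∀ t k → length (checks t k) ≡ gauss t k
length-checks zero    zero    = refl
length-checks zero    (suc k) = refl
length-checks (suc t) zero    = trans (length-product coset (assignments 0) (checks t 0)) (trans (+-identityʳ _) (length-checks t 0))
length-checks (suc t) (suc k) = trans (length-++ (map flat (checks t k)))
  (cong₂ _+_ (trans (length-map flat (checks t k)) (length-checks t k))
    (trans (length-product coset (assignments (suc k)) (checks t (suc k))) (cong₂ _*_ (length-assignments (suc k)) (length-checks t (suc k)))))

-- The Galois number of GF(2)^t, which counts its subspaces; the proof uses it as an upper bound for
-- their number.
galois : ℕ → ℕ
galois t = sumN (suc t) (gauss t)

length-kernels : ∀ t n → length (kernelsBelow t n) ≡ sumN n (gauss t)
length-kernels t zero    = refl
length-kernels t (suc n) = trans (length-++ (kernelsBelow t n))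
  (cong₂ _+_ (length-kernels t n) (trans (length-map (null ∘_) (checks t n)) (length-checks t n)))

gauss-above : ∀ {t k} → t < k → gauss t k ≡ 0
gauss-above {zero}  {suc k} _ = refl
gauss-above {suc t} {suc k} (s≤s t<k) rewrite gauss-above t<k | gauss-above (m<n⇒m<1+n t<k) = *-zeroʳ (2 ^ suc k)

gauss-0 : ∀ t → gauss t 0 ≡ 1
gauss-0 zero    = refl
gauss-0 (suc t) = gauss-0 t

gauss-diagonal : ∀ t → gauss t t ≡ 1
gauss-diagonal zero    = refl
gauss-diagonal (suc t) rewrite gauss-diagonal t | gauss-above (n<1+n t) = cong suc (*-zeroʳ (2 ^ suc t))

-- gauss (k + j) k ≤ 4 (1 − 2^-j) 2^(kj) for j ≥ 1, without fractions.
gauss-bound : ∀ k j → gauss (k + suc j) k * 2 ^ suc j + 4 * 2 ^ (k * suc j) ≤ 4 * 2 ^ suc j * 2 ^ (k * suc j)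
gauss-bound zero j rewrite gauss-0 j = begin
  1 * 2 ^ suc j + 4               ≡⟨ cong (_+ 4) (*-identityˡ (2 ^ suc j)) ⟩
  2 ^ suc j + 4                   ≤⟨ +-monoʳ-≤ (2 ^ suc j) (≤-trans (≤-trans (s≤s (s≤s (s≤s (s≤s z≤n)))) (*-monoʳ-≤ 3 (^-monoʳ-≤ 2 {1} {suc j} (s≤s z≤n)))) ≤-refl) ⟩
  2 ^ suc j + 3 * 2 ^ suc j       ≡⟨⟩
  4 * 2 ^ suc j                   ≡⟨ *-identityʳ _ ⟨
  4 * 2 ^ suc j * 1               ∎
  where open ≤-Reasoning
gauss-bound (suc k) zero = begin
  gauss (suc k + 1) (suc k) * 2 + 4 * 2 ^ (suc k * 1)
    ≡⟨ cong₂ (λ n m → (gauss (k + 1) k + K * gauss n (suc k)) * 2 + 4 * 2 ^ m) (+-comm k 1) (*-identityʳ (suc k)) ⟩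
  (a + K * gauss (suc k) (suc k)) * 2 + 4 * K
    ≡⟨ cong (λ g → (a + K * g) * 2 + 4 * K) (gauss-diagonal (suc k)) ⟩
  (a + K * 1) * 2 + 4 * K
    ≡⟨ regroup a K ⟩
  a * 2 + 6 * K
    ≤⟨ +-monoˡ-≤ (6 * K) (a≤ (gauss-bound k 0)) ⟩
  2 * K + 6 * K
    ≡⟨ collect K ⟩
  8 * K
    ≡⟨ cong (λ m → 8 * 2 ^ m) (*-identityʳ (suc k)) ⟨
  8 * 2 ^ (suc k * 1) ∎
  where
  open ≤-Reasoning
  K = 2 ^ suc k
  a = gauss (k + 1) k
  regroup : ∀ a K → (a + K * 1) * 2 + 4 * K ≡ a * 2 + 6 * K
  regroup = solve-∀
  collect : ∀ K → 2 * K + 6 * K ≡ 8 * K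
  collect = solve-∀
  halve : ∀ x → 4 * 2 * x ≡ 2 * (2 * x) + 4 * x
  halve = solve-∀
  a≤ : a * 2 + 4 * 2 ^ (k * 1) ≤ 4 * 2 * 2 ^ (k * 1) → a * 2 ≤ 2 * K
  a≤ IH = +-cancelʳ-≤ (4 * 2 ^ k) (a * 2) (2 * K) (begin
    a * 2 + 4 * 2 ^ k              ≡⟨ cong (λ m → a * 2 + 4 * 2 ^ m) (*-identityʳ k) ⟨
    a * 2 + 4 * 2 ^ (k * 1)        ≤⟨ IH ⟩
    4 * 2 * 2 ^ (k * 1)            ≡⟨ cong (λ m → 4 * 2 * 2 ^ m) (*-identityʳ k) ⟩
    4 * 2 * 2 ^ k                  ≡⟨ halve (2 ^ k) ⟩
    2 * K + 4 * 2 ^ k              ∎)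
gauss-bound (suc k) (suc j) = +-cancelʳ-≤ (4 * X) _ _ (begin
  (gauss (k + suc (suc j)) k + K * gauss (k + suc (suc j)) (suc k)) * (2 * J) + 4 * X + 4 * X
    ≡⟨ cong (λ n → (a + K * gauss n (suc k)) * (2 * J) + 4 * X + 4 * X) (+-suc k (suc j)) ⟩
  (a + K * b) * (2 * J) + 4 * X + 4 * X
    ≡⟨ regroup a K b J X ⟩
  a * (2 * J) + (b * J * (2 * K) + 8 * X)
    -- The second instance, scaled by `2 * K`, supplies a term `8 * X`: half of it is the term in
    -- the claim, the other half pays for the first instance.
    ≤⟨ +-mono-≤ (left (gauss-bound k (suc j))) (right (gauss-bound (suc k) j)) ⟩
  4 * X + 8 * J * X
    ≡⟨ collect X J ⟩
  4 * (2 * J) * X + 4 * X ∎)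
  where
  open ≤-Reasoning
  J = 2 ^ suc j
  K = 2 ^ suc k
  X = 2 ^ (suc k * suc (suc j))
  x = 2 ^ (k * suc (suc j))
  z = 2 ^ (suc k * suc j)
  a = gauss (k + suc (suc j)) k
  b = gauss (suc k + suc j) (suc k)
  X≡ : X ≡ 2 * J * x
  X≡ = ^-distribˡ-+-* 2 (suc (suc j)) (k * suc (suc j))
  X≡′ : X ≡ K * z
  X≡′ = trans (cong (2 ^_) (*-suc (suc k) (suc j))) (^-distribˡ-+-* 2 (suc k) (suc k * suc j))
  regroup : ∀ a K b J X → (a + K * b) * (2 * J) + 4 * X + 4 * X ≡ a * (2 * J) + (b * J * (2 * K) + 8 * X)
  regroup = solve-∀
  collect : ∀ X J → 4 * X + 8 * J * X ≡ 4 * (2 * J) * X + 4 * X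
  collect = solve-∀
  left : a * (2 * J) + 4 * x ≤ 4 * (2 * J) * x → a * (2 * J) ≤ 4 * X
  left IH = begin
    a * (2 * J)              ≤⟨ m≤m+n _ (4 * x) ⟩
    a * (2 * J) + 4 * x      ≤⟨ IH ⟩
    4 * (2 * J) * x          ≡⟨ *-assoc 4 (2 * J) x ⟩
    4 * (2 * J * x)          ≡⟨ cong (4 *_) X≡ ⟨
    4 * X                    ∎
  expand : ∀ b J K z → b * J * (2 * K) + 8 * (K * z) ≡ (b * J + 4 * z) * (2 * K)
  expand = solve-∀
  contract : ∀ J K z → (4 * J * z) * (2 * K) ≡ 8 * J * (K * z)
  contract = solve-∀
  right : b * J + 4 * z ≤ 4 * J * z → b * J * (2 * K) + 8 * X ≤ 8 * J * X
  right IH = begin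
    b * J * (2 * K) + 8 * X            ≡⟨ cong (λ X → b * J * (2 * K) + 8 * X) X≡′ ⟩
    b * J * (2 * K) + 8 * (K * z)      ≡⟨ expand b J K z ⟩
    (b * J + 4 * z) * (2 * K)          ≤⟨ *-monoˡ-≤ (2 * K) IH ⟩
    (4 * J * z) * (2 * K)              ≡⟨ contract J K z ⟩
    8 * J * (K * z)                    ≡⟨ cong (8 * J *_) X≡′ ⟨
    8 * J * X                          ∎

gauss≤ : ∀ k j → gauss (k + j) k ≤ 4 * 2 ^ (k * j)
gauss≤ k zero = begin
  gauss (k + 0) k      ≡⟨ cong (λ n → gauss n k) (+-identityʳ k) ⟩
  gauss k k            ≡⟨ gauss-diagonal k ⟩
  1                    ≤⟨ s≤s z≤n ⟩
  4 * 2 ^ 0            ≡⟨ cong (λ m → 4 * 2 ^ m) (*-zeroʳ k) ⟨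
  4 * 2 ^ (k * 0)      ∎
  where open ≤-Reasoning
gauss≤ k (suc j) = *-cancelʳ-≤ _ _ (2 ^ suc j) {{m^n≢0 2 (suc j)}} (begin
  gauss (k + suc j) k * 2 ^ suc j                              ≤⟨ m≤m+n _ (4 * 2 ^ (k * suc j)) ⟩
  gauss (k + suc j) k * 2 ^ suc j + 4 * 2 ^ (k * suc j)        ≤⟨ gauss-bound k j ⟩
  4 * 2 ^ suc j * 2 ^ (k * suc j)                              ≡⟨ shuffle (2 ^ suc j) (2 ^ (k * suc j)) ⟩
  4 * 2 ^ (k * suc j) * 2 ^ suc j                              ∎)
  where open ≤-Reasoning
        shuffle : ∀ a b → 4 * a * b ≡ 4 * b * a
        shuffle = solve-∀

-- The two sides differ by the square of the difference of k and j.
4kj≤ : ∀ k j → k * j * 4 ≤ (k + j) * (k + j)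
4kj≤ k j with ≤-total k j
... | inj₁ k≤j = subst (λ j → k * j * 4 ≤ (k + j) * (k + j)) (m+[n∸m]≡n k≤j) (≤-trans (m≤m+n _ ((j ∸ k) * (j ∸ k))) (≤-reflexive (complete-square k (j ∸ k))))
  where complete-square : ∀ k d → k * (k + d) * 4 + d * d ≡ (k + (k + d)) * (k + (k + d))
        complete-square = solve-∀
... | inj₂ j≤k = subst (λ k → k * j * 4 ≤ (k + j) * (k + j)) (m+[n∸m]≡n j≤k) (≤-trans (m≤m+n _ ((k ∸ j) * (k ∸ j))) (≤-reflexive (complete-square j (k ∸ j))))
  where complete-square : ∀ j d → (j + d) * j * 4 + d * d ≡ (j + d + j) * (j + d + j)
        complete-square = solve-∀

sumN-≤ : ∀ n {f c} → (∀ {k} → k < n → f k ≤ c) → sumN n f ≤ n * c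
sumN-≤ zero    h = z≤n
sumN-≤ (suc n) {f} {c} h = subst (sumN n f + f n ≤_) (+-comm (n * c) c) (+-mono-≤ (sumN-≤ n (λ k< → h (m<n⇒m<1+n k<))) (h ≤-refl))

galois≤ : ∀ t → galois t ≤ suc t * (4 * 2 ^ (t * t / 4))
galois≤ t = sumN-≤ (suc t) λ {k} k< → subst (λ n → gauss n k ≤ 4 * 2 ^ (t * t / 4)) (m+[n∸m]≡n (≤-pred k<))
  (≤-trans (gauss≤ k (t ∸ k)) (*-monoʳ-≤ 4 (^-monoʳ-≤ 2 (begin
    k * (t ∸ k)              ≡⟨ m*n/n≡m (k * (t ∸ k)) 4 ⟨
    k * (t ∸ k) * 4 / 4      ≤⟨ /-monoˡ-≤ 4 (subst (λ n → k * (t ∸ k) * 4 ≤ n * n) (m+[n∸m]≡n (≤-pred k<)) (4kj≤ k (t ∸ k))) ⟩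
    t * t / 4                ∎))))
  where open ≤-Reasoning

square-cancel-≤ : ∀ {a b} → a * a ≤ b * b → a ≤ b
square-cancel-≤ {a} {b} h with ≤-total a b
... | inj₁ a≤b = a≤b
... | inj₂ b≤a with m≤n⇒m<n∨m≡n b≤a
...   | inj₁ b<a  = contradiction h (<⇒≱ (*-mono-< b<a b<a))
...   | inj₂ refl = ≤-refl

-- The ratio of the fourth power to `2 ^ t` peaks at 40.5 for t = 5, and from there on each step
-- multiplies the left side by less than 2. The power 64 is chosen so that 256 * 64 is the square of
-- 128.
fourth-power≤ : ∀ t → suc t * suc t * (suc t * suc t) ≤ 64 * 2 ^ t
fourth-power≤ 0 = ≤ᵇ⇒≤ 1 64 tt
fourth-power≤ 1 = ≤ᵇ⇒≤ 16 128 tt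
fourth-power≤ 2 = ≤ᵇ⇒≤ 81 256 tt
fourth-power≤ 3 = ≤ᵇ⇒≤ 256 512 tt
fourth-power≤ 4 = ≤ᵇ⇒≤ 625 1024 tt
fourth-power≤ 5 = ≤ᵇ⇒≤ 1296 2048 tt
fourth-power≤ (suc t@(suc (suc (suc (suc (suc s)))))) = begin
  suc (suc t) * suc (suc t) * (suc (suc t) * suc (suc t))    ≤⟨ subst (_≤ 2 * (suc t * suc t * (suc t * suc t))) refl (growth s) ⟩
  2 * (suc t * suc t * (suc t * suc t))                      ≤⟨ *-monoʳ-≤ 2 (fourth-power≤ t) ⟩
  2 * (64 * 2 ^ t)                                           ≡⟨ shuffle (2 ^ t) ⟩
  64 * (2 * 2 ^ t)                                           ∎
  where
  open ≤-Reasoning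
  shuffle : ∀ x → 2 * (64 * x) ≡ 64 * (2 * x)
  shuffle = solve-∀
  expand : ∀ s → 2 * ((6 + s) * (6 + s) * ((6 + s) * (6 + s))) ≡
           (7 + s) * (7 + s) * ((7 + s) * (7 + s)) + (s * s * s * s + 20 * (s * s * s) + 138 * (s * s) + 356 * s + 191)
  expand = solve-∀
  growth : ∀ s → (7 + s) * (7 + s) * ((7 + s) * (7 + s)) ≤ 2 * ((6 + s) * (6 + s) * ((6 + s) * (6 + s)))
  growth s = subst ((7 + s) * (7 + s) * ((7 + s) * (7 + s)) ≤_) (sym (expand s)) (m≤m+n _ _)

triangle : ℕ → ℕ
triangle zero    = 0
triangle (suc t) = triangle t + suc t

triangle-double : ∀ t → triangle t + triangle t ≡ t * t + t
triangle-double zero    = refl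
triangle-double (suc t) = begin
  triangle t + suc t + (triangle t + suc t)        ≡⟨ shuffle (triangle t) (suc t) ⟩
  triangle t + triangle t + (suc t + suc t)        ≡⟨ cong (_+ (suc t + suc t)) (triangle-double t) ⟩
  t * t + t + (suc t + suc t)                      ≡⟨ expand t ⟩
  suc t * suc t + suc t                            ∎
  where open ≡-Reasoning
        shuffle : ∀ a b → a + b + (a + b) ≡ a + a + (b + b)
        shuffle = solve-∀
        expand : ∀ t → t * t + t + (suc t + suc t) ≡ suc t * suc t + suc t
        expand = solve-∀

triangle-mono : ∀ {s t} → s ≤ t → triangle s ≤ triangle t
triangle-mono {t = zero}  z≤n = z≤n
triangle-mono {t = suc t} s≤ with m≤n⇒m<n∨m≡n s≤
... | inj₁ s<  = ≤-trans (triangle-mono (≤-pred s<)) (m≤m+n _ (suc t))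
... | inj₂ refl = ≤-refl

-- Compare fourth powers of `galois t`: four times `t * t / 4` is at most `t * t`, and the factor
-- `2 ^ t` that absorbs the fourth power of `suc t` raises the exponent to `t * t + t`, twice
-- `triangle t`. The constant is the root of 256 * 64, with 256 the fourth power of the 4 in
-- `galois≤`.
galois-square≤ : ∀ t → galois t * galois t ≤ 128 * 2 ^ triangle t
galois-square≤ t = square-cancel-≤ (begin
  galois t * galois t * (galois t * galois t)
    ≤⟨ *-mono-≤ (*-mono-≤ (galois≤ t) (galois≤ t)) (*-mono-≤ (galois≤ t) (galois≤ t)) ⟩
  n * (4 * M) * (n * (4 * M)) * (n * (4 * M) * (n * (4 * M)))
    ≡⟨ regroup n M ⟩
  256 * (n * n * (n * n) * (M * M * (M * M)))
    ≤⟨ *-monoʳ-≤ 256 (*-mono-≤ (fourth-power≤ t) M⁴≤) ⟩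
  256 * (64 * 2 ^ t * 2 ^ (t * t))
    ≡⟨ collect (2 ^ t) (2 ^ (t * t)) ⟩
  16384 * (2 ^ (t * t) * 2 ^ t)
    ≡⟨ cong (16384 *_) (trans (sym (^-distribˡ-+-* 2 (t * t) t)) (trans (cong (2 ^_) (sym (triangle-double t))) (^-distribˡ-+-* 2 (triangle t) (triangle t)))) ⟩
  16384 * (H * H)
    ≡⟨ split H ⟩
  128 * H * (128 * H) ∎)
  where
  open ≤-Reasoning
  n = suc t
  M = 2 ^ (t * t / 4)
  H = 2 ^ triangle t
  regroup : ∀ n M → n * (4 * M) * (n * (4 * M)) * (n * (4 * M) * (n * (4 * M))) ≡ 256 * (n * n * (n * n) * (M * M * (M * M)))
  regroup = solve-∀
  collect : ∀ a b → 256 * (64 * a * b) ≡ 16384 * (b * a)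
  collect = solve-∀
  split : ∀ H → 16384 * (H * H) ≡ 128 * H * (128 * H)
  split = solve-∀
  sum4 : ∀ m → m + m + (m + m) ≡ m * 4
  sum4 = solve-∀
  M⁴≤ : M * M * (M * M) ≤ 2 ^ (t * t)
  M⁴≤ = begin
    M * M * (M * M)                                                        ≡⟨ cong₂ _*_ (^-distribˡ-+-* 2 m m) (^-distribˡ-+-* 2 m m) ⟨
    2 ^ (m + m) * 2 ^ (m + m)                                              ≡⟨ ^-distribˡ-+-* 2 (m + m) (m + m) ⟨
    2 ^ (m + m + (m + m))                                                  ≤⟨ ^-monoʳ-≤ 2 (subst (_≤ t * t) (sym (sum4 m)) (m/n*n≤m (t * t) 4)) ⟩
    2 ^ (t * t)                                                            ∎
    where m = t * t / 4

-- The number of annihilators of pure sets.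

module FamilyBound (t⁺ t⁻ : ℕ) where

  open Labels t⁺ t⁻

  _⊞ᵥ_ : V → V → V
  (u , v) ⊞ᵥ (u′ , v′) = u ⊕ u′ , v ⊕ v′

  ann-closed : ∀ U {a b} → ann U a ≡ true → ann U b ≡ true → ann U (a ⊞ᵥ b) ≡ true
  ann-closed [] _ _ = refl
  ann-closed ((u , u′) ∷ U) {a , a′} {b , b′} ha hb = cong₂ _∧_
    (ann-closed U (∧-trueˡ ha) (∧-trueˡ hb))
    (trans (cong not (trans (cong₂ _xor_ (·-distribˡ-⊕ u a b) (·-distribˡ-⊕ u′ a′ b′)) (xor-interchange (u · a) (u · b) (u′ · a′) (u′ · b′))))
           (both (not-true (∧-trueʳ (ann U (a , a′)) ha)) (not-true (∧-trueʳ (ann U (b , b′)) hb))))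
    where both : ∀ {x y} → x ≡ false → y ≡ false → not (x xor y) ≡ true
          both refl refl = refl

  0⁺ : Label t⁺
  0⁺ = Vec.replicate t⁺ false
  0⁻ : Label t⁻
  0⁻ = Vec.replicate t⁻ false

  ann-0 : ∀ U → ann U (0⁺ , 0⁻) ≡ true
  ann-0 [] = refl
  ann-0 ((u , v) ∷ U) = cong₂ _∧_ (ann-0 U) (cong not (cong₂ _xor_ (·-zeroʳ u) (·-zeroʳ v)))

  subspace⁺ : ∀ U → Subspace (λ u → ann U (u , 0⁻))
  subspace⁺ U = record { contains-0 = ann-0 U ; closed = λ {u} {v} hu hv → subst (λ z → ann U (u ⊕ v , z) ≡ true) (⊕-zeroʳ 0⁻) (ann-closed U hu hv) }

  subspace⁻ : ∀ U → Subspace (λ v → ann U (0⁺ , v))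
  subspace⁻ U = record { contains-0 = ann-0 U ; closed = λ {u} {v} hu hv → subst (λ z → ann U (z , u ⊕ v) ≡ true) (⊕-zeroʳ 0⁺) (ann-closed U hu hv) }

  -- A pure constraint tests one component only: it moves to the matching factor and holds trivially
  -- on the other.
  ann-split : ∀ {U} → All Pure U → ∀ u v → ann U (u , v) ≡ ann U (u , 0⁻) ∧ ann U (0⁺ , v)
  ann-split [] u v = refl
  ann-split {_ ∷ U} (pure⁺ w ∷ p) u v = trans (cong₂ _∧_ (ann-split p u v) (cong not (cong ((w · u) xor_) (trans (zeroˡ-· v) (sym (·-zeroʳ 0⁻))))))
    (trans (∧-swap (ann U (u , 0⁻)) (ann U (0⁺ , v)) _) (cong (_∧_ _) (sym (trans (cong (λ b → ann U (0⁺ , v) ∧ not b) (cong₂ _xor_ (·-zeroʳ w) (zeroˡ-· v))) (∧-identityʳ _)))))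
  ann-split {_ ∷ U} (pure⁻ w ∷ p) u v = trans (cong₂ _∧_ (ann-split p u v) (cong not (cong (_xor (w · v)) (trans (zeroˡ-· u) (sym (·-zeroʳ 0⁺))))))
    (trans (∧-assoc (ann U (u , 0⁻)) (ann U (0⁺ , v)) _) (cong (_∧ (ann U (0⁺ , v) ∧ not ((0⁺ · 0⁺) xor (w · v)))) (sym (trans (cong (λ b → ann U (u , 0⁻) ∧ not b) (cong₂ _xor_ (zeroˡ-· u) (·-zeroʳ w))) (∧-identityʳ _)))))

  -- A position is mapped to the parity check kernels of the two sections of its annihilator. Equal
  -- kernels give equal annihilators, hence equal keys and, the keys being distinct, equal
  -- positions.
  family≤ : ∀ L → Distinct L → AllPure L → length L ≤ galois t⁺ * galois t⁻
  family≤ L d p = begin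
    length L                                                                      ≡⟨ length-tabulate (λ i → i) ⟨
    length (List.allFin (length L))                                               ≤⟨ unique-≤ (Unique.allFin⁺ (length L)) profile injective member ⟩
    length (cartesianProduct (kernelsBelow t⁺ (suc t⁺)) (kernelsBelow t⁻ (suc t⁻))) ≡⟨ length-product _,_ (kernelsBelow t⁺ (suc t⁺)) (kernelsBelow t⁻ (suc t⁻)) ⟩
    length (kernelsBelow t⁺ (suc t⁺)) * length (kernelsBelow t⁻ (suc t⁻))         ≡⟨ cong₂ _*_ (length-kernels t⁺ (suc t⁺)) (length-kernels t⁻ (suc t⁻)) ⟩
    galois t⁺ * galois t⁻                                                         ∎
    where
    open ≤-Reasoning
    U : Fin (length L) → List V
    U i = nth L (toℕ i)

    form : ∀ {t} {A : Label t → Bool} → Subspace A → ∃ λ B → B ∈ kernelsBelow t (suc t) × ∀ v → A v ≡ B v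
    form S = let (k , k≤ , f , m , _ , e) = kernel-form S in (null ∘ f) , ∈-kernelsBelow (s≤s k≤) m , e

    profile : Fin (length L) → (Label t⁺ → Bool) × (Label t⁻ → Bool)
    profile i = proj₁ (form (subspace⁺ (U i))) , proj₁ (form (subspace⁻ (U i)))

    member : ∀ {i} → i ∈ List.allFin (length L) → profile i ∈ cartesianProduct (kernelsBelow t⁺ (suc t⁺)) (kernelsBelow t⁻ (suc t⁻))
    member {i} _ = ∈-cartesianProduct⁺ (proj₁ (proj₂ (form (subspace⁺ (U i))))) (proj₁ (proj₂ (form (subspace⁻ (U i)))))

    describe : ∀ i u v → ann (U i) (u , v) ≡ proj₁ (profile i) u ∧ proj₂ (profile i) v
    describe i u v = trans (ann-split (p (toℕ<n i)) u v) (cong₂ _∧_ (proj₂ (proj₂ (form (subspace⁺ (U i)))) u) (proj₂ (proj₂ (form (subspace⁻ (U i)))) v))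

    injective : ∀ {i j} → i ∈ List.allFin (length L) → j ∈ List.allFin (length L) → profile i ≡ profile j → i ≡ j
    injective {i} {j} _ _ e = toℕ-injective (d (toℕ<n i) (toℕ<n j) (≈⇒key {U i} {U j} (by λ (u , v) →
      trans (describe i u v) (trans (cong (λ z → proj₁ z u ∧ proj₂ z v) e) (sym (describe j u v))))))

-- Reading the input

-- Cells after the end of `xs` are required to be 0 as well; this is what finally shows that the
-- traversal stops.
record Stream (M : ℕ → ℕ) (p : ℕ) (xs : List ℕ) : Set where
  constructor reads
  field cellAt : ∀ j → M (p + j) ≡ cell xs j

open Stream public

cell-++ʳ : ∀ xs {ys} j → cell (xs ++ ys) (length xs + j) ≡ cell ys j
cell-++ʳ []       j = refl
cell-++ʳ (_ ∷ xs) j = cell-++ʳ xs j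

stream-drop : ∀ {M p} xs {ys} → Stream M p (xs ++ ys) → Stream M (p + length xs) ys
stream-drop {M} {p} xs st = reads λ j → trans (cong M (+-assoc p (length xs) j)) (trans (cellAt st (length xs + j)) (cell-++ʳ xs j))

stream-≡ : ∀ {M p xs ys} → xs ≡ ys → Stream M p xs → Stream M p ys
stream-≡ {M} {p} = subst (Stream M p)

rowList : ∀ {n} → Vec Bool n → List ℕ
rowList r = map (λ b → if b then 1 else 0) (Vec.toList r)

length-rowList : ∀ {n} (r : Vec Bool n) → length (rowList r) ≡ n
length-rowList []      = refl
length-rowList (_ ∷ r) = cong suc (length-rowList r)

cell-rowList : ∀ {n} (r : Vec Bool n) {ys l} → l < n → cell (rowList r ++ ys) l ≡ bit (at r l)
cell-rowList (b ∷ r) {l = zero}  _       = refl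
cell-rowList (b ∷ r) {l = suc l} (s≤s h) = cell-rowList r h

length-encodeMatrix : ∀ {m n} (R : Matrix m n) → length (encodeMatrix R) ≡ m * n
length-encodeMatrix []      = refl
length-encodeMatrix (r ∷ R) = trans (length-++ (rowList r)) (cong₂ _+_ (length-rowList r) (length-encodeMatrix R))

stream-matrix : ∀ {m n M p} (R : Matrix m n) {ys} → Stream M p (encodeMatrix R ++ ys) →
                ∀ {k l} → k < m → l < n → M (p + (k * n + l)) ≡ bit (entry R k l)
stream-matrix {M = M} {p} (r ∷ R) {ys} st {zero}  {l} _ l< =
  trans (cellAt st l) (trans (cong (λ xs → cell xs l) (++-assoc (rowList r) (encodeMatrix R) ys)) (cell-rowList r l<))
stream-matrix {n = n} {M} {p} (r ∷ R) {ys} st {suc k} {l} (s≤s k<) l< =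
  trans (cong M (trans (cong (p +_) (+-assoc n (k * n) l)) (trans (sym (+-assoc p n _)) (cong (λ z → p + z + (k * n + l)) (sym (length-rowList r))))))
        (stream-matrix R (stream-drop (rowList r) (stream-≡ (++-assoc (rowList r) (encodeMatrix R) ys) st)) k< l<)

operator : ∀ {t M p} (g f₁ f₂ : Relabeling t) {ys} → Stream M p (2 ∷ encodeMatrix g ++ encodeMatrix f₁ ++ encodeMatrix f₂ ++ ys) →
           (∀ {k l} → k < t → l < t → M (p + 1 + 0 * (t * t) + (k * t + l)) ≡ bit (entry g k l)) ×
           (∀ {k l} → k < t → l < t → M (p + 1 + 1 * (t * t) + (k * t + l)) ≡ bit (entry f₁ k l)) ×
           (∀ {k l} → k < t → l < t → M (p + 1 + 2 * (t * t) + (k * t + l)) ≡ bit (entry f₂ k l)) ×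
           Stream M (p + 1 + 3 * (t * t)) ys
operator {t} {M} {p} g f₁ f₂ {ys} st =
  stream-matrix g at₀ , stream-matrix f₁ at₁ , stream-matrix f₂ at₂ , next (p + 1) 2 f₂ at₂
  where
  next : ∀ a k (R : Relabeling t) {zs} → Stream M (a + k * (t * t)) (encodeMatrix R ++ zs) → Stream M (a + (suc k) * (t * t)) zs
  next a k R {zs} s = subst (λ z → Stream M z zs)
    (trans (cong (a + k * (t * t) +_) (length-encodeMatrix R)) (trans (+-assoc a _ _) (cong (a +_) (+-comm (k * (t * t)) (t * t)))))
    (stream-drop (encodeMatrix R) s)

  at₀ : Stream M (p + 1 + 0 * (t * t)) (encodeMatrix g ++ encodeMatrix f₁ ++ encodeMatrix f₂ ++ ys)
  at₀ = subst (λ z → Stream M z (encodeMatrix g ++ encodeMatrix f₁ ++ encodeMatrix f₂ ++ ys)) (sym (+-identityʳ (p + 1))) (stream-drop (2 ∷ []) st)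

  at₁ : Stream M (p + 1 + 1 * (t * t)) (encodeMatrix f₁ ++ encodeMatrix f₂ ++ ys)
  at₁ = next (p + 1) 0 g at₀

  at₂ : Stream M (p + 1 + 2 * (t * t)) (encodeMatrix f₂ ++ ys)
  at₂ = next (p + 1) 1 f₁ at₁

-- The size of the parse tree.

nodes : Shape → ℕ
nodes leaf       = 1
nodes (node l r) = nodes l + (nodes r + 1)

leaves : ∀ s → List (Leaf s)
leaves leaf       = tt ∷ []
leaves (node l r) = map inj₁ (leaves l) ++ map inj₂ (leaves r)

leaves-unique : ∀ s → Unique (leaves s)
leaves-unique leaf       = [] ∷ []
leaves-unique (node l r) = Unique.++⁺ (Unique.map⁺ (λ { refl → refl }) (leaves-unique l)) (Unique.map⁺ (λ { refl → refl }) (leaves-unique r))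
  (λ (m , m′) → disjoint (∈-map⁻ inj₁ m) (∈-map⁻ inj₂ m′))
  where disjoint : ∀ {x : Leaf (node l r)} → ∃ (λ u → u ∈ leaves l × x ≡ inj₁ u) → ∃ (λ u → u ∈ leaves r × x ≡ inj₂ u) → ⊥
        disjoint (_ , _ , refl) (_ , _ , ())

nodes-leaves : ∀ s → nodes s + 1 ≡ 2 * length (leaves s)
nodes-leaves leaf = refl
nodes-leaves (node l r) = begin
  nodes l + (nodes r + 1) + 1                           ≡⟨ shuffle (nodes l) (nodes r) ⟩
  (nodes l + 1) + (nodes r + 1)                         ≡⟨ cong₂ _+_ (nodes-leaves l) (nodes-leaves r) ⟩
  2 * length (leaves l) + 2 * length (leaves r)         ≡⟨ *-distribˡ-+ 2 (length (leaves l)) _ ⟨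
  2 * (length (leaves l) + length (leaves r))           ≡⟨ cong (2 *_) (cong₂ _+_ (length-map inj₁ (leaves l)) (length-map inj₂ (leaves r))) ⟨
  2 * (length (map inj₁ (leaves l)) + length (map inj₂ (leaves r))) ≡⟨ cong (2 *_) (length-++ (map inj₁ (leaves l))) ⟨
  2 * length (leaves (node l r))                        ∎
  where open ≡-Reasoning
        shuffle : ∀ a b → a + (b + 1) + 1 ≡ (a + 1) + (b + 1)
        shuffle = solve-∀

variableOf : ∀ {n} → Literal n → Fin n
variableOf (pos w) = w
variableOf (neg w) = w

occurrences : ∀ {n m} → Vec (List (Literal n)) m → List (Fin n)
occurrences []       = []
occurrences (c ∷ cs) = map variableOf c ++ occurrences cs

length-occurrences : ∀ {n m} (cs : Vec (List (Literal n)) m) → length (occurrences cs) ≡ sum (map length (Vec.toList cs))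
length-occurrences []       = refl
length-occurrences (c ∷ cs) = trans (length-++ (map variableOf c)) (cong₂ _+_ (length-map variableOf c) (length-occurrences cs))

∈-occurrences : ∀ {n m} (cs : Vec (List (Literal n)) m) c {l} → l ∈ Vec.lookup cs c → variableOf l ∈ occurrences cs
∈-occurrences (c ∷ cs) zero    m = ∈-++⁺ˡ (∈-map⁺ variableOf m)
∈-occurrences (c ∷ cs) (suc i) m = ∈-++⁺ʳ (map variableOf c) (∈-occurrences cs i m)

#vars≤ : ∀ φ → #vars φ ≤ sum (map length (Vec.toList (clauses φ)))
#vars≤ φ = begin
  #vars φ                                        ≡⟨ length-tabulate (λ i → i) ⟨
  length (List.allFin (#vars φ))                 ≤⟨ unique-≤ (Unique.allFin⁺ (#vars φ)) (λ w → w) (λ _ _ e → e) (λ {w} _ → occurs w (occurring φ w)) ⟩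
  length (occurrences (clauses φ))               ≡⟨ length-occurrences (clauses φ) ⟩
  sum (map length (Vec.toList (clauses φ)))      ∎
  where
  open ≤-Reasoning
  occurs : ∀ w → (∃ λ c → pos w ∈ Vec.lookup (clauses φ) c ⊎ neg w ∈ Vec.lookup (clauses φ) c) → w ∈ occurrences (clauses φ)
  occurs w (c , inj₁ m) = ∈-occurrences (clauses φ) c m
  occurs w (c , inj₂ m) = ∈-occurrences (clauses φ) c m

-- A full binary tree has fewer than twice as many nodes as leaves. The leaves are the variables and
-- clauses, and there are no more variables than literal occurrences.
nodes≤ : ∀ {t⁺ t⁻} φ (T : SignedParseTree t⁺ t⁻ (formulaGraph φ)) → nodes (shape T) ≤ 2 * size φ
nodes≤ φ T = begin
  nodes (shape T)                         ≤⟨ m≤m+n _ 1 ⟩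
  nodes (shape T) + 1                     ≡⟨ nodes-leaves (shape T) ⟩
  2 * length (leaves (shape T))           ≤⟨ *-monoʳ-≤ 2 leaves≤ ⟩
  2 * (#vars φ + #clauses φ)              ≤⟨ *-monoʳ-≤ 2 (+-monoˡ-≤ (#clauses φ) (#vars≤ φ)) ⟩
  2 * (sum (map length (Vec.toList (clauses φ))) + #clauses φ) ≡⟨ cong (2 *_) (+-comm _ (#clauses φ)) ⟩
  2 * size φ                              ∎
  where
  open ≤-Reasoning
  open Inverse (vertex T) using (to; from; strictlyInverseʳ)
  vertices : List (Vertex φ)
  vertices = map inj₁ (List.allFin (#vars φ)) ++ map inj₂ (List.allFin (#clauses φ))
  member : ∀ v → v ∈ vertices
  member (inj₁ w) = ∈-++⁺ˡ (∈-map⁺ inj₁ (∈-allFin w))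
  member (inj₂ c) = ∈-++⁺ʳ (map inj₁ (List.allFin (#vars φ))) (∈-map⁺ inj₂ (∈-allFin c))
  leaves≤ : length (leaves (shape T)) ≤ #vars φ + #clauses φ
  leaves≤ = begin
    length (leaves (shape T))   ≤⟨ unique-≤ (leaves-unique (shape T)) to (λ {x} {x′} _ _ e → trans (sym (strictlyInverseʳ x)) (trans (cong from e) (strictlyInverseʳ x′))) (λ {x} _ → member (to x)) ⟩
    length vertices             ≡⟨ trans (length-++ (map inj₁ (List.allFin (#vars φ)))) (cong₂ _+_
                                     (trans (length-map inj₁ (List.allFin (#vars φ))) (length-tabulate {n = #vars φ} (λ i → i)))
                                     (trans (length-map inj₂ (List.allFin (#clauses φ))) (length-tabulate {n = #clauses φ} (λ i → i)))) ⟩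
    #vars φ + #clauses φ        ∎

tree-positive : ∀ {t s} → ParseTree t s → 0 < t
tree-positive {t} ⊙ = >-nonZero⁻¹ t
tree-positive (⊗[ _ ∣ _ , _ ] l _) = tree-positive l

zero-·ᴹ : ∀ {m n} (R : Matrix m n) → Vec.replicate m false ·ᴹ R ≡ Vec.replicate n false
zero-·ᴹ {m} {n} R = vec-ext λ {l} _ → trans (at-·ᴹ (Vec.replicate m false) R l)
  (trans (xsum-cong m (λ {k} _ → cong (_∧ entry R k l) (at-zero m k))) (trans (xsum-false m) (sym (at-zero n l))))
  where xsum-false : ∀ n → xsum n (λ _ → false) ≡ false
        xsum-false zero    = refl
        xsum-false (suc n) = cong (_xor false) (xsum-false n)

zero-·ᵀ : ∀ {m n} (R : Matrix m n) → Vec.replicate n false ·ᵀ R ≡ Vec.replicate m false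
zero-·ᵀ [] = refl
zero-·ᵀ (r ∷ R) = cong₂ _∷_ (·-zeroʳ r) (zero-·ᵀ R)

mul-zero : ∀ {t} tr (R : Relabeling t) → mul tr R (Vec.replicate t false) ≡ Vec.replicate t false
mul-zero false R = zero-·ᴹ R
mul-zero true  R = zero-·ᵀ R

-- Correctness of the program

-- The value of `y` stays abstract: correctness and cost only need that it bounds the number of
-- vectors and the length of any list of pure sets with distinct keys.
module Algorithm (t⁺ t⁻ y : ℕ) (0<t⁺ : 0 < t⁺) (0<t⁻ : 0 < t⁻) (q≤y : 2 ^ (t⁺ + t⁻) ≤ y)
                 (count≤ : ∀ L → Labels.Distinct t⁺ t⁻ L → Labels.AllPure t⁺ t⁻ L → length L ≤ y) where

  open Dims t⁺ t⁻
  open Labels t⁺ t⁻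
  open Runs (τ , y)

  record Basic (σ : State) : Set where
    constructor basic
    field
      dims  : ∀ s → index σ 0 (bit s) ≡ dim s
      space : index σ 4 0 ≡ q
      halfs : ∀ {r} → r < q → index σ 5 r ≡ half r
      odds  : ∀ {r} → r < q → index σ 6 r ≡ bit (odd r)

  open Basic public

  basic-agree : ∀ {σ σ′} → Agree 7 σ σ′ → Basic σ → Basic σ′
  basic-agree f (basic d z h o) = basic (λ s → trans (low f 0 refl _) (d s)) (trans (low f 4 refl _) z)
    (λ r< → trans (low f 5 refl _) (h r<)) (λ r< → trans (low f 6 refl _) (o r<))

  r-double : ∀ {e ν σ n} → indep (compile (double e ν)) e ≡ true → ⟦ e ⟧ᵉ σ ≡ n → n ≤ ⟦ ν ⟧ (τ , y) →
             Runs (double e ν) σ (λ σ′ → index σ′ 30 0 ≡ index σ 30 0 * 2 ^ n)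
  r-double {σ = σ} {n} ind en n≤ = r-for (λ k σ′ → index σ′ 30 0 ≡ index σ 30 0 * 2 ^ k) ind refl en n≤
    (sym (*-identityʳ _))
    (λ k σ′ _ _ _ i → r-put (trans (cong₂ _+_ i i) (twice (index σ 30 0) (2 ^ k))))
    (λ _ _ i → i)

  r-halfTable : ∀ {σ} → index σ 4 0 ≡ q → index σ 5 0 ≡ 0 → index σ 6 0 ≡ 0 →
                Runs halfTable σ (λ σ′ → ∀ {r} → r < q → index σ′ 5 r ≡ half r × index σ′ 6 r ≡ bit (odd r))
  r-halfTable {σ} zq h₀ o₀ = r-for (λ k σ′ → ∀ {r} → r ≤ k → index σ′ 5 r ≡ half r × index σ′ 6 r ≡ bit (odd r))
    refl refl zq q≤y (λ { {zero} _ → h₀ , o₀ })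
    (λ k σ′ k< _ xk inv → let (hk , ok) = inv {k} ≤-refl in
       r-put⨟ (r-put λ {r} r≤ →
         at-write r (index σ′ 22 0 + 1)
           (λ { eq → trans (cong₂ _+_ (trans (cong (index σ′ 5) xk) hk) (trans (cong (index σ′ 6) xk) ok))
                           (cong half (sym (trans eq (trans (cong (_+ 1) xk) (+-comm k 1))))) })
           (λ ne → proj₁ (inv (older xk r≤ ne)))
       , at-write r (index σ′ 22 0 + 1)
           (λ { eq → trans (cong (1 ∸_) (trans (cong (index σ′ 6) xk) ok)) (trans (bit-not (odd k))
                           (cong (λ z → bit (odd z)) (sym (trans eq (trans (cong (_+ 1) xk) (+-comm k 1)))))) })
           (λ ne → proj₂ (inv (older xk r≤ ne)))))
    (λ _ _ inv r< → inv (<⇒≤ r<))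
    where
    older : ∀ {x k r} → x ≡ k → r ≤ suc k → r ≢ x + 1 → r ≤ k
    older {k = k} refl r≤ ne with m≤n⇒m<n∨m≡n r≤
    ... | inj₁ r<  = ≤-pred r<
    ... | inj₂ r≡ = contradiction (trans r≡ (+-comm 1 k)) ne

  r-dotStep : ∀ s d {σ x y} → Basic σ → index σ 60 0 ≡ x → index σ 61 0 ≡ y → x < q → y < q → index σ 62 0 ≡ bit d →
              Runs (dotStep s) σ (λ σ′ → index σ′ 62 0 ≡ bit (d xor xsum (dim s) (λ k → bitAt x k ∧ bitAt y k))
                × index σ′ 60 0 ≡ halves (dim s) x × index σ′ 61 0 ≡ halves (dim s) y)
  r-dotStep s d {σ} {x} {y} b ex ey x< y< ed = r-for
    (λ k σ′ → index σ′ 62 0 ≡ bit (d xor xsum k F) × index σ′ 60 0 ≡ halves k x × index σ′ 61 0 ≡ halves k y)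
    refl refl (dims b s) (dim≤τ s)
    (trans ed (cong bit (sym (xor-identityʳ d))) , ex , ey)
    (λ k σ′ k< kp _ (i , ix , iy) →
      let b′ = basic-agree (keep-agree 7 {compile (dotStep s)} refl kp) b
          hx = ≤-<-trans (halves≤ k x) x<
          hy = ≤-<-trans (halves≤ k y) y<
      in r-put⨟ (r-put⨟ (r-put
        ( trans (bit-xorᵉ (d xor xsum k F) (F k) i
                  (bit-andᵉ (bitAt x k) (bitAt y k) (trans (cong (index σ′ 6) ix) (odds b′ hx)) (trans (cong (index σ′ 6) iy) (odds b′ hy))))
                (cong bit (xor-assoc d _ _))
        , trans (cong (index σ′ 5) ix) (halfs b′ hx)
        , trans (cong (index σ′ 5) iy) (halfs b′ hy)))))
    (λ _ _ i → i)
    where F = λ k → bitAt x k ∧ bitAt y k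

  Stored : ∀ s → State → ℕ → Relabeling (dim s) → Set
  Stored s σ a R = ∀ {k l} → k < dim s → l < dim s → index σ (2 + bit s) (a + (k * dim s + l)) ≡ bit (entry R k l)

  private
    stride : ∀ s tr → ℕ
    stride s tr = if tr then 1 else dim s

    ⟦stride⟧ : ∀ s tr {σ} → index σ 0 (bit s) ≡ dim s → ⟦ if tr then lit 1 else dimᵉ s ⟧ᵉ σ ≡ stride s tr
    ⟦stride⟧ s false e = e
    ⟦stride⟧ s true  e = refl

    ⟦stride′⟧ : ∀ s tr {σ} → index σ 0 (bit s) ≡ dim s → ⟦ if tr then dimᵉ s else lit 1 ⟧ᵉ σ ≡ stride s (not tr)
    ⟦stride′⟧ s false e = refl
    ⟦stride′⟧ s true  e = e

  r-evalEntry : ∀ s tr (F : ℕ → Bool) {σ x a} → Basic σ → x < q → index σ 55 0 ≡ x → index σ 56 0 ≡ a → index σ 57 0 ≡ 0 →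
                (∀ {k} → k < dim s → index σ (2 + bit s) (a + k * stride s tr) ≡ bit (F k)) →
                Runs (evalEntry s tr) σ (λ σ′ → index σ′ 57 0 ≡ bit (xsum (dim s) (λ k → bitAt x k ∧ F k)))
  r-evalEntry s tr F {σ} {x} {a} b x< ex ea ed st = r-for
    (λ k σ′ → index σ′ 57 0 ≡ bit (xsum k (λ k → bitAt x k ∧ F k)) × index σ′ 55 0 ≡ halves k x × index σ′ 56 0 ≡ a + k * stride s tr)
    refl refl (dims b s) (dim≤τ s)
    (ed , ex , trans ea (sym (+-identityʳ a)))
    (λ k σ′ k< kp _ (i , ix , ia) →
      let ag = keep-agree 7 {compile (evalEntry s tr)} refl kp
          b′ = basic-agree ag b
          hx = ≤-<-trans (halves≤ k x) x<
      in r-put⨟ (r-put⨟ (r-put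
        ( bit-xorᵉ (xsum k (λ k → bitAt x k ∧ F k)) (bitAt x k ∧ F k) i
            (bit-andᵉ (bitAt x k) (F k) (trans (cong (index σ′ 6) ix) (odds b′ hx))
              (trans (cong (index σ′ (2 + bit s)) ia) (trans (token-agree s (keep-agree 4 {compile (evalEntry s tr)} refl kp) _) (st k<))))
        , trans (cong (index σ′ 5) ix) (halfs b′ hx)
        , trans (cong₂ _+_ ia (⟦stride⟧ s tr (dims b′ s))) (next a (k * stride s tr) (stride s tr))))))
    (λ _ _ (i , _) → i)
    where next : ∀ a b c → a + b + c ≡ a + (c + b)
          next = solve-∀

  -- The accumulator `w` and the power `p` are arbitrary, so that the negative component can be
  -- appended to the positive one.
  r-evalRows : ∀ s tr {σ x w p a R} → Basic σ → x < q → Stored s σ a R →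
               index σ 50 0 ≡ x → index σ 51 0 ≡ w → index σ 52 0 ≡ 0 → index σ 52 1 ≡ p → index σ 53 0 ≡ a →
               Runs (evalRows s tr) σ (λ σ′ →
                 index σ′ 51 0 ≡ w + p * binary (dim s) (λ l → xsum (dim s) (λ k → bitAt x k ∧ entryᵀ tr R k l))
                 × index σ′ 52 0 ≡ 0 × index σ′ 52 1 ≡ p * 2 ^ dim s)
  r-evalRows s tr {σ} {x} {w} {p} {a} {R} b x< st ex ew e0 ep ea = r-for
    (λ l σ′ → index σ′ 51 0 ≡ w + p * binary l F × index σ′ 52 0 ≡ 0 × index σ′ 52 1 ≡ p * 2 ^ l
      × index σ′ 53 0 ≡ a + l * stride s (not tr))
    (steady tr) refl (dims b s) (dim≤τ s)
    (trans ew (sym (trans (cong (w +_) (*-zeroʳ p)) (+-identityʳ w))) , e0 , trans ep (sym (*-identityʳ p)) , trans ea (sym (+-identityʳ a)))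
    (λ l σ′ l< kp _ (iw , i0 , ip , ia) →
      let ag = keep-agree 7 {compile (evalRows s tr)} refl kp
          b′ = basic-agree ag b
      in r-put⨟ (r-put⨟ (r-put⨟ (r-seq
           (r-evalEntry s tr (λ k → entryᵀ tr R k l) (basic-put b′) x< (trans (ix kp 50 refl 0) ex) ia refl
             (λ {k} k< → trans (token-put s σ′ _) (trans (token-agree s (keep-agree 4 {compile (evalRows s tr)} refl kp) _) (trans (cong (index σ (2 + bit s)) (address tr a k l)) (stored tr k< l<)))))
           (λ σ″ kp′ eq →
             r-put⨟ (r-put⨟ (r-put
               ( trans (cong₂ _+_ (trans (ix kp′ 51 refl 0) iw)
                         (select σ″ (F l) eq (trans (ix kp′ 52 refl 0) i0) (trans (ix kp′ 52 refl 1) ip)))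
                       (collect w p (binary l F) (2 ^ l) (bit (F l)))
               , trans (ix kp′ 52 refl 0) i0
               , trans (cong₂ _+_ (trans (ix kp′ 52 refl 1) ip) (trans (ix kp′ 52 refl 1) ip)) (twice p (2 ^ l))
               , trans (cong₂ _+_ (trans (ix kp′ 53 refl 0) ia) (⟦stride′⟧ s tr (trans (ix kp′ 0 refl _) (dims b′ s)))) (next a (l * stride s (not tr)) (stride s (not tr)))))))))))
    (λ _ _ (iw , i0 , ip , _) → iw , i0 , ip)
    where
    F : ℕ → Bool
    F l = xsum (dim s) (λ k → bitAt x k ∧ entryᵀ tr R k l)

    -- The strides depend on `tr`, so the syntactic check evaluates only after a case distinction.
    steady : ∀ tr → indep (compile (evalRows s tr)) (dimᵉ s) ≡ true
    steady false = refl
    steady true  = refl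

    basic-put : ∀ {σ u v w} → Basic σ → Basic (σ ⟨ 55 ≔ u ⟩ ⟨ 56 ≔ v ⟩ ⟨ 57 ≔ w ⟩)
    basic-put (basic d z h o) = basic d z h o

    token-put : ∀ s σ {u v w} j → index (σ ⟨ 55 ≔ u ⟩ ⟨ 56 ≔ v ⟩ ⟨ 57 ≔ w ⟩) (2 + bit s) j ≡ index σ (2 + bit s) j
    token-put false σ j = refl
    token-put true  σ j = refl

    stored : ∀ tr {k l} → k < dim s → l < dim s →
             index σ (2 + bit s) (a + (if tr then l * dim s + k else k * dim s + l)) ≡ bit (entryᵀ tr R k l)
    stored false k< l< = st k< l<
    stored true  k< l< = st l< k<

    address : ∀ tr a k l → a + l * stride s (not tr) + k * stride s tr ≡ a + (if tr then l * dim s + k else k * dim s + l)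
    address false a k l = arith a l k (dim s)
      where arith : ∀ a l k d → a + l * 1 + k * d ≡ a + (k * d + l)
            arith = solve-∀
    address true a k l = arith a l k (dim s)
      where arith : ∀ a l k d → a + l * d + k * 1 ≡ a + (l * d + k)
            arith = solve-∀

    select : ∀ τ d {i} → index τ 57 0 ≡ bit d → index τ 52 0 ≡ 0 → index τ 52 1 ≡ i → index τ 52 (index τ 57 0) ≡ bit d * i
    select τ false e z _ rewrite e = z
    select τ true {i} e _ o rewrite e = trans o (sym (+-identityʳ i))

    collect : ∀ w p c e b → w + p * c + b * (p * e) ≡ w + p * (c + b * e)
    collect = solve-∀

    next : ∀ a b c → a + b + c ≡ a + (c + b)
    next = solve-∀

  r-evalStep : ∀ s μ tr {σ x w p a R} → Basic σ → x < q → ⟦ 15 [ lit (bit s) ]ᵉ +ᵉ offsetᵉ s μ ⟧ᵉ σ ≡ a → Stored s σ a R →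
               index σ 50 0 ≡ x → index σ 51 0 ≡ w → index σ 52 0 ≡ 0 → index σ 52 1 ≡ p →
               Runs (evalStep s μ tr) σ (λ σ′ →
                 index σ′ 51 0 ≡ w + p * binary (dim s) (λ l → xsum (dim s) (λ k → bitAt x k ∧ entryᵀ tr R k l))
                 × index σ′ 52 0 ≡ 0 × index σ′ 52 1 ≡ p * 2 ^ dim s × index σ′ 50 0 ≡ halves (dim s) x)
  r-evalStep s μ tr {σ} {x} {R = R} b x< ea st ex ew e0 ep =
    r-put⨟ (r-seq (r-evalRows s tr {R = R} (basic-put b) x< (λ k< l< → trans (token-put s σ _) (st k< l<)) ex ew e0 ep ea)
      (λ σ′ kp (iw , i0 , ip) →
        let b′ = basic-agree (keep-agree 7 {compile (evalRows s tr)} refl kp) (basic-put b) in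
        r-for (λ k σ″ → index σ″ 50 0 ≡ halves k x) refl refl (dims b′ s) (dim≤τ s)
          (trans (ix kp 50 refl 0) ex)
          (λ k σ″ _ kp′ _ i → r-put (trans (cong (index σ″ 5) i)
             (halfs (basic-agree (keep-agree 7 {compile (for 58 (dimᵉ s) 𝕋 (50 ≔ 5 [ ! 50 ]ᵉ))} refl kp′) b′) (≤-<-trans (halves≤ k x) x<))))
          (λ σ″ kp′ i → trans (ix kp′ 51 refl 0) iw , trans (ix kp′ 52 refl 0) i0 , trans (ix kp′ 52 refl 1) ip , i)))
    where
    basic-put : ∀ {σ u} → Basic σ → Basic (σ ⟨ 53 ≔ u ⟩)
    basic-put (basic d z h o) = basic d z h o

    token-put : ∀ s σ {u} j → index (σ ⟨ 53 ≔ u ⟩) (2 + bit s) j ≡ index σ (2 + bit s) j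
    token-put false σ j = refl
    token-put true  σ j = refl

  -- Enumeration of the annihilators.

  Q : ℕ
  Q = 2 ^ q

  key<Q : ∀ U → key U < Q
  key<Q U = horner<2^n q (char U)

  q≤Q : q ≤ Q
  q≤Q = <⇒≤ (n<2^n q)
    where n<2^n : ∀ n → n < 2 ^ n
          n<2^n zero = ≤-refl
          n<2^n (suc n) = begin
            suc (suc n)        ≡⟨ cong suc (+-comm 1 n) ⟩
            suc n + 1          ≤⟨ +-mono-≤ (n<2^n n) (≤-trans (m^n>0 2 n) (m≤m+n (2 ^ n) 0)) ⟩
            2 * 2 ^ n          ∎
            where open ≤-Reasoning

  record Row (σ : State) (U : List V) : Set where
    constructor row
    field
      shift : index σ 9 (key U) ≡ key U * Q
      bits  : ∀ {r} → r < q → index σ 10 (key U * Q + r) ≡ bit (char U r)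

  open Row public

  -- `marked` and `unmarked` together say that memory 11 is nonzero exactly at the keys occurring in
  -- `L`, so membership is tested by one access.
  record Fam (σ : State) (L : List (List V)) : Set where
    constructor fam
    field
      count    : index σ 7 0 ≡ length L
      keyAt    : ∀ {i} → i < length L → index σ 8 i ≡ key (nth L i)
      rows     : ∀ {i} → i < length L → Row σ (nth L i)
      marked   : ∀ {i} → i < length L → index σ 11 (key (nth L i)) ≡ 1
      unmarked : ∀ k → index σ 11 k ≡ 0 ⊎ HasKey L k
      distinct : Distinct L
      allPure  : AllPure L

  open Fam public

  fam-agree : ∀ {σ σ′ L} → Agree 12 σ σ′ → Fam σ L → Fam σ′ L
  fam-agree {σ} f F = fam (trans (low f 7 refl _) (count F)) (λ i< → trans (low f 8 refl _) (keyAt F i<))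
    (λ i< → row (trans (low f 9 refl _) (shift (rows F i<))) (λ r< → trans (low f 10 refl _) (bits (rows F i<) r<)))
    (λ i< → trans (low f 11 refl _) (marked F i<))
    (λ k → map₁ (trans (low f 11 refl k)) (unmarked F k)) (distinct F) (allPure F)
    where map₁ : ∀ {A B C : Set} → (A → B) → A ⊎ C → B ⊎ C
          map₁ f (inj₁ a) = inj₁ (f a)
          map₁ f (inj₂ c) = inj₂ c

  vector-dot : ∀ u r → vector u ∙ vector r ≡
    (false xor xsum t⁺ (λ k → bitAt u k ∧ bitAt r k)) xor xsum t⁻ (λ k → bitAt (halves t⁺ u) k ∧ bitAt (halves t⁺ r) k)
  vector-dot u r = cong₂ _xor_ (dot t⁺ u r) (dot t⁻ (halves t⁺ u) (halves t⁺ r))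
    where dot : ∀ n x y → vec n x · vec n y ≡ xsum n (λ k → bitAt x k ∧ bitAt y k)
          dot n x y = trans (·-xsum (vec n x) (vec n y)) (xsum-cong n (λ k< → cong₂ _∧_ (at-tab n _ k<) (at-tab n _ k<)))

  record Candidate (σ : State) (U : List V) : Set where
    constructor candidate-is
    field
      isKey  : index σ 66 0 ≡ key U
      isChar : ∀ {r} → r < q → index σ 67 r ≡ bit (char U r)

  open Candidate public

  r-candidate : ∀ {σ U u a} → Basic σ → u < q → index σ 65 0 ≡ u → index σ 64 0 ≡ a →
                (∀ {r} → r < q → index σ 10 (a + r) ≡ bit (char U r)) →
                Runs candidate σ (λ σ′ → Candidate σ′ (vector u ∷ U))
  r-candidate {σ} {U} {u} {a} b u< eu ea h = r-put⨟ (r-for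
    (λ k σ′ → index σ′ 66 0 ≡ horner k F × (∀ {r} → r < k → index σ′ 67 r ≡ bit (F r)))
    refl refl (space b) q≤y (refl , λ ())
    (λ k σ′ k< kp xk (ik , ir) →
      let b₁ : Basic (σ′ ⟨ 60 ≔ index σ′ 65 0 ⟩ ⟨ 61 ≔ index σ′ 68 0 ⟩ ⟨ 62 ≔ 0 ⟩)
          b₁ = basic-put (basic-agree (keep-agree 7 {compile loop} refl kp) (basic-put′ b))
      in r-put⨟ (r-put⨟ (r-put⨟ (r-seq
        (r-dotStep false false b₁ (trans (ix kp 65 refl 0) eu) xk u< k< refl)
        λ σ₁ kp₁ (i62 , i60 , i61) → r-seq
        (r-dotStep true (false xor xsum t⁺ (λ j → bitAt u j ∧ bitAt k j)) (basic-agree (keep-agree 7 {compile (dotStep false)} refl kp₁) b₁) i60 i61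
          (≤-<-trans (halves≤ t⁺ u) u<) (≤-<-trans (halves≤ t⁺ k) k<) i62)
        λ σ₂ kp₂ (i62′ , _ , _) →
          let x68 = trans (ix kp₂ 68 refl 0) (trans (ix kp₁ 68 refl 0) xk)
              val : (index σ₂ 10 (index σ₂ 64 0 + index σ₂ 68 0) + (1 ∸ index σ₂ 62 0)) ∸ 1 ≡ bit (F k)
              val = trans (bit-andᵉ (char U k) (not (vector u ∙ vector k))
                      (trans (ix kp₂ 10 refl _) (trans (ix kp₁ 10 refl _) (trans (ix kp 10 refl _)
                        (trans (cong (index σ 10) (cong₂ _+_ (trans (ix kp₂ 64 refl 0) (trans (ix kp₁ 64 refl 0) (trans (ix kp 64 refl 0) ea))) x68)) (h k<)))))
                      (trans (cong (1 ∸_) (trans i62′ (cong bit (sym (vector-dot u k))))) (bit-not (vector u ∙ vector k))))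
                      refl
          in r-put⨟ (r-put
            ( cong₂ _+_ (cong₂ _+_ (old66 kp₁ kp₂ ik) (old66 kp₁ kp₂ ik)) (trans (at-write≡ (index σ₂ 68 0)) val)
            , λ {r} r< → at-write r (index σ₂ 68 0) (λ e → trans val (cong (λ z → bit (F z)) (sym (trans e x68))))
                (λ ne → trans (ix kp₂ 67 refl r) (trans (ix kp₁ 67 refl r) (ir (before r< (λ e → ne (trans e (sym x68)))))))))))))
    (λ _ _ (ik , ir) → candidate-is ik ir))
    where
    F = char (vector u ∷ U)

    loop = for 68 (! 4) 𝕐
      ( 60 ≔ ! 65 ⨟ 61 ≔ ! 68 ⨟ 62 ≔ lit 0 ⨟ dotStep false ⨟ dotStep true
      ⨟ put 67 (! 68) (andᵉ (10 [ ! 64 +ᵉ ! 68 ]ᵉ) (lit 1 ∸ᵉ ! 62)) ⨟ 66 ≔ ! 66 +ᵉ ! 66 +ᵉ 67 [ ! 68 ]ᵉ )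

    basic-put : ∀ {σ u v w} → Basic σ → Basic (σ ⟨ 60 ≔ u ⟩ ⟨ 61 ≔ v ⟩ ⟨ 62 ≔ w ⟩)
    basic-put (basic d z h o) = basic d z h o

    basic-put′ : ∀ {σ u} → Basic σ → Basic (σ ⟨ 66 ≔ u ⟩)
    basic-put′ (basic d z h o) = basic d z h o

    old66 : ∀ {σ σ₁ σ₂ x y v} → Keep (compile (dotStep false)) (σ ⟨ 60 ≔ x ⟩ ⟨ 61 ≔ y ⟩ ⟨ 62 ≔ 0 ⟩) σ₁ → Keep (compile (dotStep true)) σ₁ σ₂ →
            index σ 66 0 ≡ v → index σ₂ 66 0 ≡ v
    old66 kp₁ kp₂ e = trans (ix kp₂ 66 refl 0) (trans (ix kp₁ 66 refl 0) e)

    before : ∀ {r k} → r < suc k → r ≢ k → r < k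
    before r< ne = ≤∧≢⇒< (≤-pred r<) ne

  -- Every written value is determined by its address, so rewriting an existing
  -- row is harmless.
  r-insert : ∀ {σ U L} → Basic σ → Fam σ L → All Pure U → Candidate σ U →
             Runs insert σ (λ σ′ → ∃ λ L′ → L ⊑ L′ × Fam σ′ L′ × HasKey L′ (key U))
  r-insert {σ} {U} {L} b F pU c = r-put⨟ (r-seq
    (r-double refl (space b) q≤y)
    λ σ₁ kp₁ e30 →
      let k66 : index σ₁ 66 0 ≡ key U
          k66 = trans (ix kp₁ 66 refl 0) (isKey c)
          s30 : index σ₁ 30 0 ≡ key U * Q
          s30 = trans e30 (cong (_* Q) (isKey c))
      in r-put⨟ (r-seq
    (r-for (λ k σ′ → (∀ {r} → r < k → index σ′ 10 (key U * Q + r) ≡ bit (char U r)) ×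
                     (∀ {i r} → i < length L → r < q → index σ′ 10 (key (nth L i) * Q + r) ≡ bit (char (nth L i) r)))
       refl refl (trans (ix kp₁ 4 refl 0) (space b)) q≤y
       ((λ ()) , λ i< r< → trans (ix kp₁ 10 refl _) (bits (rows F i<) r<))
       (λ k σ′ k< kp xk (new , old) →
         let adr : index σ′ 30 0 + index σ′ 72 0 ≡ key U * Q + k
             adr = cong₂ _+_ (trans (ix kp 30 refl 0) s30) xk
             val : index σ′ 67 (index σ′ 72 0) ≡ bit (char U k)
             val = trans (cong (index σ′ 67) xk) (trans (ix kp 67 refl k) (trans (ix kp₁ 67 refl k) (isChar c k<)))
         in r-put
         ( (λ {r} r< → at-write (key U * Q + r) _
              (λ e → trans val (cong (λ z → bit (char U z)) (sym (+-cancelˡ-≡ (key U * Q) r k (trans e adr)))))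
              (λ ne → new (≤∧≢⇒< (≤-pred r<) (λ e → ne (trans (cong (key U * Q +_) e) (sym adr))))))
         , λ {i} {r} i< r< → at-write (key (nth L i) * Q + r) _
              (λ e → let (ek , er) = *+-injective {Q} {key (nth L i)} {key U} (<-≤-trans r< q≤Q) (<-≤-trans k< q≤Q) (trans e adr)
                     in trans val (cong bit (trans (sym (on (key⇒≈ {nth L i} {U} ek) (vector k))) (cong (char (nth L i)) (sym er)))))
              (λ _ → old i< r<)))
       (λ _ _ i → i))
    λ σ₂ kp₂ (new , old) →
      let k66′ : index σ₂ 66 0 ≡ key U
          k66′ = trans (ix kp₂ 66 refl 0) k66
          sh : index σ₂ 9 (key U) ≡ key U * Q
          sh = trans (ix kp₂ 9 refl _) (at-write (key U) (index σ₁ 66 0) (λ _ → s30) (λ ne → contradiction (sym k66) ne))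
          c7 : index σ₂ 7 0 ≡ length L
          c7 = trans (ix kp₂ 7 refl _) (trans (ix kp₁ 7 refl _) (count F))
          c8 : ∀ {i} → i < length L → index σ₂ 8 i ≡ key (nth L i)
          c8 i< = trans (ix kp₂ 8 refl _) (trans (ix kp₁ 8 refl _) (keyAt F i<))
          sh′ : ∀ {i} → i < length L → index σ₂ 9 (key (nth L i)) ≡ key (nth L i) * Q
          sh′ {i} i< = trans (ix kp₂ 9 refl _) (at-write (key (nth L i)) (index σ₁ 66 0)
                         (λ e → trans s30 (cong (_* Q) (sym (trans e k66))))
                         (λ _ → trans (ix kp₁ 9 refl _) (shift (rows F i<))))
          c11 : ∀ j → index σ₂ 11 j ≡ index σ 11 j
          c11 j = trans (ix kp₂ 11 refl j) (ix kp₁ 11 refl j)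
          F₂ : Fam σ₂ L
          F₂ = fam c7 c8 (λ i< → row (sh′ i<) (old i<)) (λ i< → trans (c11 _) (marked F i<))
                 (λ k → subst (λ z → z ≡ 0 ⊎ HasKey L k) (sym (c11 k)) (unmarked F k)) (distinct F) (allPure F)
      in r-if
        (λ seen → r-nop (L , ⊑-refl , F₂ , present F₂ k66′ seen))
        (λ unseen →
          let fresh : ¬ HasKey L (key U)
              fresh (i , i< , e) = contradiction (trans (sym (marked F₂ i<)) (trans (cong (index σ₂ 11) (trans e (sym k66′))) unseen)) λ ()
              L′ = L ++ U ∷ []
              e′ = ⊑-∷ʳ L U
          in r-put⨟ (r-put⨟ (r-put (L′ , e′ , record
            { count = trans (cong (_+ 1) c7) (trans (+-comm (length L) 1) (sym (length-∷ʳ L U)))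
            ; keyAt = λ {i} i< → at-write i (index σ₂ 7 0)
                (λ e → trans k66′ (cong key (trans (sym (nth-∷ʳ L U)) (cong (nth L′) (sym (trans e c7))))))
                (λ ne → case-new i< (λ o → trans (c8 o) (cong key (sym (same e′ o)))) (λ e → contradiction (trans e (sym c7)) ne))
            ; rows = λ {i} i< → case-new i<
                (λ o → subst (Row _) (sym (same e′ o)) (row (sh′ o) (old o)))
                (λ e → subst (Row _) (trans (sym (nth-∷ʳ L U)) (cong (nth L′) (sym e))) (row sh new))
            ; marked = λ {i} i< → at-write (key (nth L′ i)) (index σ₂ 66 0) (λ _ → refl)
                (λ ne → case-new i<
                  (λ o → trans (cong (λ z → index σ₂ 11 (key z)) (same e′ o)) (marked F₂ o))
                  (λ e → contradiction (trans (cong key (trans (cong (nth L′) e) (nth-∷ʳ L U))) (sym k66′)) ne))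
            ; unmarked = λ k → at-write⊎ k (index σ₂ 66 0)
                (λ e → length L , subst (length L <_) (sym (length-∷ʳ L U)) ≤-refl , trans (cong key (nth-∷ʳ L U)) (sym (trans e k66′)))
                (mapR (hasKey-⊑ e′) (unmarked F₂ k))
            ; distinct = distinct-∷ʳ L U (distinct F) fresh
            ; allPure = allPure-∷ʳ L U (allPure F) pU
            } , length L , subst (length L <_) (sym (length-∷ʳ L U)) ≤-refl , cong key (nth-∷ʳ L U)))))))
    where
    present : ∀ {σ₂} → Fam σ₂ L → index σ₂ 66 0 ≡ key U → index σ₂ 11 (index σ₂ 66 0) ≢ 0 → HasKey L (key U)
    present {σ₂} F₂ e seen with unmarked F₂ (index σ₂ 66 0)
    ... | inj₁ z = contradiction z seen
    ... | inj₂ h = subst (HasKey L) e h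

    case-new : ∀ {A : Set} {i} → i < length (L ++ U ∷ []) → (i < length L → A) → (i ≡ length L → A) → A
    case-new i< f g with ∷ʳ-case L U i<
    ... | inj₁ o = f o
    ... | inj₂ e = g e

    at-write⊎ : ∀ j i {v x : ℕ} {B : Set} → (j ≡ i → B) → (x ≡ 0 ⊎ B) → (if j ≡ᵇ i then v else x) ≡ 0 ⊎ B
    at-write⊎ zero    zero    f g = inj₂ (f refl)
    at-write⊎ zero    (suc i) f g = g
    at-write⊎ (suc j) zero    f g = g
    at-write⊎ (suc j) (suc i) f g = at-write⊎ j i (λ e → f (cong suc e)) g

    mapR : ∀ {A B C : Set} → (B → C) → A ⊎ B → A ⊎ C
    mapR f (inj₁ a) = inj₁ a
    mapR f (inj₂ b) = inj₂ (f b)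

  r-extendAll : ∀ {σ L u} → Basic σ → Fam σ L → u < q → Pure (vector u) → index σ 65 0 ≡ u →
                Runs extendAll σ (λ σ′ → ∃ λ L′ → L ⊑ L′ × Fam σ′ L′ × (∀ {i} → i < length L → HasKey L′ (key (vector u ∷ nth L i))))
  r-extendAll {σ} {L} {u} b F u< pu eu = r-put⨟ (r-for
    (λ k σ′ → ∃ λ L′ → L ⊑ L′ × Fam σ′ L′ × (∀ {i} → i < k → HasKey L′ (key (vector u ∷ nth L i))))
    refl refl (count F) (count≤ L (distinct F) (allPure F))
    (L , ⊑-refl , fam-agree (agree-trans (agree-put {a = 69} refl) (agree-put {a = 70} refl)) F , λ ())
    (λ k σ′ k< kp xk (L₁ , e₁ , F₁ , has) →
      let b₁ : Basic (σ′ ⟨ 71 ≔ index σ′ 8 (index σ′ 70 0) ⟩ ⟨ 64 ≔ index σ′ 9 (index σ′ 8 (index σ′ 70 0)) ⟩)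
          b₁ = basic-agree (agree-trans (agree-put {a = 71} refl) (agree-put {a = 64} refl))
                 (basic-agree (keep-agree 7 {compile loop} refl kp) (basic-agree (agree-put {a = 69} refl) b))
          F₂ : Fam (σ′ ⟨ 71 ≔ index σ′ 8 (index σ′ 70 0) ⟩ ⟨ 64 ≔ index σ′ 9 (index σ′ 8 (index σ′ 70 0)) ⟩) L₁
          F₂ = fam-agree (agree-trans (agree-put {a = 71} refl) (agree-put {a = 64} refl)) F₁
          k<₁ = <-≤-trans k< (longer e₁)
          kk : index σ′ 8 (index σ′ 70 0) ≡ key (nth L₁ k)
          kk = trans (cong (index σ′ 8) xk) (keyAt F₁ k<₁)
      in r-put⨟ (r-put⨟ (r-seq
        (r-candidate {U = nth L₁ k} b₁ u< (trans (ix kp 65 refl 0) eu)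
          (trans (cong (index σ′ 9) kk) (shift (rows F₁ k<₁))) (bits (rows F₁ k<₁)))
        λ σ₂ kp₂ cand → r-conseq
        (r-insert (basic-agree (keep-agree 7 {compile candidate} refl kp₂) b₁)
                  (fam-agree (keep-agree 12 {compile candidate} refl kp₂) F₂) (pu ∷ allPure F₁ k<₁) cand)
        λ σ₃ kp₃ (L₃ , e₃ , F₃ , h) → L₃ , ⊑-trans e₁ e₃ , fam-agree (agree-put {a = 70} refl) F₃ ,
          λ {i} i< → latest e₃ has (subst (λ z → HasKey L₃ (key (vector u ∷ z))) (same e₁ k<) h) i<)))
    (λ _ _ i → i))
    where
    loop = for 70 (! 69) 𝕐 ( 71 ≔ 8 [ ! 70 ]ᵉ ⨟ 64 ≔ 9 [ ! 71 ]ᵉ ⨟ candidate ⨟ insert )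

    latest : ∀ {k L₁ L₃} → L₁ ⊑ L₃ → (∀ {i} → i < k → HasKey L₁ (key (vector u ∷ nth L i))) → HasKey L₃ (key (vector u ∷ nth L k)) →
             ∀ {i} → i < suc k → HasKey L₃ (key (vector u ∷ nth L i))
    latest e old new i< with m≤n⇒m<n∨m≡n (≤-pred i<)
    ... | inj₁ i<k  = hasKey-⊑ e (old i<k)
    ... | inj₂ refl = new

  code-zero : ∀ n → code (Vec.replicate n false) ≡ 0
  code-zero n = go n (at-zero n)
    where go : ∀ m {f} → (∀ k → f k ≡ false) → binary m f ≡ 0
          go zero    h = refl
          go (suc m) h rewrite h m = trans (+-identityʳ _) (go m h)

  vec-zero : ∀ n → vec n 0 ≡ Vec.replicate n false
  vec-zero n = trans (cong (vec n) (sym (code-zero n))) (vec-code (Vec.replicate n false))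

  vector-low : ∀ {r} → r < 2 ^ t⁺ → vector r ≡ (vec t⁺ r , Vec.replicate t⁻ false)
  vector-low {r} r< = cong (vec t⁺ r ,_) (trans (cong (vec t⁻) (halves-zero t⁺ r<)) (vec-zero t⁻))

  vector-high : ∀ j → vector (j * 2 ^ t⁺) ≡ (Vec.replicate t⁺ false , vec t⁻ j)
  vector-high j = cong₂ _,_
    (trans (cong (vec t⁺) eq) (vec-code+ (Vec.replicate t⁺ false) j))
    (cong (vec t⁻) (trans (cong (halves t⁺) eq) (halves-binary t⁺ (at (Vec.replicate t⁺ false)) j)))
    where eq : j * 2 ^ t⁺ ≡ code (Vec.replicate t⁺ false) + 2 ^ t⁺ * j
          eq = trans (*-comm j _) (cong (_+ 2 ^ t⁺ * j) (sym (code-zero t⁺)))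

  Low High : ℕ → V → Set
  Low k v = ∃ λ r → r < k × v ≡ vector r
  High k v = ∃ λ j → j < k × v ≡ vector (j * 2 ^ t⁺)

  pure-reached : ∀ {v} → Pure v → Low (2 ^ t⁺) v ⊎ High (2 ^ t⁻) v
  pure-reached (pure⁺ u) = inj₁ (code u , binary<2^n t⁺ (at u) , sym (trans (vector-low (binary<2^n t⁺ (at u))) (cong (_, _) (vec-code u))))
  pure-reached (pure⁻ v) = inj₂ (code v , binary<2^n t⁻ (at v) , sym (trans (vector-high (code v)) (cong (_ ,_) (vec-code v))))

  -- The invariant is completeness for the vectors processed so far, first those of `Low`, then also
  -- those of `High`; by `pure-reached` these are all pure vectors. Only pure vectors are added, so
  -- every listed set stays pure and `count≤` bounds the list at all times.
  r-enumerate : ∀ {σ} → Basic σ → index σ 13 0 ≡ 2 ^ t⁺ → index σ 29 0 ≡ 2 ^ t⁻ → index σ 7 0 ≡ 0 → (∀ k → index σ 11 k ≡ 0) →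
                Runs enumerate σ (λ σ′ → ∃ λ L → Fam σ′ L × Complete Pure L × index σ′ 13 0 ≡ 2 ^ t⁺ × index σ′ 13 1 ≡ key [])
  r-enumerate {σ} b e13 e29 e7 e11 = r-put⨟ (r-seq
    (r-for (λ k σ′ → index σ′ 66 0 ≡ horner k (char []) × (∀ {r} → r < k → index σ′ 67 r ≡ 1))
      refl refl (space b) q≤y (refl , λ ())
      (λ k σ′ k< kp xk (ik , ir) → r-put⨟ (r-put
        ( cong (_+ 1) (cong₂ _+_ ik ik)
        , λ {r} r< → at-write r (index σ′ 68 0) (λ _ → refl) (λ ne → ir (≤∧≢⇒< (≤-pred r<) (λ e → ne (trans e (sym xk))))))))
      (λ σ′ _ (ik , ir) → candidate-is {σ′} {[]} ik ir))
    λ σ₁ kp₁ cand →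
      let b₁ = basic-agree (agree-put {a = 13} refl) (basic-agree (keep-agree 7 {compile start} refl kp₁) (basic-agree (agree-put {a = 66} refl) b))
          F₀ : Fam (σ₁ ⟨ 13 # 1 ≔ index σ₁ 66 0 ⟩) []
          F₀ = fam (trans (ix kp₁ 7 refl 0) e7) (λ ()) (λ ()) (λ ()) (λ k → inj₁ (trans (ix kp₁ 11 refl k) (e11 k))) (λ ()) (λ ())
      in r-put⨟ (r-seq (r-insert b₁ F₀ [] (candidate-is {U = []} (isKey cand) (isChar cand)))
    λ σ₂ kp₂ (L₂ , e₂ , F₂ , h₂) →
      let b₂ = basic-agree (keep-agree 7 {compile insert} refl kp₂) b₁
      in r-put⨟ (r-seq
    (r-for (λ k σ′ → index σ′ 65 0 ≡ k × ∃ λ L → L₂ ⊑ L × Fam σ′ L × Complete (Low k) L) refl refl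
      (trans (ix kp₂ 13 refl 0) (trans (ix kp₁ 13 refl 0) e13)) (≤-trans low≤q q≤y)
      (refl , L₂ , ⊑-refl , fam-agree (agree-trans (agree-put {a = 65} refl) (agree-put {a = 73} refl)) F₂
        , λ { [] → h₂ ; ((_ , () , _) ∷ _) })
      (λ k σ′ k< kp xk (i65 , L , e , F , c) →
        let b′ = basic-agree (keep-agree 7 {compile loop₁} refl kp) (basic-agree (agree-put {a = 65} refl) b₂)
        in r-seq (r-extendAll b′ F (<-≤-trans k< low≤q) (subst Pure (sym (vector-low k<)) (pure⁺ _)) i65)
           λ σ″ kp″ (L″ , e″ , F″ , st) → r-put
             ( trans (cong (_+ 1) (trans (ix kp″ 65 refl 0) i65)) (+-comm k 1)
             , L″ , ⊑-trans e e″ , fam-agree (agree-trans (agree-put {a = 65} refl) (agree-put {a = 73} refl)) F″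
             , complete-mono L″ (λ { (r , r< , eq) → splitLow r< eq }) (complete-step (vector k) e″ c st)))
      (λ _ _ i → i))
    λ σ₃ kp₃ (_ , L₃ , e₃ , F₃ , c₃) →
      let b₃ = basic-agree (keep-agree 7 {compile loop₁} refl kp₃) (basic-agree (agree-put {a = 65} refl) b₂)
      in r-put⨟
    (r-for (λ k σ′ → index σ′ 65 0 ≡ k * 2 ^ t⁺ × ∃ λ L → L₂ ⊑ L × Fam σ′ L × Complete (λ v → Low (2 ^ t⁺) v ⊎ High k v) L) refl refl
      (trans (ix kp₃ 29 refl 0) (trans (ix kp₂ 29 refl 0) (trans (ix kp₁ 29 refl 0) e29))) (≤-trans high≤q q≤y)
      (refl , L₃ , e₃ , fam-agree (agree-trans (agree-put {a = 65} refl) (agree-put {a = 73} refl)) F₃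
        , complete-mono L₃ (λ { (inj₁ l) → l ; (inj₂ (_ , () , _)) }) c₃)
      (λ k σ′ k< kp xk (i65 , L , e , F , c) →
        let b′ = basic-agree (keep-agree 7 {compile loop₂} refl kp) (basic-agree (agree-put {a = 65} refl) b₃)
        in r-seq (r-extendAll b′ F (high<q k<) (subst Pure (sym (vector-high k)) (pure⁻ _)) i65)
           λ σ″ kp″ (L″ , e″ , F″ , st) → r-put
             ( trans (cong₂ _+_ (trans (ix kp″ 65 refl 0) i65)
                 (trans (ix kp″ 13 refl 0) (trans (ix kp 13 refl 0) (trans (ix kp₃ 13 refl 0) (trans (ix kp₂ 13 refl 0) (trans (ix kp₁ 13 refl 0) e13))))))
                 (+-comm (k * 2 ^ t⁺) _)
             , L″ , ⊑-trans e e″ , fam-agree (agree-trans (agree-put {a = 65} refl) (agree-put {a = 73} refl)) F″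
             , complete-mono L″ (λ { (inj₁ l) → inj₁ (inj₁ l) ; (inj₂ (r , r< , eq)) → splitHigh r< eq }) (complete-step (vector (k * 2 ^ t⁺)) e″ c st)))
      (λ σ′ kp′ (_ , L , _ , F , c) → L , F , complete-mono L pure-reached c
        , trans (ix kp′ 13 refl 0) (trans (ix kp₃ 13 refl 0) (trans (ix kp₂ 13 refl 0) (trans (ix kp₁ 13 refl 0) e13)))
        , trans (ix kp′ 13 refl 1) (trans (ix kp₃ 13 refl 1) (trans (ix kp₂ 13 refl 1) (isKey cand))))))))
    where
    start = for 68 (! 4) 𝕐 (put 67 (! 68) (lit 1) ⨟ 66 ≔ ! 66 +ᵉ ! 66 +ᵉ lit 1)
    loop₁ = for 73 (! 13) 𝕐 (extendAll ⨟ 65 ≔ ! 65 +ᵉ lit 1)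
    loop₂ = for 73 (! 29) 𝕐 (extendAll ⨟ 65 ≔ ! 65 +ᵉ ! 13)

    low≤q : 2 ^ t⁺ ≤ q
    low≤q = ^-monoʳ-≤ 2 (m≤m+n t⁺ t⁻)

    high≤q : 2 ^ t⁻ ≤ q
    high≤q = ^-monoʳ-≤ 2 (m≤n+m t⁻ t⁺)

    high<q : ∀ {k} → k < 2 ^ t⁻ → k * 2 ^ t⁺ < q
    high<q {k} k< = begin-strict
      k * 2 ^ t⁺         <⟨ *-monoˡ-< (2 ^ t⁺) {{m^n≢0 2 t⁺}} k< ⟩
      2 ^ t⁻ * 2 ^ t⁺    ≡⟨ *-comm (2 ^ t⁻) _ ⟩
      2 ^ t⁺ * 2 ^ t⁻    ≡⟨ ^-distribˡ-+-* 2 t⁺ t⁻ ⟨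
      q                  ∎
      where open ≤-Reasoning

    splitLow : ∀ {k r v} → r < suc k → v ≡ vector r → Low k v ⊎ v ≡ vector k
    splitLow {r = r} r< eq with m≤n⇒m<n∨m≡n (≤-pred r<)
    ... | inj₁ l    = inj₁ (r , l , eq)
    ... | inj₂ refl = inj₂ eq

    splitHigh : ∀ {k r v} → r < suc k → v ≡ vector (r * 2 ^ t⁺) → (Low (2 ^ t⁺) v ⊎ High k v) ⊎ v ≡ vector (k * 2 ^ t⁺)
    splitHigh {r = r} r< eq with m≤n⇒m<n∨m≡n (≤-pred r<)
    ... | inj₁ l    = inj₁ (inj₂ (r , l , eq))
    ... | inj₂ refl = inj₂ eq

  record Ready (σ : State) (L : List (List V)) : Set where
    constructor ready
    field
      rbasic  : Basic σ
      rfam    : Fam σ L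
      rpair   : index σ 12 0 ≡ Q * Q
      rlow    : index σ 13 0 ≡ 2 ^ t⁺
      rfull   : index σ 13 1 ≡ key []
      rsquare : ∀ s → index σ 14 (bit s) ≡ dim s * dim s

  open Ready public

  ready-agree : ∀ {σ σ′ L} → Agree 15 σ σ′ → Ready σ L → Ready σ′ L
  ready-agree a (ready b f w l u s) = ready
    (basic-agree (agree-weaken 7 8 a) b)
    (fam-agree (agree-weaken 12 3 a) f)
    (trans (low a 12 refl 0) w) (trans (low a 13 refl 0) l) (trans (low a 13 refl 1) u)
    (λ s′ → trans (low a 14 refl _) (s s′))

  r-square : ∀ s {σ} → (∀ s → index σ 0 (bit s) ≡ dim s) → index σ 14 (bit s) ≡ 0 →
             Runs (square s) σ (λ σ′ → index σ′ 14 (bit s) ≡ dim s * dim s × (∀ s′ → s′ ≢ s → index σ′ 14 (bit s′) ≡ index σ 14 (bit s′)))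
  r-square s {σ} d z = r-for
    (λ k σ′ → index σ′ 14 (bit s) ≡ k * dim s × (∀ s′ → s′ ≢ s → index σ′ 14 (bit s′) ≡ index σ 14 (bit s′)))
    refl refl (d s) (dim≤τ s) (z , λ _ _ → refl)
    (λ k σ′ k< kp xk (i , o) → r-put
      ( trans (at-write≡ (bit s)) (trans (cong₂ _+_ i (trans (ix kp 0 refl _) (d s))) (+-comm (k * dim s) _))
      , λ s′ ne → at-write (bit s′) (bit s) (λ e → contradiction (bit-injective e) ne) (λ _ → o s′ ne)))
    (λ _ _ i → i)

  r-powers : ∀ {σ} → (∀ s → index σ 0 (bit s) ≡ dim s) → index σ 4 0 ≡ q →
             Runs powers σ (λ σ′ → index σ′ 13 0 ≡ 2 ^ t⁺ × index σ′ 29 0 ≡ 2 ^ t⁻ × index σ′ 12 0 ≡ Q * Q)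
  r-powers {σ} d eq =
    r-seq (r-put⨟ (r-seq (r-double refl (d false) (dim≤τ false)) λ σ₁ k₁ e₁ → r-put (trans e₁ (+-identityʳ _)))) λ σ₁ k₁ e₁ →
    r-seq (r-put⨟ (r-seq (r-double refl (trans (ix k₁ 0 refl 1) (d true)) (dim≤τ true)) λ σ₂ k₂ e₂ → r-put (trans e₂ (+-identityʳ _)))) λ σ₂ k₂ e₂ →
    r-put⨟ (r-seq (r-double refl (trans (ix k₂ 4 refl 0) (trans (ix k₁ 4 refl 0) eq)) q≤y) λ σ₃ k₃ e₃ →
    r-seq (r-double refl (trans (ix k₃ 4 refl 0) (trans (ix k₂ 4 refl 0) (trans (ix k₁ 4 refl 0) eq))) q≤y) λ σ₄ k₄ e₄ →
    r-put
      ( trans (ix k₄ 13 refl 0) (trans (ix k₃ 13 refl 0) (trans (ix k₂ 13 refl 0) e₁))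
      , trans (ix k₄ 29 refl 0) (trans (ix k₃ 29 refl 0) e₂)
      , trans e₄ (cong (_* Q) (trans e₃ (+-identityʳ Q)))))

  r-setup : ∀ {σ} → (∀ s → index σ 0 (bit s) ≡ dim s) → (∀ b j → (b <ᵇ 4) ≡ false → index σ b j ≡ 0) →
            Runs setup σ (λ σ′ → ∃ λ L → Ready σ′ L × Complete Pure L)
  r-setup {σ} d z =
    r-seq (r-put⨟ (r-seq (r-double refl (cong₂ _+_ (d false) (d true)) ≤-refl) λ σ₁ k₁ e₁ → r-put (trans e₁ (+-identityʳ q)))) λ σ₁ k₁ e₁ →
    r-seq (r-halfTable e₁ (trans (ix k₁ 5 refl 0) (z 5 0 refl)) (trans (ix k₁ 6 refl 0) (z 6 0 refl))) λ σ₂ k₂ tabs →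
    let d₂ = λ s → trans (ix k₂ 0 refl _) (trans (ix k₁ 0 refl _) (d s))
        q₂ = trans (ix k₂ 4 refl 0) e₁
    in
    r-seq (r-powers d₂ q₂) λ σ₃ k₃ (e13 , e29 , e12) →
    let d₃ = λ s → trans (ix k₃ 0 refl _) (d₂ s)
        z₃ = λ j → trans (ix k₃ 14 refl j) (trans (ix k₂ 14 refl j) (trans (ix k₁ 14 refl j) (z 14 j refl)))
    in
    r-seq (r-square false d₃ (z₃ 0)) λ σ₄ k₄ (s₄ , o₄) →
    r-seq (r-square true (λ s → trans (ix k₄ 0 refl _) (d₃ s)) (trans (o₄ true λ ()) (z₃ 1))) λ σ₅ k₅ (s₅ , o₅) →
    let old : ∀ b j → writes b (compile (square true)) ≡ false → index σ₅ b j ≡ index σ₃ b j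
        old b j w = trans (ix k₅ b w j) (ix k₄ b w j)
        b₅ : Basic σ₅
        b₅ = basic (λ s → trans (old 0 _ refl) (d₃ s)) (trans (old 4 0 refl) (trans (ix k₃ 4 refl 0) q₂))
                   (λ r< → trans (old 5 _ refl) (trans (ix k₃ 5 refl _) (proj₁ (tabs r<))))
                   (λ r< → trans (old 6 _ refl) (trans (ix k₃ 6 refl _) (proj₂ (tabs r<))))
        sq₅ : ∀ s → index σ₅ 14 (bit s) ≡ dim s * dim s
        sq₅ = λ { false → trans (o₅ false λ ()) s₄ ; true → s₅ }
    in r-conseq
      (r-enumerate b₅ (trans (old 13 0 refl) e13) (trans (old 29 0 refl) e29)
        (trans (old 7 0 refl) (trans (ix k₃ 7 refl 0) (trans (ix k₂ 7 refl 0) (trans (ix k₁ 7 refl 0) (z 7 0 refl)))))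
        (λ k → trans (old 11 k refl) (trans (ix k₃ 11 refl k) (trans (ix k₂ 11 refl k) (trans (ix k₁ 11 refl k) (z 11 k refl))))))
      λ σ₆ k₆ (L , F , c , low₆ , full) → L , record
        { rbasic  = basic-agree (keep-agree 7 {compile enumerate} refl k₆) b₅
        ; rfam    = F
        ; rpair   = trans (ix k₆ 12 refl 0) (trans (old 12 0 refl) e12)
        ; rlow    = low₆
        ; rfull   = full
        ; rsquare = λ s → trans (ix k₆ 14 refl _) (sq₅ s)
        } , c

  -- Relabeled contributions and the operation tables.

  Blocks : Set
  Blocks = ∀ s → Relabeling (dim s)

  mulV : Bool → Blocks → V → V
  mulV tr R (u , v) = mul tr (R false) u , mul tr (R true) v

  mulV-adjoint : ∀ tr R u v → mulV tr R u ∙ v ≡ u ∙ mulV (not tr) R v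
  mulV-adjoint tr R (u , u′) (v , v′) = cong₂ _xor_ (mul-adjoint tr (R false) u v) (mul-adjoint tr (R true) u′ v′)

  pure-mulV : ∀ tr R {v} → Pure v → Pure (mulV tr R v)
  pure-mulV tr R (pure⁺ u) = subst (λ z → Pure (mul tr (R false) u , z)) (sym (mul-zero tr (R true))) (pure⁺ _)
  pure-mulV tr R (pure⁻ v) = subst (λ z → Pure (z , mul tr (R true) v)) (sym (mul-zero tr (R false))) (pure⁻ _)

  ann-map : ∀ tr R U v → ann (map (mulV tr R) U) v ≡ ann U (mulV (not tr) R v)
  ann-map tr R [] v = refl
  ann-map tr R (u ∷ U) v = cong₂ (λ a b → a ∧ not b) (ann-map tr R U v) (mulV-adjoint tr R u v)

  -- A union of constraints, named after its annihilator, which is the intersection of two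
  -- pullbacks.
  meet : Bool → Blocks → Bool → Blocks → List V → List V → List V
  meet tr R tr′ R′ U U′ = map (mulV tr R) U ++ map (mulV tr′ R′) U′

  ann-meet : ∀ tr R tr′ R′ U U′ v → ann (meet tr R tr′ R′ U U′) v ≡ ann U (mulV (not tr) R v) ∧ ann U′ (mulV (not tr′) R′ v)
  ann-meet tr R tr′ R′ U U′ v = trans (ann-++ (map (mulV tr R) U) _ v) (cong₂ _∧_ (ann-map tr R U v) (ann-map tr′ R′ U′ v))

  -- The annihilator of a relabeled set depends only on that of the set. Hence all operations of the
  -- dynamic program are well defined on keys.
  meet-≈ : ∀ tr R tr′ R′ {U U₁ U′ U₁′} → U ≈ U₁ → U′ ≈ U₁′ → meet tr R tr′ R′ U U′ ≈ meet tr R tr′ R′ U₁ U₁′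
  meet-≈ tr R tr′ R′ {U} {U₁} {U′} {U₁′} h h′ = by λ v → trans (ann-meet tr R tr′ R′ U U′ v)
    (trans (cong₂ _∧_ (on h _) (on h′ _)) (sym (ann-meet tr R tr′ R′ U₁ U₁′ v)))

  pure-meet : ∀ tr R tr′ R′ {U U′} → All Pure U → All Pure U′ → All Pure (meet tr R tr′ R′ U U′)
  pure-meet tr R tr′ R′ pU pU′ = ++⁺ (map⁺ (All.map (pure-mulV tr R) pU)) (map⁺ (All.map (pure-mulV tr′ R′) pU′))

  -- The matrices g, f₁, f₂ of the current node are numbered 0, 1, 2.
  record Loaded (σ : State) (R : ℕ → Blocks) : Set where
    constructor loaded
    field stored : ∀ s {μ} → μ < 3 → Stored s σ (⟦ 15 [ lit (bit s) ]ᵉ +ᵉ offsetᵉ s μ ⟧ᵉ σ) (R μ s)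

  open Loaded public

  offset-agree : ∀ s μ {σ σ′} → Agree 15 σ σ′ → ⟦ offsetᵉ s μ ⟧ᵉ σ′ ≡ ⟦ offsetᵉ s μ ⟧ᵉ σ
  offset-agree s zero a = refl
  offset-agree s (suc μ) a = cong₂ _+_ (offset-agree s μ a) (low a 14 refl _)

  loaded-agree : ∀ {σ σ′ R} → Agree 16 σ σ′ → Loaded σ R → Loaded σ′ R
  loaded-agree {σ} {σ′} {R} a l = loaded λ s {μ} μ< {k} {j} k< j< →
    trans (token-agree s (agree-weaken 4 12 a) _)
      (trans (cong (λ z → index σ (2 + bit s) (z + (k * dim s + j)))
               (cong₂ _+_ (low a 15 refl _) (offset-agree s μ (agree-weaken 15 1 a))))
             (stored l s μ< k< j<))

  r-evalAt : ∀ μ tr R {σ r} → μ < 3 → Basic σ → Loaded σ R → index σ 47 0 ≡ r → r < q →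
             Runs (evalAt μ tr) σ (λ σ′ → index σ′ 51 0 ≡ number (mulV tr (R μ) (vector r)))
  r-evalAt μ tr R {σ} {r} μ< b l er r< = r-put⨟ (r-put⨟ (r-put⨟ (r-put⨟ (r-seq
    (r-evalStep false μ tr {R = R μ false} b₁ r< refl (stored l₁ false μ<) er refl refl refl)
    λ σ₂ k₂ (w , z , p , x) → r-conseq
    (r-evalStep true μ tr {R = R μ true} (basic-agree (keep-agree 7 {compile (evalStep false μ tr)} refl k₂) b₁)
      (≤-<-trans (halves≤ t⁺ r) r<) refl
      (stored (loaded-agree (keep-agree 16 {compile (evalStep false μ tr)} refl k₂) l₁) true μ<) x w z p)
    λ σ₃ k₃ (w′ , _) → trans w′ (cong₂ _+_ (trans (+-identityʳ _) (block (R μ false) r))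
      (cong₂ _*_ (+-identityʳ (2 ^ t⁺)) (block (R μ true) (halves t⁺ r))))))))
    where
    σ₁ = σ ⟨ 50 ≔ index σ 47 0 ⟩ ⟨ 51 ≔ 0 ⟩ ⟨ 52 # 0 ≔ 0 ⟩ ⟨ 52 # 1 ≔ 1 ⟩
    ag : ∀ K → (K ≤ᵇ 50) ≡ true → (K ≤ᵇ 51) ≡ true → (K ≤ᵇ 52) ≡ true → Agree K σ σ₁
    ag K p p′ p″ = agree-trans (agree-put {a = 50} p) (agree-trans (agree-put {a = 51} p′) (agree-trans (agree-put {a = 52} p″) (agree-put {a = 52} p″)))
    b₁ : Basic σ₁
    b₁ = basic-agree (ag 7 refl refl refl) b
    l₁ : Loaded σ₁ R
    l₁ = loaded-agree (ag 16 refl refl refl) l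
    block : ∀ {t} (M : Relabeling t) x → binary t (λ l → xsum t (λ k → bitAt x k ∧ entryᵀ tr M k l)) ≡ code (mul tr M (vec t x))
    block {t} M x = binary-cong t λ {l} l< → sym (trans (at-mul tr M (vec t x) l<)
      (xsum-cong t (λ {k} k< → cong (_∧ entryᵀ tr M k l) (at-tab t _ k<))))

  r-keyLoop : ∀ μ tr μ′ tr′ R {σ U U′} → μ < 3 → μ′ < 3 → Basic σ → Loaded σ R →
              Row σ U → Row σ U′ → index σ 41 0 ≡ key U * Q → index σ 45 0 ≡ key U′ * Q → index σ 46 0 ≡ 0 →
              Runs (keyLoop μ tr μ′ tr′) σ (λ σ′ → index σ′ 46 0 ≡
                horner q (λ r → ann U (mulV tr (R μ) (vector r)) ∧ ann U′ (mulV tr′ (R μ′) (vector r))))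
  r-keyLoop μ tr μ′ tr′ R {σ} {U} {U′} μ< μ′< b l ρ ρ′ e41 e45 e46 = r-for
    (λ k σ′ → index σ′ 46 0 ≡ horner k F)
    refl refl (space b) q≤y e46
    (λ k σ′ k< kp xk ik →
      let b₁ = basic-agree (keep-agree 7 {compile (keyLoop μ tr μ′ tr′)} refl kp) b
          l₁ = loaded-agree (keep-agree 16 {compile (keyLoop μ tr μ′ tr′)} refl kp) l
      in r-seq (r-evalAt μ tr R μ< b₁ l₁ xk k<) λ σ₂ k₂ e₂ → r-put⨟ (r-seq
         (r-evalAt μ′ tr′ R μ′< (basic-agree (agree-trans (keep-agree 7 {compile (evalAt μ tr)} refl k₂) (agree-put {a = 48} refl)) b₁)
            (loaded-agree (agree-trans (keep-agree 16 {compile (evalAt μ tr)} refl k₂) (agree-put {a = 48} refl)) l₁)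
            (trans (ix k₂ 47 refl 0) xk) k<)
         λ σ₃ k₃ e₃ → r-put (cong₂ _+_
           (cong₂ _+_ (trans (ix k₃ 46 refl 0) (trans (ix k₂ 46 refl 0) ik)) (trans (ix k₃ 46 refl 0) (trans (ix k₂ 46 refl 0) ik)))
           (bit-andᵉ (ann U (mulV tr (R μ) (vector k))) (ann U′ (mulV tr′ (R μ′) (vector k)))
             (trans (ix k₃ 48 refl 0) (trans (cong (index σ₂ 10) (cong₂ _+_ (trans (ix k₂ 41 refl 0) (trans (ix kp 41 refl 0) e41)) e₂))
               (trans (ix k₂ 10 refl _) (trans (ix kp 10 refl _) (member ρ _)))))
             (trans (cong (index σ₃ 10) (cong₂ _+_ (trans (ix k₃ 45 refl 0) (trans (ix k₂ 45 refl 0) (trans (ix kp 45 refl 0) e45))) e₃))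
               (trans (ix k₃ 10 refl _) (trans (ix k₂ 10 refl _) (trans (ix kp 10 refl _) (member ρ′ _)))))))))
    (λ _ _ i → i)
    where
    F : ℕ → Bool
    F r = ann U (mulV tr (R μ) (vector r)) ∧ ann U′ (mulV tr′ (R μ′) (vector r))

    member : ∀ {U} → Row σ U → ∀ v → index σ 10 (key U * Q + number v) ≡ bit (ann U v)
    member {U} ρ v = trans (bits ρ (number<q v)) (cong (λ z → bit (ann U z)) (vector-number v))

  K : List (List V) → ℕ → ℕ
  K L i = key (nth L i)

  size≤ : ∀ {σ L} → Ready σ L → length L ≤ y
  size≤ {L = L} r = count≤ L (distinct (rfam r)) (allPure (rfam r))

  HasTable : State → ℕ → List (List V) → (List V → List V → List V) → Set
  HasTable σ m L f = ∀ {i j} → i < length L → j < length L → index σ (80 + m) (K L i * Q + K L j) ≡ key (f (nth L i) (nth L j))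

  r-table : ∀ m μ tr μ′ tr′ R {σ L} → μ < 3 → μ′ < 3 → Ready σ L → Loaded σ R →
            Runs (table m μ tr μ′ tr′) σ (λ σ′ → HasTable σ′ m L (meet (not tr) (R μ) (not tr′) (R μ′)))
  r-table m μ tr μ′ tr′ R {σ} {L} μ< μ′< rd l = r-for
    (λ i σ′ → ∀ {i′ j} → i′ < i → j < N → index σ′ (80 + m) (adr i′ j) ≡ joint i′ j)
    refl refl (count (rfam rd)) (size≤ rd) (λ ())
    (λ i σ′ i< kp xi old →
      let rd₁ : Ready (σ′ ⟨ 41 ≔ index σ′ 9 (index σ′ 8 (index σ′ 40 0)) ⟩) L
          rd₁ = ready-agree (agree-trans (keep-agree 15 {compile (table m μ tr μ′ tr′)} refl kp) (agree-put {a = 41} refl)) rd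
          l₁  = loaded-agree (agree-trans (keep-agree 16 {compile (table m μ tr μ′ tr′)} refl kp) (agree-put {a = 41} refl)) l
          e41 : index σ′ 9 (index σ′ 8 (index σ′ 40 0)) ≡ K L i * Q
          e41 = trans (cong (index σ′ 9) (trans (cong (index σ′ 8) xi) (keyAt (rfam rd₁) i<))) (shift (rows (rfam rd₁) i<))
      in r-put⨟ (r-for
        (λ j σ″ → (∀ {i′ j} → i′ < i → j < N → index σ″ (80 + m) (adr i′ j) ≡ joint i′ j) ×
                  (∀ {j′} → j′ < j → index σ″ (80 + m) (adr i j′) ≡ joint i j′))
        refl refl (count (rfam rd₁)) (size≤ rd) (old , λ ())
        (λ j σ″ j< kp′ xj (older , new) →
          let rd₂ : Ready (σ″ ⟨ 44 ≔ index σ″ 8 (index σ″ 43 0) ⟩ ⟨ 45 ≔ index σ″ 9 (index σ″ 8 (index σ″ 43 0)) ⟩ ⟨ 46 ≔ 0 ⟩) L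
              rd₂ = ready-agree (agree-trans (keep-agree 15 {compile (tableRow m μ tr μ′ tr′)} refl kp′)
                      (agree-trans (agree-put {a = 44} refl) (agree-trans (agree-put {a = 45} refl) (agree-put {a = 46} refl)))) rd₁
              l₂  = loaded-agree (agree-trans (keep-agree 16 {compile (tableRow m μ tr μ′ tr′)} refl kp′)
                      (agree-trans (agree-put {a = 44} refl) (agree-trans (agree-put {a = 45} refl) (agree-put {a = 46} refl)))) l₁
              e44 : index σ″ 8 (index σ″ 43 0) ≡ K L j
              e44 = trans (cong (index σ″ 8) xj) (keyAt (rfam rd₂) j<)
          in r-put⨟ (r-put⨟ (r-put⨟ (r-seq
            (r-keyLoop μ tr μ′ tr′ R {U = nth L i} {U′ = nth L j} μ< μ′< (rbasic rd₂) l₂ (rows (rfam rd₂) i<) (rows (rfam rd₂) j<)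
              (trans (ix kp′ 41 refl 0) e41) (trans (cong (index σ″ 9) e44) (shift (rows (rfam rd₂) j<))) refl)
            λ σ₃ k₃ e46 →
              let dst : index σ₃ 41 0 + index σ₃ 44 0 ≡ adr i j
                  dst = cong₂ _+_ (trans (ix k₃ 41 refl 0) (trans (ix kp′ 41 refl 0) e41)) (trans (ix k₃ 44 refl 0) e44)
                  keyed : index σ₃ 46 0 ≡ joint i j
                  keyed = trans e46 (horner-cong q (λ {r} _ → sym (value i j (vector r))))
                  stable : ∀ {i′ j′} → i′ < N → j′ < N → index σ″ (80 + m) (adr i′ j′) ≡ joint i′ j′ →
                           index (σ₃ ⟨ 80 + m # index σ₃ 41 0 + index σ₃ 44 0 ≔ index σ₃ 46 0 ⟩) (80 + m) (adr i′ j′) ≡ joint i′ j′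
                  stable {i′} {j′} i′< j′< e = trans (write-same (index σ₃) (80 + m) _ _ _) (at-write (adr i′ j′) _
                    (λ eq → trans keyed (consistent i j i′ j′ (sym (trans eq dst))))
                    (λ _ → trans (ix k₃ (80 + m) refl _) e))
              in r-put
                ( (λ {i′} {j′} i′< j′< → stable (<-trans i′< i<) j′< (older i′< j′<))
                , λ {j′} j′< → latest j′< (λ j′<j → stable i< (<-trans j′<j j<) (new j′<j))
                    (λ e → subst (λ z → index (σ₃ ⟨ 80 + m # index σ₃ 41 0 + index σ₃ 44 0 ≔ index σ₃ 46 0 ⟩) (80 + m) (adr i z) ≡ joint i z) (sym e)
                      (trans (write-same (index σ₃) (80 + m) _ _ _) (at-write (adr i j) _ (λ _ → keyed) (λ ne → contradiction (sym dst) ne)))))))))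
        (λ σ″ _ (older , new) {i′} {j} i′< j< → latest i′< (λ i′<i → older i′<i j<)
          (λ e → subst (λ z → index σ″ (80 + m) (adr z j) ≡ joint z j) (sym e) (new j<)))))
    (λ _ _ i → λ i< j< → i i< j<)
    where
    N = length L
    adr : ℕ → ℕ → ℕ
    adr i j = K L i * Q + K L j

    f : List V → List V → List V
    f = meet (not tr) (R μ) (not tr′) (R μ′)

    joint : ℕ → ℕ → ℕ
    joint i j = key (f (nth L i) (nth L j))

    value : ∀ i j v → ann (f (nth L i) (nth L j)) v ≡ ann (nth L i) (mulV tr (R μ) v) ∧ ann (nth L j) (mulV tr′ (R μ′) v)
    value i j v = trans (ann-meet (not tr) (R μ) (not tr′) (R μ′) (nth L i) (nth L j) v)
      (cong₂ (λ a b → ann (nth L i) (mulV a (R μ) v) ∧ ann (nth L j) (mulV b (R μ′) v)) (not-involutive tr) (not-involutive tr′))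

    -- An address determines both keys and thereby the value, so no write can spoil an entry that is
    -- already there.
    consistent : ∀ i j i′ j′ → adr i j ≡ adr i′ j′ → joint i j ≡ joint i′ j′
    consistent i j i′ j′ e with *+-injective {Q} {K L i} {K L i′} (key<Q (nth L j)) (key<Q (nth L j′)) e
    ... | e₁ , e₂ = ≈⇒key (meet-≈ (not tr) (R μ) (not tr′) (R μ′) (key⇒≈ {nth L i} {nth L i′} e₁) (key⇒≈ {nth L j} {nth L j′} e₂))

    latest : ∀ {A : Set} {k n} → k < suc n → (k < n → A) → (k ≡ n → A) → A
    latest k< f g with m≤n⇒m<n∨m≡n (≤-pred k<)
    ... | inj₁ l = f l
    ... | inj₂ e = g e

  -- Table c of the dynamic program occupies the cells c , a , b of counter
  -- memory 1 with a, b < Q.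

  cell² : ℕ → ℕ → ℕ → ℕ
  cell² c a b = c * (Q * Q) + a * Q + b

  pair< : ∀ {a b} → a < Q → b < Q → a * Q + b < Q * Q
  pair< {a} {b} a< b< = begin-strict
    a * Q + b     <⟨ +-monoʳ-< (a * Q) b< ⟩
    a * Q + Q     ≡⟨ +-comm (a * Q) Q ⟩
    suc a * Q     ≤⟨ *-monoˡ-≤ Q a< ⟩
    Q * Q         ∎
    where open ≤-Reasoning

  cell²-injective : ∀ {c c′ a a′ b b′} → a < Q → b < Q → a′ < Q → b′ < Q → cell² c a b ≡ cell² c′ a′ b′ → c ≡ c′ × a ≡ a′ × b ≡ b′
  cell²-injective {c} {c′} {a} {a′} {b} {b′} a< b< a′< b′< e
    with e₁ , e₂ ← *+-injective {Q * Q} {c} {c′} (pair< a< b<) (pair< a′< b′<) (trans (sym (+-assoc (c * (Q * Q)) _ b)) (trans e (+-assoc (c′ * (Q * Q)) _ b′)))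
    with e₃ , e₄ ← *+-injective {Q} {a} {a′} b< b′< e₂ = e₁ , e₃ , e₄

  -- Increments are recorded instead of values: the effects of consecutive writes then simply add
  -- up, and tables other than `c` remain readable meanwhile.
  record Acc (c : ℕ) (F : ℕ → ℕ → ℕ) (σ σ′ : State) : Set where
    constructor acc
    field
      others : ∀ {c′ a b} → c′ ≢ c → a < Q → b < Q → counter σ′ 1 (cell² c′ a b) ≡ counter σ 1 (cell² c′ a b)
      gained : ∀ {a b} → a < Q → b < Q → counter σ′ 1 (cell² c a b) ≡ counter σ 1 (cell² c a b) + F a b

  open Acc public

  acc-0 : ∀ {c σ M} → Acc c (λ _ _ → 0) σ ⟪ M , counter σ ⟫
  acc-0 = acc (λ _ _ _ → refl) (λ _ _ → sym (+-identityʳ _))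

  acc-index : ∀ {c F M N σ D} → Acc c F σ ⟪ M , D ⟫ → Acc c F σ ⟪ N , D ⟫
  acc-index (acc o h) = acc o h

  acc-trans : ∀ {c F G σ σ′ σ″} → Acc c F σ σ′ → Acc c G σ′ σ″ → Acc c (λ a b → F a b + G a b) σ σ″
  acc-trans {c} {F} {G} {σ} (acc o h) (acc o′ h′) = acc (λ ne a< b< → trans (o′ ne a< b<) (o ne a< b<))
    (λ {a} {b} a< b< → trans (h′ a< b<) (trans (cong (_+ G a b) (h a< b<)) (+-assoc (counter σ 1 (cell² c a b)) _ _)))

  acc-cong : ∀ {c F G σ σ′} → (∀ a b → F a b ≡ G a b) → Acc c F σ σ′ → Acc c G σ σ′
  acc-cong e (acc o h) = acc o (λ {a} {b} a< b< → trans (h a< b<) (cong (_ +_) (e a b)))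

  acc-add : ∀ {c a b i v w σ} → a < Q → b < Q → i ≡ cell² c a b → v ≡ counter σ 1 (cell² c a b) + w →
            Acc c (λ a′ b′ → ind a′ a * ind b′ b * w) σ (σ ⟨ 1 # i ≔ᶜ v ⟩)
  acc-add {c} {a} {b} {w = w} {σ} a< b< refl refl = acc
    (λ {c′} {a′} {b′} ne a′< b′< → at-write (cell² c′ a′ b′) (cell² c a b)
      (λ e → contradiction (proj₁ (cell²-injective {c′} {c} a′< b′< a< b< e)) ne) (λ _ → refl))
    (λ {a′} {b′} a′< b′< → at-write (cell² c a′ b′) (cell² c a b)
      (λ e → let (_ , ea , eb) = cell²-injective {c} {c} a′< b′< a< b< e in
        cong₂ _+_ (cong (counter σ 1) (sym e)) (sym (one ea eb)))
      (λ ne → sym (trans (cong (counter σ 1 (cell² c a′ b′) +_) (none {a′} {b′} ne)) (+-identityʳ _))))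
    where
    one : ∀ {a′ b′} → a′ ≡ a → b′ ≡ b → ind a′ a * ind b′ b * w ≡ w
    one refl refl rewrite ind-same a | ind-same b = trans (+-identityʳ _) refl
    none : ∀ {a′ b′} → cell² c a′ b′ ≢ cell² c a b → ind a′ a * ind b′ b * w ≡ 0
    none {a′} {b′} ne with a′ ≟ a
    ... | no na rewrite ind-differ na = refl
    ... | yes refl with b′ ≟ b
    ...   | no nb rewrite ind-differ nb | *-zeroʳ (ind a a) = refl
    ...   | yes refl = contradiction refl ne

  -- Both source tables differ from the destination, so the counters that are multiplied can be
  -- taken in the initial state although the loops keep writing.
  r-combine : ∀ {σ L c x y fZ fX fY} → Ready σ L → HasTable σ 0 L fZ → HasTable σ 1 L fX → HasTable σ 2 L fY →
              (∀ {i j} → i < length L → j < length L → HasKey L (key (fZ (nth L i) (nth L j)))) →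
              index σ 18 0 ≡ c * (Q * Q) → index σ 20 0 ≡ x * (Q * Q) → index σ 21 0 ≡ y * (Q * Q) → x ≢ c → y ≢ c →
              Runs combine σ (Acc c (λ a b → sumN (length L) λ i → sumN (length L) λ j → sumN (length L) λ k →
                ind a (key (fZ (nth L i) (nth L j))) * ind b (K L k) *
                (counter σ 1 (cell² x (K L i) (key (fX (nth L k) (nth L j)))) * counter σ 1 (cell² y (K L j) (key (fY (nth L k) (nth L i)))))) σ)
  r-combine {σ} {L} {c} {x} {y} {fZ} {fX} {fY} rd T₀ T₁ T₂ closed e18 e20 e21 x≢ y≢ = r-for
    (λ i σ′ → Acc c (λ a b → S₃ a b i) σ σ′)
    refl refl (count (rfam rd)) (size≤ rd) acc-0
    (λ i σ₁ i< k₁ x₁ A₁ →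
      let rd₁ : Ready (σ₁ ⟨ 41 ≔ index σ₁ 8 (index σ₁ 40 0) ⟩ ⟨ 42 ≔ index σ₁ 9 (index σ₁ 8 (index σ₁ 40 0)) ⟩) L
          rd₁ = ready-agree (agree-trans (keep-agree 15 {compile combine} refl k₁) (agree-trans (agree-put {a = 41} refl) (agree-put {a = 42} refl))) rd
          e41 : index σ₁ 8 (index σ₁ 40 0) ≡ K L i
          e41 = trans (cong (index σ₁ 8) x₁) (keyAt (rfam rd₁) i<)
          e42 = trans (cong (index σ₁ 9) e41) (shift (rows (rfam rd₁) i<))
      in r-put⨟ (r-put⨟ (r-for
        (λ j σ′ → Acc c (λ a b → S₃ a b i + S₂ a b i j) σ σ′)
        refl refl (count (rfam rd₁)) (size≤ rd₁) (acc-cong (λ a b → sym (+-identityʳ _)) (acc-index A₁))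
        (λ j σ₂ j< k₂ x₂ A₂ →
          let rd₂ : Ready (σ₂ ⟨ 44 ≔ index σ₂ 8 (index σ₂ 43 0) ⟩ ⟨ 45 ≔ index σ₂ 9 (index σ₂ 8 (index σ₂ 43 0)) ⟩
                              ⟨ 46 ≔ index σ₂ 9 (index σ₂ 80 (index σ₂ 42 0 + index σ₂ 8 (index σ₂ 43 0))) ⟩) L
              rd₂ = ready-agree (agree-trans (keep-agree 15 {compile combineRows} refl k₂)
                      (agree-trans (agree-put {a = 44} refl) (agree-trans (agree-put {a = 45} refl) (agree-put {a = 46} refl)))) rd₁
              e44 : index σ₂ 8 (index σ₂ 43 0) ≡ K L j
              e44 = trans (cong (index σ₂ 8) x₂) (keyAt (rfam rd₂) j<)
              e45 = trans (cong (index σ₂ 9) e44) (shift (rows (rfam rd₂) j<))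
              e80 : index σ₂ 80 (index σ₂ 42 0 + index σ₂ 8 (index σ₂ 43 0)) ≡ Z i j
              e80 = trans (cong (index σ₂ 80) (cong₂ _+_ (trans (ix k₂ 42 refl 0) e42) e44))
                      (trans (ix k₂ 80 refl _) (trans (ix k₁ 80 refl _) (T₀ i< j<)))
              -- The join has a listed key, so memory 9 knows its multiple by `Q`.
              (h , h< , eh) = closed i< j<
              e46 : index σ₂ 9 (index σ₂ 80 (index σ₂ 42 0 + index σ₂ 8 (index σ₂ 43 0))) ≡ Z i j * Q
              e46 = trans (cong (index σ₂ 9) (trans e80 (sym eh))) (trans (shift (rows (rfam rd₂) h<)) (cong (_* Q) eh))
          in r-put⨟ (r-put⨟ (r-put⨟ (r-for
            (λ k σ′ → Acc c (λ a b → S₃ a b i + S₂ a b i j + S₁ a b i j k) σ σ′)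
            refl refl (count (rfam rd₂)) (size≤ rd₂) (acc-cong (λ a b → sym (+-identityʳ _)) (acc-index A₂))
            (λ k σ₃ k< k₃ x₃ A₃ →
              let rd₃ : Ready (σ₃ ⟨ 48 ≔ index σ₃ 8 (index σ₃ 47 0) ⟩ ⟨ 49 ≔ index σ₃ 9 (index σ₃ 8 (index σ₃ 47 0)) ⟩) L
                  rd₃ = ready-agree (agree-trans (keep-agree 15 {compile combineRow} refl k₃) (agree-trans (agree-put {a = 48} refl) (agree-put {a = 49} refl))) rd₂
                  e48 : index σ₃ 8 (index σ₃ 47 0) ≡ K L k
                  e48 = trans (cong (index σ₃ 8) x₃) (keyAt (rfam rd₃) k<)
                  e49 = trans (cong (index σ₃ 9) e48) (shift (rows (rfam rd₃) k<))
                  through : ∀ b j → writes b (compile combineRow) ≡ false → (b ≡ᵇ 44) ≡ false → (b ≡ᵇ 45) ≡ false → (b ≡ᵇ 46) ≡ false →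
                            index σ₃ b j ≡ index σ₂ b j
                  through b j w n₁ n₂ n₃ = trans (ix k₃ b w j)
                    (trans (write-other (index (σ₂ ⟨ 44 ≔ index σ₂ 8 (index σ₂ 43 0) ⟩ ⟨ 45 ≔ index σ₂ 9 (index σ₂ 8 (index σ₂ 43 0)) ⟩)) 46 _ _ b j n₃)
                    (trans (write-other (index (σ₂ ⟨ 44 ≔ index σ₂ 8 (index σ₂ 43 0) ⟩)) 45 _ _ b j n₂) (write-other (index σ₂) 44 _ _ b j n₁)))
                  f18 = trans (through 18 0 refl refl refl refl) (trans (ix k₂ 18 refl 0) (trans (ix k₁ 18 refl 0) e18))
                  f20 = trans (through 20 0 refl refl refl refl) (trans (ix k₂ 20 refl 0) (trans (ix k₁ 20 refl 0) e20))
                  f21 = trans (through 21 0 refl refl refl refl) (trans (ix k₂ 21 refl 0) (trans (ix k₁ 21 refl 0) e21))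
                  f41 = trans (through 41 0 refl refl refl refl) (trans (ix k₂ 41 refl 0) e41)
                  f42 = trans (through 42 0 refl refl refl refl) (trans (ix k₂ 42 refl 0) e42)
                  f44 = trans (ix k₃ 44 refl 0) e44
                  f45 = trans (ix k₃ 45 refl 0) e45
                  f46 = trans (ix k₃ 46 refl 0) e46
                  t81 : index σ₃ 81 (index σ₃ 9 (index σ₃ 8 (index σ₃ 47 0)) + index σ₃ 44 0) ≡ X k j
                  t81 = trans (cong (index σ₃ 81) (cong₂ _+_ e49 f44))
                          (trans (through 81 _ refl refl refl refl) (trans (ix k₂ 81 refl _) (trans (ix k₁ 81 refl _) (T₁ k< j<))))
                  t82 : index σ₃ 82 (index σ₃ 9 (index σ₃ 8 (index σ₃ 47 0)) + index σ₃ 41 0) ≡ Y k i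
                  t82 = trans (cong (index σ₃ 82) (cong₂ _+_ e49 f41))
                          (trans (through 82 _ refl refl refl refl) (trans (ix k₂ 82 refl _) (trans (ix k₁ 82 refl _) (T₂ k< i<))))
                  dst : index σ₃ 18 0 + index σ₃ 46 0 + index σ₃ 8 (index σ₃ 47 0) ≡ cell² c (Z i j) (K L k)
                  dst = cong₂ _+_ (cong₂ _+_ f18 f46) e48
                  srcX : counter σ₃ 1 (index σ₃ 20 0 + index σ₃ 42 0 + index σ₃ 81 (index σ₃ 9 (index σ₃ 8 (index σ₃ 47 0)) + index σ₃ 44 0))
                         ≡ counter σ 1 (cell² x (K L i) (X k j))
                  srcX = trans (cong (counter σ₃ 1) (cong₂ _+_ (cong₂ _+_ f20 f42) t81)) (others A₃ x≢ (key<Q (nth L i)) (key<Q (fX (nth L k) (nth L j))))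
                  srcY : counter σ₃ 1 (index σ₃ 21 0 + index σ₃ 45 0 + index σ₃ 82 (index σ₃ 9 (index σ₃ 8 (index σ₃ 47 0)) + index σ₃ 41 0))
                         ≡ counter σ 1 (cell² y (K L j) (Y k i))
                  srcY = trans (cong (counter σ₃ 1) (cong₂ _+_ (cong₂ _+_ f21 f45) t82)) (others A₃ y≢ (key<Q (nth L j)) (key<Q (fY (nth L k) (nth L i))))
              in r-put⨟ (r-put⨟ (r-putᶜ (acc-cong (λ a b → +-assoc (S₃ a b i + S₂ a b i j) _ _)
                   (acc-trans A₃ (acc-index (acc-add {c} {Z i j} {K L k} (key<Q (fZ (nth L i) (nth L j))) (key<Q (nth L k)) dst
                     (cong₂ _+_ (cong (counter σ₃ 1) dst) (cong₂ _*_ srcX srcY)))))))))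
            (λ σ′ _ A → acc-cong (λ a b → +-assoc (S₃ a b i) _ _) (acc-index A))))))
        (λ σ′ _ A → acc-index A))))
    (λ _ _ A → A)
    where
    N = length L
    Z X Y : ℕ → ℕ → ℕ
    Z i j = key (fZ (nth L i) (nth L j))
    X k j = key (fX (nth L k) (nth L j))
    Y k i = key (fY (nth L k) (nth L i))

    S₁ : ℕ → ℕ → ℕ → ℕ → ℕ → ℕ
    S₁ a b i j n = sumN n λ k → ind a (Z i j) * ind b (K L k) * (counter σ 1 (cell² x (K L i) (X k j)) * counter σ 1 (cell² y (K L j) (Y k i)))
    S₂ : ℕ → ℕ → ℕ → ℕ → ℕ
    S₂ a b i n = sumN n λ j → S₁ a b i j N
    S₃ : ℕ → ℕ → ℕ → ℕ
    S₃ a b n = sumN n λ i → S₂ a b i N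

  -- Tables of leaves and the stack.

  u⁺ u⁻ u± : V
  u⁺ = vector 1
  u⁻ = vector (2 ^ t⁺)
  u± = vector (1 + 2 ^ t⁺)

  1<2^t⁺ : 1 < 2 ^ t⁺
  1<2^t⁺ = ^-monoʳ-≤ 2 0<t⁺

  u±<q : 1 + 2 ^ t⁺ < q
  u±<q = begin-strict
    1 + 2 ^ t⁺         <⟨ +-monoˡ-< (2 ^ t⁺) 1<2^t⁺ ⟩
    2 ^ t⁺ + 2 ^ t⁺    ≡⟨ cong (2 ^ t⁺ +_) (+-identityʳ _) ⟨
    2 * 2 ^ t⁺         ≡⟨ *-comm 2 (2 ^ t⁺) ⟩
    2 ^ t⁺ * 2         ≤⟨ *-monoʳ-≤ (2 ^ t⁺) (^-monoʳ-≤ 2 0<t⁻) ⟩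
    2 ^ t⁺ * 2 ^ t⁻    ≡⟨ ^-distribˡ-+-* 2 t⁺ t⁻ ⟨
    q                  ∎
    where open ≤-Reasoning

  u⁻<q : 2 ^ t⁺ < q
  u⁻<q = <-trans ≤-refl u±<q

  u⁺<q : 1 < q
  u⁺<q = <-trans 1<2^t⁺ u⁻<q

  pure-u⁺ : Pure u⁺
  pure-u⁺ = subst Pure (sym (vector-low 1<2^t⁺)) (pure⁺ _)

  pure-u⁻ : Pure u⁻
  pure-u⁻ = subst Pure (trans (sym (vector-high 1)) (cong vector (+-identityʳ _))) (pure⁻ (vec t⁻ 1))

  Unit : List (List V) → List V → ℕ → ℕ → ℕ
  Unit L U a b = sumN (length L) λ k → ind a (key U) * ind b (K L k) * 1

  acc-indexˡ : ∀ {c F M N σ D} → Acc c F ⟪ M , D ⟫ σ → Acc c F ⟪ N , D ⟫ σ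
  acc-indexˡ (acc o h) = acc o h

  acc-keep : ∀ {c P σ σ′} → Keep P σ σ′ → writesᶜ 1 P ≡ false → Acc c (λ _ _ → 0) σ σ′
  acc-keep k w = acc (λ _ _ _ → ct k 1 w _) (λ _ _ → trans (ct k 1 w _) (sym (+-identityʳ _)))

  r-addRow : ∀ {σ L U c} → Ready σ L → index σ 18 0 ≡ c * (Q * Q) → index σ 46 0 ≡ key U * Q →
             Runs addRow σ (Acc c (Unit L U) σ)
  r-addRow {σ} {L} {U} {c} rd e18 e46 = r-for
    (λ k σ′ → Acc c (λ a b → sumN k λ k → ind a (key U) * ind b (K L k) * 1) σ σ′)
    refl refl (count (rfam rd)) (size≤ rd) acc-0
    (λ k σ₁ k< k₁ x₁ A →
      let rd₁ = ready-agree (keep-agree 15 {compile addRow} refl k₁) rd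
          e48 : index σ₁ 8 (index σ₁ 47 0) ≡ K L k
          e48 = trans (cong (index σ₁ 8) x₁) (keyAt (rfam rd₁) k<)
          dst : index σ₁ 18 0 + index σ₁ 46 0 + index σ₁ 8 (index σ₁ 47 0) ≡ cell² c (key U) (K L k)
          dst = cong₂ _+_ (cong₂ _+_ (trans (ix k₁ 18 refl 0) e18) (trans (ix k₁ 46 refl 0) e46)) e48
      in r-put⨟ (r-putᶜ (acc-trans A (acc-index (acc-add {c} {key U} {K L k} (key<Q U) (key<Q (nth L k)) dst
           (cong (λ z → counter σ₁ 1 z + 1) dst))))))
    (λ _ _ A → A)

  row-of : ∀ {σ L k} → Fam σ L → HasKey L k → index σ 9 k ≡ k * Q
  row-of {σ} F (i , i< , e) = subst (λ k → index σ 9 k ≡ k * Q) e (shift (rows F i<))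

  bits-of : ∀ {σ L} U → Fam σ L → HasKey L (key U) → ∀ {r} → r < q → index σ 10 (key U * Q + r) ≡ bit (char U r)
  bits-of {σ} {L} U F (i , i< , e) {r} r< = trans (cong (λ k → index σ 10 (k * Q + r)) (sym e))
    (trans (bits (rows F i<) r<) (cong bit (on (key⇒≈ {nth L i} {U} e) (vector r))))

  r-addKey : ∀ e {σ L c u} → (∀ {σ} → Ready σ L → ⟦ e ⟧ᵉ σ ≡ u) → Ready σ L → Complete Pure L → u < q → Pure (vector u) →
             index σ 18 0 ≡ c * (Q * Q) →
             Runs (addKey e) σ (Acc c (Unit L (vector u ∷ [])) σ)
  r-addKey e {σ} {L} {c} {u} val rd C u< pu e18 =
    let σ₁ = σ ⟨ 65 ≔ ⟦ e ⟧ᵉ σ ⟩ ⟨ 64 ≔ index σ 9 (index σ 13 1) ⟩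
        rd₁ : Ready σ₁ L
        rd₁ = ready-agree (agree-trans (agree-put {a = 65} refl) (agree-put {a = 64} refl)) rd
    in r-put⨟ (r-put⨟ (r-seq
      (r-candidate {U = []} (rbasic rd₁) u< (val rd) (trans (cong (index σ 9) (rfull rd)) (row-of (rfam rd) (C []))) (bits-of [] (rfam rd₁) (C [])))
      λ σ₂ k₂ cand →
        let rd₂ = ready-agree (keep-agree 15 {compile candidate} refl k₂) rd₁
            h = C (pu ∷ [])
        in r-put⨟ (r-conseq
          (r-addRow {U = vector u ∷ []} (ready-agree (agree-put {a = 46} refl) rd₂) (trans (ix k₂ 18 refl 0) e18)
            (trans (cong (index σ₂ 9) (isKey cand)) (row-of (rfam rd₂) h)))
          λ σ₃ k₃ A → acc-trans (acc-indexˡ (acc-keep k₂ refl)) (acc-indexˡ A))))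

  -- A leaf table is filled for every enumerated outside set `k`. A clause is counted iff the
  -- outside reaches it, that is, iff `u±` is not annihilated.
  Variable Clause : List (List V) → ℕ → ℕ → ℕ
  Variable L a b = Unit L (u⁺ ∷ []) a b + Unit L (u⁻ ∷ []) a b
  Clause L a b = sumN (length L) λ k → ind a (key []) * ind b (K L k) * bit (not (ann (nth L k) u±))

  r-variableLeaf : ∀ {σ L c} → Ready σ L → Complete Pure L → index σ 18 0 ≡ c * (Q * Q) →
                   Runs variableLeaf σ (Acc c (Variable L) σ)
  r-variableLeaf {L = L} rd C e18 = r-seq (r-addKey (lit 1) (λ _ → refl) rd C u⁺<q pure-u⁺ e18)
    λ σ₁ k₁ A₁ → r-conseq (r-addKey (! 13) rlow (ready-agree (keep-agree 15 {compile (addKey (lit 1))} refl k₁) rd) C u⁻<q pure-u⁻ (trans (ix k₁ 18 refl 0) e18))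
    λ σ₂ k₂ A₂ → acc-trans A₁ A₂

  r-clauseLeaf : ∀ {σ L c} → Ready σ L → Complete Pure L → index σ 18 0 ≡ c * (Q * Q) →
                 Runs clauseLeaf σ (Acc c (Clause L) σ)
  r-clauseLeaf {σ} {L} {c} rd C e18 =
    let σ₁ = σ ⟨ 46 ≔ index σ 9 (index σ 13 1) ⟩ ⟨ 41 ≔ 1 + index σ 13 0 ⟩
        rd₁ : Ready σ₁ L
        rd₁ = ready-agree (agree-trans (agree-put {a = 46} refl) (agree-put {a = 41} refl)) rd
        e46 : index σ 9 (index σ 13 1) ≡ key [] * Q
        e46 = trans (cong (index σ 9) (rfull rd)) (row-of (rfam rd) (C []))
    in r-put⨟ (r-put⨟ (r-for
      (λ k σ′ → Acc c (λ a b → sumN k λ k → ind a (key []) * ind b (K L k) * bit (not (ann (nth L k) u±))) σ σ′)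
      refl refl (count (rfam rd₁)) (size≤ rd₁) acc-0
      (λ k σ₂ k< k₂ x₂ A →
        let rd₂ = ready-agree (keep-agree 15 {compile clauseRow} refl k₂) rd₁
            e48 : index σ₂ 8 (index σ₂ 47 0) ≡ K L k
            e48 = trans (cong (index σ₂ 8) x₂) (keyAt (rfam rd₂) k<)
            dst : index σ₂ 18 0 + index σ₂ 46 0 + index σ₂ 8 (index σ₂ 47 0) ≡ cell² c (key []) (K L k)
            dst = cong₂ _+_ (cong₂ _+_ (trans (ix k₂ 18 refl 0) e18) (trans (ix k₂ 46 refl 0) e46)) e48
            test : index σ₂ 10 (index σ₂ 9 (index σ₂ 8 (index σ₂ 47 0)) + index σ₂ 41 0) ≡ bit (ann (nth L k) u±)
            test = trans (cong (index σ₂ 10) (cong₂ _+_ (trans (cong (index σ₂ 9) e48) (shift (rows (rfam rd₂) k<))) (trans (ix k₂ 41 refl 0) (cong suc (rlow rd)))))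
                     (bits (rows (rfam rd₂) k<) u±<q)
        in r-put⨟ (r-if
          (λ nz → r-nop (acc-cong (λ a b → trans (sym (+-identityʳ _)) (cong (sumN k (λ j → ind a (key []) * ind b (K L j) * bit (not (ann (nth L j) u±))) +_) (sym (vanish a b k (ann (nth L k) u±) (sym test) nz)))) (acc-index A)))
          (λ z → r-putᶜ (acc-trans A (acc-cong (λ a b → cong (ind a (key []) * ind b (K L k) *_) (sym (keepBit (ann (nth L k) u±) (trans (sym test) z))))
            (acc-index (acc-add {c} {key []} {K L k} {w = 1} (key<Q []) (key<Q (nth L k)) dst (cong (λ z → counter σ₂ 1 z + 1) dst))))))))
      (λ _ _ A → A)))
    where
    vanish : ∀ a b k β {x} → bit β ≡ x → x ≢ 0 → ind a (key []) * ind b (K L k) * bit (not β) ≡ 0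
    vanish a b k true e nz = *-zeroʳ (ind a (key []) * ind b (K L k))
    vanish a b k false refl nz = contradiction refl nz

    keepBit : ∀ β → bit β ≡ 0 → bit (not β) ≡ 1
    keepBit false _ = refl

  -- h is the height of the stack below the new entry, c the number of the new
  -- table.
  record After (σ σ′ : State) (L : List (List V)) (c h : ℕ) (F : ℕ → ℕ → ℕ) (p : Bool → ℕ) : Set where
    constructor after
    field
      aready  : Ready σ′ L
      added   : Acc c F σ σ′
      ahead   : ∀ s → index σ′ 15 (bit s) ≡ p s
      top     : index σ′ 16 h ≡ c * (Q * Q)
      below   : ∀ {i} → i < h → index σ′ 16 i ≡ index σ 16 i
      height  : index σ′ 17 0 ≡ suc h
      fresh   : index σ′ 18 0 ≡ suc c * (Q * Q)

  open After public

  r-push : ∀ {σ σ₀ L c h F p} → Ready σ L → Acc c F σ₀ σ → (∀ s → index σ 15 (bit s) ≡ p s) →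
           index σ 17 0 ≡ h → index σ 18 0 ≡ c * (Q * Q) → (∀ {i} → i < h → index σ 16 i ≡ index σ₀ 16 i) →
           Runs push σ (λ σ′ → After σ₀ σ′ L c h F p)
  r-push {σ} {c = c} {h} rd A ep e17 e18 old = r-put⨟ (r-put⨟ (r-put (after
    (ready-agree (agree-trans (agree-put {a = 16} refl) (agree-trans (agree-put {a = 17} refl) (agree-put {a = 18} refl))) rd)
    (acc-index A) ep
    (at-write h (index σ 17 0) (λ _ → e18) (λ ne → contradiction (sym e17) ne))
    (λ {i} i< → at-write i (index σ 17 0) (λ e → contradiction (trans e e17) (<⇒≢ i<)) (λ _ → old i<))
    (trans (cong (_+ 1) e17) (+-comm h 1))
    (trans (cong₂ _+_ e18 (rpair rd)) (+-comm (c * (Q * Q)) _)))))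

  record Before (σ : State) (L : List (List V)) (c : ℕ) (p : Bool → ℕ) : Set where
    constructor before
    field
      bready    : Ready σ L
      complete  : Complete Pure L
      position  : ∀ s → index σ 15 (bit s) ≡ p s
      nextTable : index σ 18 0 ≡ c * (Q * Q)

  open Before public

  LeafSum : Bool → List (List V) → ℕ → ℕ → ℕ
  LeafSum b L = if b then Variable L else Clause L

  r-leaf : ∀ var {σ L c h p v n} → Before σ L c p → index σ 17 0 ≡ h → index σ 0 2 ≡ n → index σ 2 (p false + 1) ≡ v →
           (if var then v < n else n ≤ v) →
           Runs leafCmd σ (λ σ′ → After σ σ′ L c h (LeafSum var L) (λ s → p s + 2))
  r-leaf var {σ} {L} {c} {h} {p} {v} {n} B e17 en ev isVar = r-seq
    (r-if {σ = σ} {Q = Acc c (LeafSum var L) σ} (branch var isVar) (branch′ var isVar))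
    λ σ₁ k₁ A →
      let rd₁ = ready-agree (keep-agree 15 {compile (ifte (0 [ lit 2 ]ᵉ ∸ᵉ 2 [ 15 [ lit 0 ]ᵉ +ᵉ lit 1 ]ᵉ) variableLeaf clauseLeaf)} refl k₁) (bready B)
      in r-put⨟ (r-put⨟ (r-push
        (ready-agree (agree-trans (agree-put {a = 15} refl) (agree-put {a = 15} refl)) rd₁) (acc-index A)
        (λ { false → cong (_+ 2) (trans (ix k₁ 15 refl 0) (position B false)) ; true → cong (_+ 2) (trans (ix k₁ 15 refl 1) (position B true)) })
        (trans (ix k₁ 17 refl 0) e17) (trans (ix k₁ 18 refl 0) (nextTable B)) (λ _ → ix k₁ 16 refl _)))
    where
    test : index σ 0 2 ∸ index σ 2 (index σ 15 0 + 1) ≡ n ∸ v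
    test = cong₂ _∸_ en (trans (cong (λ z → index σ 2 (z + 1)) (position B false)) ev)

    branch : ∀ var → (if var then v < n else n ≤ v) → index σ 0 2 ∸ index σ 2 (index σ 15 0 + 1) ≢ 0 →
             Runs variableLeaf σ (Acc c (LeafSum var L) σ)
    branch true  _   _  = r-variableLeaf (bready B) (complete B) (nextTable B)
    branch false n≤v nz = contradiction (trans test (m≤n⇒m∸n≡0 n≤v)) nz

    branch′ : ∀ var → (if var then v < n else n ≤ v) → index σ 0 2 ∸ index σ 2 (index σ 15 0 + 1) ≡ 0 →
              Runs clauseLeaf σ (Acc c (LeafSum var L) σ)
    branch′ true  v<n z = contradiction (m∸n≡0⇒m≤n (trans (sym test) z)) (<⇒≱ v<n)
    branch′ false _   _ = r-clauseLeaf (bready B) (complete B) (nextTable B)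

  -- joinOp collects the contributions of both subtrees; leftOp and rightOp give
  -- what a subtree sees of the outside and of its sibling.
  joinOp leftOp rightOp : (ℕ → Blocks) → List V → List V → List V
  joinOp  R = meet false (R 1) false (R 2)
  leftOp  R = meet true (R 1) false (R 0)
  rightOp R = meet true (R 2) true (R 0)

  NodeSum : (ℕ → ℕ) → (ℕ → Blocks) → List (List V) → ℕ → ℕ → ℕ → ℕ → ℕ
  NodeSum D R L x y a b = sumN (length L) λ i → sumN (length L) λ j → sumN (length L) λ k →
    ind a (key (joinOp R (nth L i) (nth L j))) * ind b (K L k) *
    (D (cell² x (K L i) (key (leftOp R (nth L k) (nth L j)))) * D (cell² y (K L j) (key (rightOp R (nth L k) (nth L i)))))

  NodeSum-cong : ∀ {D D′} R L x y a b → (∀ j → D j ≡ D′ j) → NodeSum D R L x y a b ≡ NodeSum D′ R L x y a b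
  NodeSum-cong R L x y a b e = sumN-cong (length L) λ {i} _ → sumN-cong (length L) λ {j} _ → sumN-cong (length L) λ {k} _ →
    cong (ind a (key (joinOp R (nth L i) (nth L j))) * ind b (K L k) *_)
      (cong₂ _*_ (e (cell² x (K L i) (key (leftOp R (nth L k) (nth L j))))) (e (cell² y (K L j) (key (rightOp R (nth L k) (nth L i))))))

  r-nodeTables : ∀ R {σ L} → Ready σ L → Loaded σ R →
    Runs nodeTables σ (λ σ′ → HasTable σ′ 0 L (joinOp R) × HasTable σ′ 1 L (leftOp R) × HasTable σ′ 2 L (rightOp R))
  r-nodeTables R {σ} {L} rd l =
    r-seq (r-table 0 1 true 2 true R (s≤s (s≤s z≤n)) (s≤s (s≤s (s≤s z≤n))) rd l) λ σ₁ k₁ T₀ →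
    r-seq (r-table 1 1 false 0 true R (s≤s (s≤s z≤n)) (s≤s z≤n) (ready-agree (keep-agree 15 {compile (table 0 1 true 2 true)} refl k₁) rd)
                                             (loaded-agree (keep-agree 16 {compile (table 0 1 true 2 true)} refl k₁) l)) λ σ₂ k₂ T₁ →
    r-conseq (r-table 2 2 false 0 false R (s≤s (s≤s (s≤s z≤n))) (s≤s z≤n)
      (ready-agree (agree-trans (keep-agree 15 {compile (table 0 1 true 2 true)} refl k₁) (keep-agree 15 {compile (table 1 1 false 0 true)} refl k₂)) rd)
      (loaded-agree (agree-trans (keep-agree 16 {compile (table 0 1 true 2 true)} refl k₁) (keep-agree 16 {compile (table 1 1 false 0 true)} refl k₂)) l))
    λ σ₃ k₃ T₂ →
      (λ i< j< → trans (ix k₃ 80 refl _) (trans (ix k₂ 80 refl _) (T₀ i< j<)))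
    , (λ i< j< → trans (ix k₃ 81 refl _) (T₁ i< j<))
    , T₂

  ⟦offset⟧ : ∀ s μ {σ L} → Ready σ L → ⟦ offsetᵉ s μ ⟧ᵉ σ ≡ μ * (dim s * dim s)
  ⟦offset⟧ s zero    rd = refl
  ⟦offset⟧ s (suc μ) rd = trans (cong₂ _+_ (⟦offset⟧ s μ rd) (rsquare rd s)) (+-comm (μ * (dim s * dim s)) _)

  r-node : ∀ R {σ L c h p x y} → Before σ L c p → index σ 17 0 ≡ suc (suc h) →
           (∀ s {μ} → μ < 3 → Stored s σ (p s + 1 + μ * (dim s * dim s)) (R μ s)) →
           index σ 16 h ≡ x * (Q * Q) → index σ 16 (suc h) ≡ y * (Q * Q) → x ≢ c → y ≢ c →
           Runs nodeCmd σ (λ σ′ → After σ σ′ L c h (NodeSum (counter σ 1) R L x y) (λ s → p s + 1 + 3 * (dim s * dim s)))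
  r-node R {σ} {L} {c} {h} {p} {x} {y} B e17 st ex ey x≢ y≢ =
    let σ₁ = σ ⟨ 15 # 0 ≔ index σ 15 0 + 1 ⟩ ⟨ 15 # 1 ≔ index σ 15 1 + 1 ⟩
               ⟨ 20 ≔ index σ 16 (index σ 17 0 ∸ 2) ⟩ ⟨ 21 ≔ index σ 16 (index σ 17 0 ∸ 1) ⟩
        ag : Agree 15 σ σ₁
        ag = agree-trans (agree-put {a = 15} refl) (agree-trans (agree-put {a = 15} refl) (agree-trans (agree-put {a = 20} refl) (agree-put {a = 21} refl)))
        rd₁ : Ready σ₁ L
        rd₁ = ready-agree ag (bready B)
        pos₁ : ∀ s → index σ₁ 15 (bit s) ≡ p s + 1
        pos₁ = λ { false → cong (_+ 1) (position B false) ; true → cong (_+ 1) (position B true) }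
        l₁ : Loaded σ₁ R
        l₁ = loaded λ s {μ} μ< {k} {j} k< j< → trans (token-agree s (agree-weaken 4 11 ag) _)
               (trans (cong (λ z → index σ (2 + bit s) (z + (k * dim s + j))) (cong₂ _+_ (pos₁ s) (⟦offset⟧ s μ rd₁))) (st s μ< k< j<))
    in r-put⨟ (r-put⨟ (r-put⨟ (r-put⨟ (r-seq (r-nodeTables R rd₁ l₁)
    λ σ₂ k₂ (T₀ , T₁ , T₂) →
      let rd₂ = ready-agree (keep-agree 15 {compile nodeTables} refl k₂) rd₁
      in r-seq (r-combine {fZ = joinOp R} {fX = leftOp R} {fY = rightOp R} rd₂ T₀ T₁ T₂
        (λ i< j< → complete B (pure-meet false (R 1) false (R 2) (allPure (rfam rd₂) i<) (allPure (rfam rd₂) j<)))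
        (trans (ix k₂ 18 refl 0) (nextTable B))
        (trans (ix k₂ 20 refl 0) (trans (cong (λ z → index σ 16 (z ∸ 2)) e17) ex))
        (trans (ix k₂ 21 refl 0) (trans (cong (λ z → index σ 16 (z ∸ 1)) e17) ey)) x≢ y≢)
    λ σ₃ k₃ A →
      let rd₃ = ready-agree (keep-agree 15 {compile combine} refl k₃) rd₂
          pos₃ : ∀ s → index σ₃ 15 (bit s) ≡ p s + 1
          pos₃ s = trans (ix k₃ 15 refl _) (trans (ix k₂ 15 refl _) (pos₁ s))
          A′ : Acc c (NodeSum (counter σ 1) R L x y) σ σ₃
          A′ = acc-cong (λ a b → NodeSum-cong R L x y a b (λ j → ct k₂ 1 refl j)) (acc-trans (acc-indexˡ (acc-keep k₂ refl)) A)
      in r-put⨟ (r-put⨟ (r-put⨟ (r-push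
        (ready-agree (agree-trans (agree-put {a = 15} refl) (agree-trans (agree-put {a = 15} refl) (agree-put {a = 17} refl))) rd₃)
        (acc-index A′)
        (λ { false → cong₂ _+_ (pos₃ false) (⟦offset⟧ false 3 rd₃) ; true → cong₂ _+_ (pos₃ true) (⟦offset⟧ true 3 rd₃) })
        (cong (_∸ 2) (trans (ix k₃ 17 refl 0) (trans (ix k₂ 17 refl 0) e17)))
        (trans (ix k₃ 18 refl 0) (trans (ix k₂ 18 refl 0) (nextTable B)))
        (λ _ → trans (ix k₃ 16 refl _) (ix k₂ 16 refl _)))))))))

  -- What the tables count.

  matrices : (g⁺ f₁⁺ f₂⁺ : Relabeling t⁺) (g⁻ f₁⁻ f₂⁻ : Relabeling t⁻) → ℕ → Blocks
  matrices g⁺ f₁⁺ f₂⁺ g⁻ f₁⁻ f₂⁻ 0             = λ { false → g⁺ ; true → g⁻ }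
  matrices g⁺ f₁⁺ f₂⁺ g⁻ f₁⁻ f₂⁻ 1             = λ { false → f₁⁺ ; true → f₁⁻ }
  matrices g⁺ f₁⁺ f₂⁺ g⁻ f₁⁻ f₂⁻ (suc (suc _)) = λ { false → f₂⁺ ; true → f₂⁻ }

  -- The contributions of the variables below a node, transported to its coordinates.
  labels : ∀ {s} → ParseTree t⁺ s → ParseTree t⁻ s → (Leaf s → Bool) → Asg s → List V
  labels ⊙ ⊙ κ a = if κ tt then (if a then u⁺ ∷ [] else u⁻ ∷ []) else []
  labels (⊗[ g⁺ ∣ f₁⁺ , f₂⁺ ] l⁺ r⁺) (⊗[ g⁻ ∣ f₁⁻ , f₂⁻ ] l⁻ r⁻) κ (a , b) =
    joinOp (matrices g⁺ f₁⁺ f₂⁺ g⁻ f₁⁻ f₂⁻) (labels l⁺ l⁻ (κ ∘ inj₁) a) (labels r⁺ r⁻ (κ ∘ inj₂) b)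

  -- All clauses below are satisfied by the assignment or by an outside variable
  -- whose label in the current node's coordinates occurs in B.
  ok : ∀ {s} → ParseTree t⁺ s → ParseTree t⁻ s → (Leaf s → Bool) → Asg s → List V → Bool
  ok ⊙ ⊙ κ a B = if κ tt then true else not (ann B u±)
  ok (⊗[ g⁺ ∣ f₁⁺ , f₂⁺ ] l⁺ r⁺) (⊗[ g⁻ ∣ f₁⁻ , f₂⁻ ] l⁻ r⁻) κ (a , b) B =
    ok l⁺ l⁻ (κ ∘ inj₁) a (leftOp R B (labels r⁺ r⁻ (κ ∘ inj₂) b)) ∧
    ok r⁺ r⁻ (κ ∘ inj₂) b (rightOp R B (labels l⁺ l⁻ (κ ∘ inj₁) a))
    where R = matrices g⁺ f₁⁺ f₂⁺ g⁻ f₁⁻ f₂⁻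

  cnt : ∀ {s} → ParseTree t⁺ s → ParseTree t⁻ s → (Leaf s → Bool) → ℕ → List V → ℕ
  cnt {s} T⁺ T⁻ κ a B = sumA s κ λ x → ind a (key (labels T⁺ T⁻ κ x)) * bit (ok T⁺ T⁻ κ x B)

  pure-labels : ∀ {s} (T⁺ : ParseTree t⁺ s) (T⁻ : ParseTree t⁻ s) κ a → All Pure (labels T⁺ T⁻ κ a)
  pure-labels ⊙ ⊙ κ a with κ tt | a
  ... | true  | true  = pure-u⁺ ∷ []
  ... | true  | false = pure-u⁻ ∷ []
  ... | false | _     = []
  pure-labels (⊗[ g⁺ ∣ f₁⁺ , f₂⁺ ] l⁺ r⁺) (⊗[ g⁻ ∣ f₁⁻ , f₂⁻ ] l⁻ r⁻) κ (a , b) =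
    pure-meet false (R 1) false (R 2) (pure-labels l⁺ l⁻ (κ ∘ inj₁) a) (pure-labels r⁺ r⁻ (κ ∘ inj₂) b)
    where R = matrices g⁺ f₁⁺ f₂⁺ g⁻ f₁⁻ f₂⁻

  ≈-refl : ∀ {U} → U ≈ U
  ≈-refl = by λ _ → refl

  ok-≈ : ∀ {s} (T⁺ : ParseTree t⁺ s) (T⁻ : ParseTree t⁻ s) κ a {B B′} → B ≈ B′ → ok T⁺ T⁻ κ a B ≡ ok T⁺ T⁻ κ a B′
  ok-≈ ⊙ ⊙ κ a h with κ tt
  ... | true  = refl
  ... | false = cong not (on h u±)
  ok-≈ (⊗[ g⁺ ∣ f₁⁺ , f₂⁺ ] l⁺ r⁺) (⊗[ g⁻ ∣ f₁⁻ , f₂⁻ ] l⁻ r⁻) κ (a , b) h =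
    cong₂ _∧_ (ok-≈ l⁺ l⁻ _ a (meet-≈ true (R 1) false (R 0) h ≈-refl)) (ok-≈ r⁺ r⁻ _ b (meet-≈ true (R 2) true (R 0) h ≈-refl))
    where R = matrices g⁺ f₁⁺ f₂⁺ g⁻ f₁⁻ f₂⁻

  pick : ∀ {L k} → Distinct L → ((i , _ , _) : HasKey L k) → ∀ g → sumN (length L) (λ j → ind k (K L j) * g j) ≡ g i
  pick {L} d (i , i< , e) g = sumN-pick (K L) g i< e (λ j< e′ → d j< i< (trans e′ (sym e)))

  unit-sum : ∀ L → Distinct L → Complete Pure L → ∀ {B} → All Pure B → ∀ a U → Unit L U a (key B) ≡ ind a (key U)
  unit-sum L d C {B} pB a U = begin
    sumN (length L) (λ k → ind a (key U) * ind (key B) (K L k) * 1)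
      ≡⟨ sumN-cong (length L) (λ {k} _ → shuffle (ind a (key U)) (ind (key B) (K L k))) ⟩
    sumN (length L) (λ k → ind (key B) (K L k) * ind a (key U))
      ≡⟨ pick {L} {key B} d (C pB) (λ _ → ind a (key U)) ⟩
    ind a (key U) ∎
    where open ≡-Reasoning
          shuffle : ∀ x y → x * y * 1 ≡ y * x
          shuffle = solve-∀

  cnt-leaf : ∀ {L} → Distinct L → Complete Pure L → .{{_ : NonZero t⁺}} .{{_ : NonZero t⁻}} → ∀ κ {B} → All Pure B → ∀ a →
             LeafSum (κ tt) L a (key B) ≡ cnt ⊙ ⊙ κ a B
  cnt-leaf {L} d C κ {B} pB a with κ tt
  ... | true  = cong₂ _+_ (trans (unit-sum L d C pB a (u⁺ ∷ [])) (sym (*-identityʳ _))) (trans (unit-sum L d C pB a (u⁻ ∷ [])) (sym (*-identityʳ _)))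
  ... | false = begin
    sumN (length L) (λ k → ind a (key []) * ind (key B) (K L k) * bit (not (ann (nth L k) u±)))
      ≡⟨ sumN-cong (length L) (λ {k} _ → shuffle (ind a (key [])) (ind (key B) (K L k)) _) ⟩
    sumN (length L) (λ k → ind (key B) (K L k) * (ind a (key []) * bit (not (ann (nth L k) u±))))
      ≡⟨ pick {L} {key B} d (C pB) (λ k → ind a (key []) * bit (not (ann (nth L k) u±))) ⟩
    ind a (key []) * bit (not (ann (nth L i) u±))
      ≡⟨ cong (λ β → ind a (key []) * bit (not β)) (on (key⇒≈ {nth L i} {B} (proj₂ (proj₂ (C pB)))) u±) ⟩
    ind a (key []) * bit (not (ann B u±)) ∎
    where open ≡-Reasoning
          i = proj₁ (C pB)
          shuffle : ∀ x y z → x * y * z ≡ y * (x * z)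
          shuffle = solve-∀

  module _ {l r} (g⁺ f₁⁺ f₂⁺ : Relabeling t⁺) (g⁻ f₁⁻ f₂⁻ : Relabeling t⁻)
           (l⁺ : ParseTree t⁺ l) (l⁻ : ParseTree t⁻ l) (r⁺ : ParseTree t⁺ r) (r⁻ : ParseTree t⁻ r) (κ : Leaf (node l r) → Bool)
           {L : List (List V)} (d : Distinct L) (AP : AllPure L) (C : Complete Pure L) where

    private
      N = length L
      R = matrices g⁺ f₁⁺ f₂⁺ g⁻ f₁⁻ f₂⁻
      κˡ : Leaf l → Bool
      κˡ = κ ∘ inj₁
      κʳ : Leaf r → Bool
      κʳ = κ ∘ inj₂
      A : Asg l → List V
      A = labels l⁺ l⁻ κˡ
      B : Asg r → List V
      B = labels r⁺ r⁻ κʳ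

    -- The sums over i and j sort the assignments of the two subtrees by annihilator: a pair (u, v)
    -- contributes to exactly one (i, j). There the listed representatives may be replaced by the
    -- actual contributions, since `joinOp` and `ok` respect annihilators.
    cnt-node : ∀ {D x y} →
      (∀ {a E} → a < Q → All Pure E → D (cell² x a (key E)) ≡ cnt l⁺ l⁻ κˡ a E) →
      (∀ {a E} → a < Q → All Pure E → D (cell² y a (key E)) ≡ cnt r⁺ r⁻ κʳ a E) →
      ∀ {E} → All Pure E → ∀ a →
      NodeSum D R L x y a (key E) ≡ cnt (⊗[ g⁺ ∣ f₁⁺ , f₂⁺ ] l⁺ r⁺) (⊗[ g⁻ ∣ f₁⁻ , f₂⁻ ] l⁻ r⁻) κ a E
    cnt-node {D} {x} {y} hx hy {E} pE a = begin
      NodeSum D R L x y a (key E)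
        ≡⟨ sumN-cong N (λ {i} i< → sumN-cong N (λ {j} j< → innermost i j i< j<)) ⟩
      sumN N (λ i → sumN N (λ j → sumA l κˡ (λ u → sumA r κʳ (λ v → term u v i j))))
        ≡⟨ sumN-cong N (λ {i} _ → trans (sumN-sumA N l κˡ) (sumA-cong l κˡ (λ u → sumN-sumA N r κʳ))) ⟩
      sumN N (λ i → sumA l κˡ (λ u → sumA r κʳ (λ v → sumN N (λ j → term u v i j))))
        ≡⟨ trans (sumN-sumA N l κˡ) (sumA-cong l κˡ (λ u → sumN-sumA N r κʳ)) ⟩
      sumA l κˡ (λ u → sumA r κʳ (λ v → sumN N (λ i → sumN N (λ j → term u v i j))))
        ≡⟨ sumA-cong l κˡ (λ u → sumA-cong r κʳ (λ v → collapse u v)) ⟩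
      sumA l κˡ (λ u → sumA r κʳ (λ v → ind a (key (joinOp R (A u) (B v))) *
        bit (ok l⁺ l⁻ κˡ u (leftOp R E (B v)) ∧ ok r⁺ r⁻ κʳ v (rightOp R E (A u))))) ∎
      where
      open ≡-Reasoning
      k₀ = proj₁ (C pE)
      k₀< = proj₁ (proj₂ (C pE))
      E₀ = nth L k₀
      E₀≈E : E₀ ≈ E
      E₀≈E = key⇒≈ (proj₂ (proj₂ (C pE)))

      okˡ : Asg l → ℕ → ℕ
      okˡ u j = bit (ok l⁺ l⁻ κˡ u (leftOp R E₀ (nth L j)))
      okʳ : Asg r → ℕ → ℕ
      okʳ v i = bit (ok r⁺ r⁻ κʳ v (rightOp R E₀ (nth L i)))
      Z : ℕ → ℕ → ℕ
      Z i j = ind a (key (joinOp R (nth L i) (nth L j)))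

      term : Asg l → Asg r → ℕ → ℕ → ℕ
      term u v i j = ind (key (A u)) (K L i) * (ind (key (B v)) (K L j) * (Z i j * (okˡ u j * okʳ v i)))

      innermost : ∀ i j → i < N → j < N →
        sumN N (λ k → Z i j * ind (key E) (K L k) *
          (D (cell² x (K L i) (key (leftOp R (nth L k) (nth L j)))) * D (cell² y (K L j) (key (rightOp R (nth L k) (nth L i))))))
        ≡ sumA l κˡ (λ u → sumA r κʳ (λ v → term u v i j))
      innermost i j i< j< = begin
        sumN N (λ k → Z i j * ind (key E) (K L k) * G k)
          ≡⟨ sumN-cong N (λ {k} _ → shuffle (Z i j) (ind (key E) (K L k)) (G k)) ⟩
        sumN N (λ k → ind (key E) (K L k) * (Z i j * G k))
          ≡⟨ pick {L} {key E} d (C pE) (λ k → Z i j * G k) ⟩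
        Z i j * G k₀
          ≡⟨ cong (Z i j *_) (cong₂ _*_
               (hx (key<Q (nth L i)) (pure-meet true (R 1) false (R 0) (AP k₀<) (AP j<)))
               (hy (key<Q (nth L j)) (pure-meet true (R 2) true (R 0) (AP k₀<) (AP i<)))) ⟩
        Z i j * (sumA l κˡ (λ u → ind (K L i) (key (A u)) * okˡ u j) * sumA r κʳ (λ v → ind (K L j) (key (B v)) * okʳ v i))
          ≡⟨ cong (Z i j *_) (trans (sumA-*ʳ l κˡ _) (sumA-cong l κˡ (λ u → sumA-*ˡ r κʳ (ind (K L i) (key (A u)) * okˡ u j)))) ⟩
        Z i j * sumA l κˡ (λ u → sumA r κʳ (λ v → ind (K L i) (key (A u)) * okˡ u j * (ind (K L j) (key (B v)) * okʳ v i)))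
          ≡⟨ trans (sumA-*ˡ l κˡ (Z i j)) (sumA-cong l κˡ (λ u → sumA-*ˡ r κʳ (Z i j))) ⟩
        sumA l κˡ (λ u → sumA r κʳ (λ v → Z i j * (ind (K L i) (key (A u)) * okˡ u j * (ind (K L j) (key (B v)) * okʳ v i))))
          ≡⟨ sumA-cong l κˡ (λ u → sumA-cong r κʳ (λ v → trans
               (cong₂ (λ α β → Z i j * (α * okˡ u j * (β * okʳ v i))) (ind-sym (K L i) _) (ind-sym (K L j) _))
               (regroup (Z i j) (ind (key (A u)) (K L i)) (okˡ u j) (ind (key (B v)) (K L j)) (okʳ v i)))) ⟩
        sumA l κˡ (λ u → sumA r κʳ (λ v → term u v i j)) ∎
        where
        G : ℕ → ℕ
        G k = D (cell² x (K L i) (key (leftOp R (nth L k) (nth L j)))) * D (cell² y (K L j) (key (rightOp R (nth L k) (nth L i))))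
        shuffle : ∀ x y z → x * y * z ≡ y * (x * z)
        shuffle = solve-∀
        regroup : ∀ z α o β p → z * (α * o * (β * p)) ≡ α * (β * (z * (o * p)))
        regroup = solve-∀

      collapse : ∀ u v → sumN N (λ i → sumN N (λ j → term u v i j)) ≡
                 ind a (key (joinOp R (A u) (B v))) * bit (ok l⁺ l⁻ κˡ u (leftOp R E (B v)) ∧ ok r⁺ r⁻ κʳ v (rightOp R E (A u)))
      collapse u v = begin
        sumN N (λ i → sumN N (λ j → term u v i j))
          ≡⟨ sumN-cong N (λ {i} _ → sumN-*ˡ N (ind (key (A u)) (K L i))) ⟨
        sumN N (λ i → ind (key (A u)) (K L i) * sumN N (λ j → ind (key (B v)) (K L j) * H i j))
          ≡⟨ pick {L} {key (A u)} d (C (pure-labels l⁺ l⁻ κˡ u)) (λ i → sumN N (λ j → ind (key (B v)) (K L j) * H i j)) ⟩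
        sumN N (λ j → ind (key (B v)) (K L j) * H i₀ j)
          ≡⟨ pick {L} {key (B v)} d (C (pure-labels r⁺ r⁻ κʳ v)) (λ j → H i₀ j) ⟩
        H i₀ j₀
          ≡⟨ cong₂ _*_ (cong (ind a) (≈⇒key (meet-≈ false (R 1) false (R 2) U≈ V≈)))
               (trans (bit-* (ok l⁺ l⁻ κˡ u (leftOp R E₀ (nth L j₀))) (ok r⁺ r⁻ κʳ v (rightOp R E₀ (nth L i₀)))) (cong bit (cong₂ _∧_
                 (ok-≈ l⁺ l⁻ κˡ u (meet-≈ true (R 1) false (R 0) E₀≈E V≈))
                 (ok-≈ r⁺ r⁻ κʳ v (meet-≈ true (R 2) true (R 0) E₀≈E U≈))))) ⟩
        ind a (key (joinOp R (A u) (B v))) * bit (ok l⁺ l⁻ κˡ u (leftOp R E (B v)) ∧ ok r⁺ r⁻ κʳ v (rightOp R E (A u))) ∎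
        where
        H : ℕ → ℕ → ℕ
        H i j = Z i j * (okˡ u j * okʳ v i)
        i₀ = proj₁ (C (pure-labels l⁺ l⁻ κˡ u))
        j₀ = proj₁ (C (pure-labels r⁺ r⁻ κʳ v))
        U≈ : nth L i₀ ≈ A u
        U≈ = key⇒≈ (proj₂ (proj₂ (C (pure-labels l⁺ l⁻ κˡ u))))
        V≈ : nth L j₀ ≈ B v
        V≈ = key⇒≈ (proj₂ (proj₂ (C (pure-labels r⁺ r⁻ κʳ v))))

  -- The contributions of an assignment have exactly one listed key, so summing over the list
  -- removes the condition on them.
  total : ∀ {s} (T⁺ : ParseTree t⁺ s) (T⁻ : ParseTree t⁻ s) κ {L} → Distinct L → Complete Pure L →
          sumN (length L) (λ i → cnt T⁺ T⁻ κ (K L i) []) ≡ sumA s κ (λ x → bit (ok T⁺ T⁻ κ x []))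
  total {s} T⁺ T⁻ κ {L} d C = begin
    sumN (length L) (λ i → cnt T⁺ T⁻ κ (K L i) [])
      ≡⟨ sumN-sumA (length L) s κ ⟩
    sumA s κ (λ x → sumN (length L) (λ i → ind (K L i) (key (labels T⁺ T⁻ κ x)) * bit (ok T⁺ T⁻ κ x [])))
      ≡⟨ sumA-cong s κ (λ x → trans (sumN-cong (length L) (λ {i} _ → cong (_* bit (ok T⁺ T⁻ κ x [])) (ind-sym (K L i) _)))
           (pick {L} {key (labels T⁺ T⁻ κ x)} d (C (pure-labels T⁺ T⁻ κ x)) (λ _ → bit (ok T⁺ T⁻ κ x [])))) ⟩
    sumA s κ (λ x → bit (ok T⁺ T⁻ κ x [])) ∎
    where open ≡-Reasoning

  -- Traversal of the postfix input.

  bodyCost : ℕ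
  bodyCost = ⟦ cost body ⟧ (τ , y)

  -- Rounds of the main loop without the final failing test, so that the runs for two subtrees and
  -- their parent can be concatenated.
  data Loops : ℕ → State → State → Set where
    none : ∀ {σ} → Loops 0 σ σ
    more : ∀ {k m σ σ₁ σ₂} → ⟦ tokenᵉ ⟧ᵉ σ ≢ 0 → ⟨ compile body , σ ⟩⇓[ m ] σ₁ → m ≤ bodyCost → Loops k σ₁ σ₂ → Loops (suc k) σ σ₂

  loops-++ : ∀ {k l σ σ₁ σ₂} → Loops k σ σ₁ → Loops l σ₁ σ₂ → Loops (k + l) σ σ₂
  loops-++ none ls = ls
  loops-++ (more t d b ks) ls = more t d b (loops-++ ks ls)

  -- Evaluating `tokenᵉ` costs 3 and testing it 1, whence the 4 in every round and at the end.
  loops-while : ∀ {k σ σ′} → Loops k σ σ′ → ⟦ tokenᵉ ⟧ᵉ σ′ ≡ 0 →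
                Σ[ n ∈ ℕ ] (⟨ WHILE tokenᵉ DO compile body , σ ⟩⇓[ n ] σ′) × n ≤ k * (4 + bodyCost) + 4
  loops-while none z = _ , ⇓stop z , ≤-refl
  loops-while {suc k} (more {m = m} t d b ks) z with n , d′ , b′ ← loops-while ks z =
    _ , ⇓loop t d d′ , ≤-trans (+-mono-≤ (+-monoʳ-≤ 4 b) b′) (≤-reflexive (sym (+-assoc (4 + bodyCost) (k * (4 + bodyCost)) 4)))

  Streams : State → (Bool → ℕ) → (Bool → List ℕ) → Set
  Streams σ p X = ∀ s → Stream (index σ (2 + bit s)) (p s) (X s)

  tokens : ∀ {s} → (Leaf s → ℕ) → ParseTree t⁺ s → ParseTree t⁻ s → (Bool → List ℕ) → Bool → List ℕ
  tokens code T⁺ T⁻ rest false = encodeTree code T⁺ ++ rest false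
  tokens code T⁺ T⁻ rest true  = encodeTree code T⁻ ++ rest true

  Zero : State → ℕ → Set
  Zero σ c = ∀ {c′ a b} → c ≤ c′ → a < Q → b < Q → counter σ 1 (cell² c′ a b) ≡ 0

  Filled : ∀ {s} → State → ℕ → ParseTree t⁺ s → ParseTree t⁻ s → (Leaf s → Bool) → Set
  Filled σ c T⁺ T⁻ κ = ∀ {a E} → a < Q → All Pure E → counter σ 1 (cell² c a (key E)) ≡ cnt T⁺ T⁻ κ a E

  -- The contract of a stack machine reading postfix notation: a subtree consumes exactly its
  -- tokens, pushes one entry and preserves the stack below. Table numbers only grow, so older
  -- tables survive and later ones are still zero, as accumulation requires.
  record Done {s} (σ : State) (L : List (List V)) (c h : ℕ) (T⁺ : ParseTree t⁺ s) (T⁻ : ParseTree t⁻ s)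
              (κ : Leaf s → Bool) (rest : Bool → List ℕ) : Set where
    constructor done
    field
      {result}  : State
      loops     : Loops (nodes s) σ result
      {c′}      : ℕ
      {p′}      : Bool → ℕ
      ready′    : Before result L (suc c′) p′
      later     : c ≤ c′
      onTop     : index result 16 h ≡ c′ * (Q * Q)
      stack     : ∀ {i} → i < h → index result 16 i ≡ index σ 16 i
      height′   : index result 17 0 ≡ suc h
      inputs    : Agree 4 σ result
      streams   : Streams result p′ rest
      unchanged : ∀ {d a b} → d < c → a < Q → b < Q → counter result 1 (cell² d a b) ≡ counter σ 1 (cell² d a b)
      filled    : Filled result c′ T⁺ T⁻ κ
      zero′     : Zero result (suc c′)

  open Done

  streams-agree : ∀ {σ σ′ p X} → Agree 4 σ σ′ → Streams σ p X → Streams σ′ p X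
  streams-agree a st s = reads λ j → trans (token-agree s a _) (cellAt (st s) j)

  zero-after : ∀ {σ σ′ L c h F p} → After σ σ′ L c h F p → Zero σ c → Zero σ′ (suc c)
  zero-after A z c< a< b< = trans (others (added A) (λ e → <⇒≢ c< (sym e)) a< b<) (z (<⇒≤ c<) a< b<)

  module _ {l r} (g⁺ f₁⁺ f₂⁺ : Relabeling t⁺) (g⁻ f₁⁻ f₂⁻ : Relabeling t⁻)
           (l⁺ : ParseTree t⁺ l) (l⁻ : ParseTree t⁻ l) (r⁺ : ParseTree t⁺ r) (r⁻ : ParseTree t⁻ r)
           (rest : Bool → List ℕ) where

    private
      R = matrices g⁺ f₁⁺ f₂⁺ g⁻ f₁⁻ f₂⁻
      T⁺₀ = ⊗[ g⁺ ∣ f₁⁺ , f₂⁺ ] l⁺ r⁺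
      T⁻₀ = ⊗[ g⁻ ∣ f₁⁻ , f₂⁻ ] l⁻ r⁻

    op : Bool → List ℕ
    op false = 2 ∷ encodeMatrix g⁺ ++ encodeMatrix f₁⁺ ++ encodeMatrix f₂⁺ ++ rest false
    op true  = 2 ∷ encodeMatrix g⁻ ++ encodeMatrix f₁⁻ ++ encodeMatrix f₂⁻ ++ rest true

    regroup : ∀ code s → tokens code T⁺₀ T⁻₀ rest s ≡ tokens (code ∘ inj₁) l⁺ l⁻ (tokens (code ∘ inj₂) r⁺ r⁻ op) s
    regroup code s = go s
      where
      reassoc : ∀ (a b G F₁ F₂ r : List ℕ) → (a ++ b ++ 2 ∷ G ++ F₁ ++ F₂) ++ r ≡ a ++ b ++ 2 ∷ G ++ F₁ ++ F₂ ++ r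
      reassoc a b G F₁ F₂ r = trans (++-assoc a _ r) (cong (a ++_) (trans (++-assoc b _ r)
        (cong (λ z → b ++ 2 ∷ z) (trans (++-assoc G _ r) (cong (G ++_) (++-assoc F₁ F₂ r))))))

      go : ∀ s → tokens code T⁺₀ T⁻₀ rest s ≡ tokens (code ∘ inj₁) l⁺ l⁻ (tokens (code ∘ inj₂) r⁺ r⁻ op) s
      go false = reassoc (encodeTree (code ∘ inj₁) l⁺) (encodeTree (code ∘ inj₂) r⁺) (encodeMatrix g⁺) (encodeMatrix f₁⁺) (encodeMatrix f₂⁺) (rest false)
      go true  = reassoc (encodeTree (code ∘ inj₁) l⁻) (encodeTree (code ∘ inj₂) r⁻) (encodeMatrix g⁻) (encodeMatrix f₁⁻) (encodeMatrix f₂⁻) (rest true)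

    done-node : ∀ (κ : Leaf (node l r) → Bool) {code : Leaf (node l r) → ℕ} {σ L c h} (D₁ : Done σ L c h l⁺ l⁻ (κ ∘ inj₁) (tokens (code ∘ inj₂) r⁺ r⁻ op)) →
                Done (result D₁) L (suc (c′ D₁)) (suc h) r⁺ r⁻ (κ ∘ inj₂) op → Done σ L c h T⁺₀ T⁻₀ κ rest
    done-node κ {code} {σ} {L} {c} {h} D₁ D₂ = finish (
        r-if {e = tokenᵉ ∸ᵉ lit 1} {nodeCmd} {leafCmd} {σ₂}
                     (λ _ → r-node R B₂ (height′ D₂)
                       (λ { false {zero} _ → proj₁ (operator g⁺ f₁⁺ f₂⁺ (streams D₂ false))
                          ; false {suc zero} _ → proj₁ (proj₂ (operator g⁺ f₁⁺ f₂⁺ (streams D₂ false)))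
                          ; false {suc (suc zero)} _ → proj₁ (proj₂ (proj₂ (operator g⁺ f₁⁺ f₂⁺ (streams D₂ false))))
                          ; false {suc (suc (suc _))} (s≤s (s≤s (s≤s ())))
                          ; true {zero} _ → proj₁ (operator g⁻ f₁⁻ f₂⁻ (streams D₂ true))
                          ; true {suc zero} _ → proj₁ (proj₂ (operator g⁻ f₁⁻ f₂⁻ (streams D₂ true)))
                          ; true {suc (suc zero)} _ → proj₁ (proj₂ (proj₂ (operator g⁻ f₁⁻ f₂⁻ (streams D₂ true))))
                          ; true {suc (suc (suc _))} (s≤s (s≤s (s≤s ()))) })
                       (trans (stack D₂ {h} ≤-refl) (onTop D₁)) (onTop D₂)
                       -- Both children have smaller table numbers than the new table.
                       (<⇒≢ (m<n⇒m<1+n (later D₂))) (<⇒≢ ≤-refl))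
                     (λ e → contradiction (trans (sym (cong (_∸ 1) tok)) e) λ ()))
      where
      σ₂ = result D₂
      B₂ = ready′ D₂
      tok : index σ₂ 2 (index σ₂ 15 0) ≡ 2
      tok = trans (cong (index σ₂ 2) (trans (position B₂ false) (sym (+-identityʳ _)))) (cellAt (streams D₂ false) 0)

      finish : Runs body σ₂ (λ σ′ → After σ₂ σ′ L (suc (c′ D₂)) h (NodeSum (counter σ₂ 1) R L (c′ D₁) (c′ D₂)) (λ s → p′ D₂ s + 1 + 3 * (dim s * dim s))) → Done σ L c h T⁺₀ T⁻₀ κ rest
      finish (runs {_} {σ₃} d b A) =
        let ag = keep-agree 4 {compile body} refl (keep d)
            rd = aready A
        in done (subst (λ k → Loops k σ σ₃) (+-assoc (nodes l) (nodes r) 1)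
                     (loops-++ (loops-++ (loops D₁) (loops D₂)) (more (λ e → contradiction (trans (sym tok) e) λ ()) d b none)))
                (before rd (complete B₂) (ahead A) (fresh A))
                (≤-trans (later D₁) (≤-trans (n≤1+n _) (≤-trans (later D₂) (n≤1+n _))))
                (top A)
                (λ {i} i< → trans (below A {i} i<) (trans (stack D₂ {i} (m<n⇒m<1+n i<)) (stack D₁ {i} i<)))
                (height A)
                (agree-trans (inputs D₁) (agree-trans (inputs D₂) ag))
                (streams-agree ag (λ { false → proj₂ (proj₂ (proj₂ (operator g⁺ f₁⁺ f₂⁺ (streams D₂ false))))
                                     ; true  → proj₂ (proj₂ (proj₂ (operator g⁻ f₁⁻ f₂⁻ (streams D₂ true)))) }))
                (λ {d} {a} {b} d< a< b< → trans (others (added A) {d} {a} {b} (<⇒≢ (m<n⇒m<1+n (<-≤-trans d< (≤-trans (later D₁) (≤-trans (n≤1+n _) (later D₂)))))) a< b<)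
                   (trans (unchanged D₂ {d} {a} {b} (<-≤-trans d< (≤-trans (later D₁) (n≤1+n _))) a< b<) (unchanged D₁ {d} {a} {b} d< a< b<)))
                (λ {a} {E} a< pE → trans (gained (added A) {a} {key E} a< (key<Q E))
                   (trans (cong (_+ NodeSum (counter σ₂ 1) R L (c′ D₁) (c′ D₂) a (key E)) (zero′ D₂ {suc (c′ D₂)} {a} {key E} ≤-refl a< (key<Q E)))
                     (cnt-node g⁺ f₁⁺ f₂⁺ g⁻ f₁⁻ f₂⁻ l⁺ l⁻ r⁺ r⁻ κ {L} (distinct (rfam rd)) (allPure (rfam rd)) (complete B₂) {counter σ₂ 1} {c′ D₁} {c′ D₂}
                       -- The left table was completed before the right subtree was read and has not
                       -- changed since.
                       (λ {a′} {E′} a′< pE′ → trans (unchanged D₂ {c′ D₁} {a′} {key E′} ≤-refl a′< (key<Q E′)) (filled D₁ {a′} {E′} a′< pE′))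
                       (λ {a′} {E′} → filled D₂ {a′} {E′}) {E} pE a)))
                (zero-after A (zero′ D₂))

  traverse : ∀ {s} (T⁺ : ParseTree t⁺ s) (T⁻ : ParseTree t⁻ s) κ code n {L c h p σ} rest →
             (∀ x → if κ x then code x < n else n ≤ code x) → index σ 0 2 ≡ n →
             Before σ L c p → index σ 17 0 ≡ h → Streams σ p (tokens code T⁺ T⁻ rest) → Zero σ c →
             Done σ L c h T⁺ T⁻ κ rest
  traverse ⊙ ⊙ κ code n {L} {c} {h} {p} {σ} rest kinds en B eh st z = finish
    (r-if {e = tokenᵉ ∸ᵉ lit 1} {nodeCmd} {leafCmd} {σ}
      (λ nz → contradiction (cong (_∸ 1) tok) nz)
      (λ _ → r-leaf (κ tt) B eh en (cellAt (st false) 1) (kinds tt)))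
    where
    tok : index σ 2 (index σ 15 0) ≡ 1
    tok = trans (cong (index σ 2) (trans (position B false) (sym (+-identityʳ _)))) (cellAt (st false) 0)

    finish : Runs body σ (λ σ′ → After σ σ′ L c h (LeafSum (κ tt) L) (λ s → p s + 2)) → Done σ L c h ⊙ ⊙ κ rest
    finish (runs {_} {σ′} d b A) = done (more (λ e → contradiction (trans (sym tok) e) λ ()) d b none)
      (before (aready A) (complete B) (ahead A) (fresh A)) ≤-refl (top A) (below A) (height A) ag
      (λ { false → stream-drop (1 ∷ code tt ∷ []) (st′ false) ; true → stream-drop (1 ∷ code tt ∷ []) (st′ true) })
      (λ d< a< b< → others (added A) (<⇒≢ d<) a< b<)
      (λ {a} {E} a< pE → trans (gained (added A) {a} {key E} a< (key<Q E))
        (trans (cong (_+ LeafSum (κ tt) L a (key E)) (z ≤-refl a< (key<Q E)))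
          (cnt-leaf {L} (distinct (rfam (aready A))) (complete B) κ pE a)))
      (zero-after A z)
      where
      ag : Agree 4 σ σ′
      ag = keep-agree 4 {compile body} refl (keep d)
      st′ : Streams σ′ p (tokens code ⊙ ⊙ rest)
      st′ = streams-agree {p = p} {X = tokens code ⊙ ⊙ rest} ag st
  traverse (⊗[ g⁺ ∣ f₁⁺ , f₂⁺ ] l⁺ r⁺) (⊗[ g⁻ ∣ f₁⁻ , f₂⁻ ] l⁻ r⁻) κ code n {L} {c} {h} {p} {σ} rest kinds en B eh st z =
    right (traverse l⁺ l⁻ (κ ∘ inj₁) (code ∘ inj₁) n {h = h} {p} (tokens (code ∘ inj₂) r⁺ r⁻ next) (λ x → kinds (inj₁ x)) en B eh
      (λ s → stream-≡ (regroup g⁺ f₁⁺ f₂⁺ g⁻ f₁⁻ f₂⁻ l⁺ l⁻ r⁺ r⁻ rest code s) (st s)) z)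
    where
    next : Bool → List ℕ
    next = op g⁺ f₁⁺ f₂⁺ g⁻ f₁⁻ f₂⁻ l⁺ l⁻ r⁺ r⁻ rest

    right : Done σ L c h l⁺ l⁻ (κ ∘ inj₁) (tokens (code ∘ inj₂) r⁺ r⁻ next) →
            Done σ L c h (⊗[ g⁺ ∣ f₁⁺ , f₂⁺ ] l⁺ r⁺) (⊗[ g⁻ ∣ f₁⁻ , f₂⁻ ] l⁻ r⁻) κ rest
    right D = done-node g⁺ f₁⁺ f₂⁺ g⁻ f₁⁻ f₂⁻ l⁺ l⁻ r⁺ r⁻ rest κ {code} D
      (traverse r⁺ r⁻ (κ ∘ inj₂) (code ∘ inj₂) n {h = suc h} {p′ D} next
        (λ x → kinds (inj₂ x)) (trans (low (inputs D) 0 refl 2) en) (ready′ D) (height′ D) (streams D) (zero′ D))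

  -- Contributions and edges of the generated graphs.

  vec-one : ∀ t .{{_ : NonZero t}} → vec t 1 ≡ ⁅1⁆ t
  vec-one (suc n) = cong (true ∷_) (vec-ext λ {k} k< → trans (at-tab n _ k<) (trans (cong odd (halves-one k)) (sym (at-zero n k))))
    where halves-one : ∀ k → halves (suc k) 1 ≡ 0
          halves-one zero = refl
          halves-one (suc k) = cong half (halves-one k)

  code-one : ∀ t .{{_ : NonZero t}} → code (⁅1⁆ t) ≡ 1
  code-one t@(suc n) = trans (cong code (sym (vec-one t))) (trans (code-vec t 1)
    (sym (trans (binary-expand t 1) (trans (cong (λ z → binary t (bitAt 1) + 2 ^ t * z) (halves-zero t (^-monoʳ-≤ 2 {1} {t} (s≤s z≤n))))
      (trans (cong (binary t (bitAt 1) +_) (*-zeroʳ (2 ^ t))) (+-identityʳ _))))))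

  module _ .{{_ : NonZero t⁺}} .{{_ : NonZero t⁻}} where

    u⁺-label : u⁺ ≡ (⁅1⁆ t⁺ , Vec.replicate t⁻ false)
    u⁺-label = trans (cong vector (sym (trans (cong₂ (λ a b → a + 2 ^ t⁺ * b) (code-one t⁺) (code-zero t⁻)) (cong suc (*-zeroʳ (2 ^ t⁺))))))
                     (vector-number (⁅1⁆ t⁺ , Vec.replicate t⁻ false))

    u⁻-label : u⁻ ≡ (Vec.replicate t⁺ false , ⁅1⁆ t⁻)
    u⁻-label = trans (cong vector (sym (trans (cong₂ (λ a b → a + 2 ^ t⁺ * b) (code-zero t⁺) (code-one t⁻)) (*-identityʳ (2 ^ t⁺)))))
                     (vector-number (Vec.replicate t⁺ false , ⁅1⁆ t⁻))

    u±-label : u± ≡ (⁅1⁆ t⁺ , ⁅1⁆ t⁻)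
    u±-label = trans (cong vector (sym (trans (cong₂ (λ a b → a + 2 ^ t⁺ * b) (code-one t⁺) (code-one t⁻)) (cong suc (*-identityʳ (2 ^ t⁺))))))
                     (vector-number (⁅1⁆ t⁺ , ⁅1⁆ t⁻))

  module _ {s} (T⁺ : ParseTree t⁺ s) (T⁻ : ParseTree t⁻ s) where

    labV : Leaf s → V
    labV x = lab (generate T⁺) x , lab (generate T⁻) x

    touch : Bool → Leaf s → V → Bool
    touch v w r = if v then lab (generate T⁺) w · proj₁ r else lab (generate T⁻) w · proj₂ r

    Joined : Bool → Leaf s → Leaf s → Set
    Joined v w c = if v then Edge (graph (generate T⁺)) w c else Edge (graph (generate T⁻)) w c

  ∧-false⁻ : ∀ a b → a ∧ b ≡ false → a ≡ false ⊎ b ≡ false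
  ∧-false⁻ false b _ = inj₁ refl
  ∧-false⁻ true  b e = inj₂ e

  not-false : ∀ {b} → not b ≡ false → b ≡ true
  not-false {true} _ = refl

  ∧-falseˡ : ∀ {a} b → a ≡ false → a ∧ b ≡ false
  ∧-falseˡ b refl = refl

  ∧-falseʳ : ∀ a {b} → b ≡ false → a ∧ b ≡ false
  ∧-falseʳ a refl = ∧-zeroʳ a

  Touched : ∀ {s} → ParseTree t⁺ s → ParseTree t⁻ s → (Leaf s → Bool) → Asg s → V → Set
  Touched T⁺ T⁻ κ a r = ∃ λ w → κ w ≡ true × touch T⁺ T⁻ (val a w) w r ≡ true

  module _ {l r} (g⁺ f₁⁺ f₂⁺ : Relabeling t⁺) (g⁻ f₁⁻ f₂⁻ : Relabeling t⁻)
           (l⁺ : ParseTree t⁺ l) (l⁻ : ParseTree t⁻ l) (r⁺ : ParseTree t⁺ r) (r⁻ : ParseTree t⁻ r) where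

    private
      R = matrices g⁺ f₁⁺ f₂⁺ g⁻ f₁⁻ f₂⁻
      N⁺ = ⊗[ g⁺ ∣ f₁⁺ , f₂⁺ ] l⁺ r⁺
      N⁻ = ⊗[ g⁻ ∣ f₁⁻ , f₂⁻ ] l⁻ r⁻

    touch-left : ∀ v w z → touch N⁺ N⁻ v (inj₁ w) z ≡ touch l⁺ l⁻ v w (mulV true (R 1) z)
    touch-left true  w (z , _) = mul-adjoint false f₁⁺ (lab (generate l⁺) w) z
    touch-left false w (_ , z) = mul-adjoint false f₁⁻ (lab (generate l⁻) w) z

    touch-right : ∀ v w z → touch N⁺ N⁻ v (inj₂ w) z ≡ touch r⁺ r⁻ v w (mulV true (R 2) z)
    touch-right true  w (z , _) = mul-adjoint false f₂⁺ (lab (generate r⁺) w) z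
    touch-right false w (_ , z) = mul-adjoint false f₂⁻ (lab (generate r⁻) w) z

    joined-lr : ∀ v w c → Joined N⁺ N⁻ v (inj₁ w) (inj₂ c) ≡ (touch l⁺ l⁻ v w (mulV false (R 0) (labV r⁺ r⁻ c)) ≡ true)
    joined-lr true  w c = refl
    joined-lr false w c = refl

    -- In a composition `g` acts on the label from the right subtree. For a variable on the right it
    -- must be transposed before it can act on the clause; this is why `leftOp` and `rightOp` use
    -- `R 0` with different flags.
    joined-rl : ∀ v w c → Joined N⁺ N⁻ v (inj₂ w) (inj₁ c) ≡ (touch r⁺ r⁻ v w (mulV true (R 0) (labV l⁺ l⁻ c)) ≡ true)
    joined-rl true  w c = cong (_≡ true) (trans (sym (mul-adjoint true g⁺ (lab (generate l⁺) c) (lab (generate r⁺) w))) (·-comm _ (lab (generate r⁺) w)))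
    joined-rl false w c = cong (_≡ true) (trans (sym (mul-adjoint true g⁻ (lab (generate l⁻) c) (lab (generate r⁻) w))) (·-comm _ (lab (generate r⁻) w)))

  -- A vector leaves the annihilator iff some contribution has product 1 with it. Going down the
  -- tree, the relabelings pass by adjointness from the contributions to the vector, until a leaf
  -- names the variable.
  ann⇒touched : ∀ {s} (T⁺ : ParseTree t⁺ s) (T⁻ : ParseTree t⁻ s) κ a z → ann (labels T⁺ T⁻ κ a) z ≡ false → Touched T⁺ T⁻ κ a z
  touched⇒ann : ∀ {s} (T⁺ : ParseTree t⁺ s) (T⁻ : ParseTree t⁻ s) κ a z → Touched T⁺ T⁻ κ a z → ann (labels T⁺ T⁻ κ a) z ≡ false

  ann⇒touched (⊙ {{n⁺}}) (⊙ {{n⁻}}) κ a z e with κ tt in k | a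
  ... | true | true  = tt , k , trans (sym (trans (cong (_∙ z) (u⁺-label {{n⁺}} {{n⁻}})) (trans (cong ((⁅1⁆ t⁺ · proj₁ z) xor_) (zeroˡ-· (proj₂ z))) (xor-identityʳ _)))) (not-false e)
  ... | true | false = tt , k , trans (sym (trans (cong (_∙ z) (u⁻-label {{n⁺}} {{n⁻}})) (cong (_xor (⁅1⁆ t⁻ · proj₂ z)) (zeroˡ-· (proj₁ z))))) (not-false e)
  ann⇒touched (⊗[ g⁺ ∣ f₁⁺ , f₂⁺ ] l⁺ r⁺) (⊗[ g⁻ ∣ f₁⁻ , f₂⁻ ] l⁻ r⁻) κ (a , b) z e
    with ∧-false⁻ (ann (labels l⁺ l⁻ (κ ∘ inj₁) a) (mulV true (R 1) z)) _
           (trans (sym (ann-meet false (R 1) false (R 2) (labels l⁺ l⁻ (κ ∘ inj₁) a) (labels r⁺ r⁻ (κ ∘ inj₂) b) z)) e)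
    where R = matrices g⁺ f₁⁺ f₂⁺ g⁻ f₁⁻ f₂⁻
  ... | inj₁ h with w , k , t ← ann⇒touched l⁺ l⁻ (κ ∘ inj₁) a _ h =
          inj₁ w , k , trans (touch-left g⁺ f₁⁺ f₂⁺ g⁻ f₁⁻ f₂⁻ l⁺ l⁻ r⁺ r⁻ (val a w) w z) t
  ... | inj₂ h with w , k , t ← ann⇒touched r⁺ r⁻ (κ ∘ inj₂) b _ h =
          inj₂ w , k , trans (touch-right g⁺ f₁⁺ f₂⁺ g⁻ f₁⁻ f₂⁻ l⁺ l⁻ r⁺ r⁻ (val b w) w z) t

  touched⇒ann (⊙ {{n⁺}}) (⊙ {{n⁻}}) κ a z (tt , k , t) rewrite k with a
  ... | true  = cong not (trans (trans (cong (_∙ z) (u⁺-label {{n⁺}} {{n⁻}})) (trans (cong ((⁅1⁆ t⁺ · proj₁ z) xor_) (zeroˡ-· (proj₂ z))) (xor-identityʳ _))) t)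
  ... | false = cong not (trans (trans (cong (_∙ z) (u⁻-label {{n⁺}} {{n⁻}})) (cong (_xor (⁅1⁆ t⁻ · proj₂ z)) (zeroˡ-· (proj₁ z)))) t)
  touched⇒ann (⊗[ g⁺ ∣ f₁⁺ , f₂⁺ ] l⁺ r⁺) (⊗[ g⁻ ∣ f₁⁻ , f₂⁻ ] l⁻ r⁻) κ (a , b) z (w , k , t) =
    trans (ann-meet false (R 1) false (R 2) (labels l⁺ l⁻ (κ ∘ inj₁) a) (labels r⁺ r⁻ (κ ∘ inj₂) b) z) (go w k t)
    where
    R = matrices g⁺ f₁⁺ f₂⁺ g⁻ f₁⁻ f₂⁻
    go : ∀ w → κ w ≡ true → touch (⊗[ g⁺ ∣ f₁⁺ , f₂⁺ ] l⁺ r⁺) (⊗[ g⁻ ∣ f₁⁻ , f₂⁻ ] l⁻ r⁻) (val (a , b) w) w z ≡ true →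
         ann (labels l⁺ l⁻ (κ ∘ inj₁) a) (mulV true (R 1) z) ∧ ann (labels r⁺ r⁻ (κ ∘ inj₂) b) (mulV true (R 2) z) ≡ false
    go (inj₁ w) k t = ∧-falseˡ _ (touched⇒ann l⁺ l⁻ (κ ∘ inj₁) a _ (w , k , trans (sym (touch-left g⁺ f₁⁺ f₂⁺ g⁻ f₁⁻ f₂⁻ l⁺ l⁻ r⁺ r⁻ (val a w) w z)) t))
    go (inj₂ w) k t = ∧-falseʳ (ann (labels l⁺ l⁻ (κ ∘ inj₁) a) (mulV true (R 1) z)) (touched⇒ann r⁺ r⁻ (κ ∘ inj₂) b _ (w , k , trans (sym (touch-right g⁺ f₁⁺ f₂⁺ g⁻ f₁⁻ f₂⁻ l⁺ l⁻ r⁺ r⁻ (val b w) w z)) t))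

  -- The meaning of `ok` for a single clause in terms of edges: it is joined to a variable below by
  -- an edge of the sign given by its value, or its label is reached from outside.
  Covered : ∀ {s} → ParseTree t⁺ s → ParseTree t⁻ s → (Leaf s → Bool) → Asg s → List V → Leaf s → Set
  Covered T⁺ T⁻ κ a B c = (∃ λ w → κ w ≡ true × Joined T⁺ T⁻ (val a w) w c) ⊎ ann B (labV T⁺ T⁻ c) ≡ false

  ok⇒covered : ∀ {s} (T⁺ : ParseTree t⁺ s) (T⁻ : ParseTree t⁻ s) κ a B → ok T⁺ T⁻ κ a B ≡ true →
               ∀ c → κ c ≡ false → Covered T⁺ T⁻ κ a B c
  ok⇒covered (⊙ {{n⁺}}) (⊙ {{n⁻}}) κ a B e tt k rewrite k = inj₂ (trans (cong (ann B) (sym (u±-label {{n⁺}} {{n⁻}}))) (not-true e))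
  ok⇒covered (⊗[ g⁺ ∣ f₁⁺ , f₂⁺ ] l⁺ r⁺) (⊗[ g⁻ ∣ f₁⁻ , f₂⁻ ] l⁻ r⁻) κ (a , b) B e = λ
    { (inj₁ c) k → left c (ok⇒covered l⁺ l⁻ (κ ∘ inj₁) a _ (∧-trueˡ e) c k)
    ; (inj₂ c) k → right c (ok⇒covered r⁺ r⁻ (κ ∘ inj₂) b _ (∧-trueʳ (ok l⁺ l⁻ (κ ∘ inj₁) a _) e) c k) }
    where
    R = matrices g⁺ f₁⁺ f₂⁺ g⁻ f₁⁻ f₂⁻
    A′ = labels l⁺ l⁻ (κ ∘ inj₁) a
    B′ = labels r⁺ r⁻ (κ ∘ inj₂) b
    N⁺ = ⊗[ g⁺ ∣ f₁⁺ , f₂⁺ ] l⁺ r⁺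
    N⁻ = ⊗[ g⁻ ∣ f₁⁻ , f₂⁻ ] l⁻ r⁻

    left : ∀ c → Covered l⁺ l⁻ (κ ∘ inj₁) a (leftOp R B B′) c → Covered N⁺ N⁻ κ (a , b) B (inj₁ c)
    left c (inj₁ (w , k , j)) = inj₁ (inj₁ w , k , j)
    left c (inj₂ h) with ∧-false⁻ (ann B (mulV false (R 1) (labV l⁺ l⁻ c))) _ (trans (sym (ann-meet true (R 1) false (R 0) B B′ (labV l⁺ l⁻ c))) h)
    ... | inj₁ h₁ = inj₂ h₁
    ... | inj₂ h₂ with w , k , t ← ann⇒touched r⁺ r⁻ (κ ∘ inj₂) b _ h₂ =
            inj₁ (inj₂ w , k , subst (λ X → X) (sym (joined-rl g⁺ f₁⁺ f₂⁺ g⁻ f₁⁻ f₂⁻ l⁺ l⁻ r⁺ r⁻ (val b w) w c)) t)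

    right : ∀ c → Covered r⁺ r⁻ (κ ∘ inj₂) b (rightOp R B A′) c → Covered N⁺ N⁻ κ (a , b) B (inj₂ c)
    right c (inj₁ (w , k , j)) = inj₁ (inj₂ w , k , j)
    right c (inj₂ h) with ∧-false⁻ (ann B (mulV false (R 2) (labV r⁺ r⁻ c))) _ (trans (sym (ann-meet true (R 2) true (R 0) B A′ (labV r⁺ r⁻ c))) h)
    ... | inj₁ h₁ = inj₂ h₁
    ... | inj₂ h₂ with w , k , t ← ann⇒touched l⁺ l⁻ (κ ∘ inj₁) a _ h₂ =
            inj₁ (inj₁ w , k , subst (λ X → X) (sym (joined-lr g⁺ f₁⁺ f₂⁺ g⁻ f₁⁻ f₂⁻ l⁺ l⁻ r⁺ r⁻ (val a w) w c)) t)

  covered⇒ok : ∀ {s} (T⁺ : ParseTree t⁺ s) (T⁻ : ParseTree t⁻ s) κ a B →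
               (∀ c → κ c ≡ false → Covered T⁺ T⁻ κ a B c) → ok T⁺ T⁻ κ a B ≡ true
  covered⇒ok (⊙ {{n⁺}}) (⊙ {{n⁻}}) κ a B h with κ tt in k
  ... | true  = refl
  ... | false with h tt k
  ...   | inj₁ (tt , k′ , _) = contradiction (trans (sym k′) k) λ ()
  ...   | inj₂ e = cong not (trans (cong (ann B) (u±-label {{n⁺}} {{n⁻}})) e)
  covered⇒ok (⊗[ g⁺ ∣ f₁⁺ , f₂⁺ ] l⁺ r⁺) (⊗[ g⁻ ∣ f₁⁻ , f₂⁻ ] l⁻ r⁻) κ (a , b) B h =
    cong₂ _∧_ (covered⇒ok l⁺ l⁻ (κ ∘ inj₁) a _ (λ c k → left c (h (inj₁ c) k)))
              (covered⇒ok r⁺ r⁻ (κ ∘ inj₂) b _ (λ c k → right c (h (inj₂ c) k)))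
    where
    R = matrices g⁺ f₁⁺ f₂⁺ g⁻ f₁⁻ f₂⁻
    A′ = labels l⁺ l⁻ (κ ∘ inj₁) a
    B′ = labels r⁺ r⁻ (κ ∘ inj₂) b
    N⁺ = ⊗[ g⁺ ∣ f₁⁺ , f₂⁺ ] l⁺ r⁺
    N⁻ = ⊗[ g⁻ ∣ f₁⁻ , f₂⁻ ] l⁻ r⁻

    left : ∀ c → Covered N⁺ N⁻ κ (a , b) B (inj₁ c) → Covered l⁺ l⁻ (κ ∘ inj₁) a (leftOp R B B′) c
    left c (inj₁ (inj₁ w , k , j)) = inj₁ (w , k , j)
    left c (inj₁ (inj₂ w , k , j)) = inj₂ (trans (ann-meet true (R 1) false (R 0) B B′ (labV l⁺ l⁻ c))
      (∧-falseʳ (ann B (mulV false (R 1) (labV l⁺ l⁻ c))) (touched⇒ann r⁺ r⁻ (κ ∘ inj₂) b _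
        (w , k , subst (λ X → X) (joined-rl g⁺ f₁⁺ f₂⁺ g⁻ f₁⁻ f₂⁻ l⁺ l⁻ r⁺ r⁻ (val b w) w c) j))))
    left c (inj₂ e) = inj₂ (trans (ann-meet true (R 1) false (R 0) B B′ (labV l⁺ l⁻ c)) (∧-falseˡ _ e))

    right : ∀ c → Covered N⁺ N⁻ κ (a , b) B (inj₂ c) → Covered r⁺ r⁻ (κ ∘ inj₂) b (rightOp R B A′) c
    right c (inj₁ (inj₂ w , k , j)) = inj₁ (w , k , j)
    right c (inj₁ (inj₁ w , k , j)) = inj₂ (trans (ann-meet true (R 2) true (R 0) B A′ (labV r⁺ r⁻ c))
      (∧-falseʳ (ann B (mulV false (R 2) (labV r⁺ r⁻ c))) (touched⇒ann l⁺ l⁻ (κ ∘ inj₁) a _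
        (w , k , subst (λ X → X) (joined-lr g⁺ f₁⁺ f₂⁺ g⁻ f₁⁻ f₂⁻ l⁺ l⁻ r⁺ r⁻ (val a w) w c) j))))
    right c (inj₂ e) = inj₂ (trans (ann-meet true (R 2) true (R 0) B A′ (labV r⁺ r⁻ c)) (∧-falseˡ _ e))

  -- From assignments of the tree to those of the formula.

  module _ (φ : CNF) (T : SignedParseTree t⁺ t⁻ (formulaGraph φ)) where

    open Inverse (vertex T) using (to; from; strictlyInverseˡ; strictlyInverseʳ)

    κ : Leaf (shape T) → Bool
    κ x = isVariable (to x)

    good : Asg (shape T) → Bool
    good a = ok (T⁺ T) (T⁻ T) κ a []

    leafValue : Assignment (#vars φ) → Vertex φ → Bool
    leafValue ν (inj₁ w) = Vec.lookup ν w
    leafValue ν (inj₂ _) = false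

    restrict : Assignment (#vars φ) → Asg (shape T)
    restrict ν = build (shape T) (leafValue ν ∘ to)

    extend : Asg (shape T) → Assignment (#vars φ)
    extend a = Vec.tabulate (λ w → val a (from (inj₁ w)))

    extend-restrict : ∀ ν → extend (restrict ν) ≡ ν
    extend-restrict ν = trans (tabulate-cong (λ w → trans (val-build (shape T) (leafValue ν ∘ to) (from (inj₁ w)))
      (cong (leafValue ν) (strictlyInverseˡ (inj₁ w))))) (tabulate∘lookup ν)

    restrict-extend : ∀ {a} → a ∈ allAsg (shape T) κ → restrict (extend a) ≡ a
    restrict-extend {a} m = build-val (shape T) a λ x → go x (to x) refl
      where
      go : ∀ x v → to x ≡ v → leafValue (extend a) v ≡ val a x
      go x (inj₁ w) e = trans (lookup∘tabulate (λ w → val a (from (inj₁ w))) w) (cong (val a) (trans (cong from (sym e)) (strictlyInverseʳ x)))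
      go x (inj₂ c) e = sym (∈-allAsg⁻ (shape T) κ m x (cong isVariable e))

    restrict-∈ : ∀ ν → restrict ν ∈ allAsg (shape T) κ
    restrict-∈ ν = ∈-allAsg⁺ (shape T) κ (restrict ν) λ x k →
      let (c , e) = isClause⁻ (to x) k in trans (val-build (shape T) (leafValue ν ∘ to) x) (cong (leafValue ν) e)

    edge⁺ : ∀ w c {w′ c′} → to w ≡ inj₁ w′ → to c ≡ inj₂ c′ → Edge (graph (generate (T⁺ T))) w c ⇔ (pos w′ ∈ Vec.lookup (clauses φ) c′)
    edge⁺ w c ew ec = subst₂ (λ u v → Edge (graph (generate (T⁺ T))) w c ⇔ Edge (G⁺ (formulaGraph φ)) u v) ew ec (generates⁺ T w c)

    edge⁻ : ∀ w c {w′ c′} → to w ≡ inj₁ w′ → to c ≡ inj₂ c′ → Edge (graph (generate (T⁻ T))) w c ⇔ (neg w′ ∈ Vec.lookup (clauses φ) c′)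
    edge⁻ w c ew ec = subst₂ (λ u v → Edge (graph (generate (T⁻ T))) w c ⇔ Edge (G⁻ (formulaGraph φ)) u v) ew ec (generates⁻ T w c)

    value : ∀ ν w {w′} → to w ≡ inj₁ w′ → val (restrict ν) w ≡ Vec.lookup ν w′
    value ν w e = trans (val-build (shape T) (leafValue ν ∘ to) w) (cong (leafValue ν) e)

    satisfied : ∀ ν → good (restrict ν) ≡ true → Satisfies φ ν
    satisfied ν g = tabulate-all (clauses φ) λ c → clause c (from (inj₂ c)) (strictlyInverseˡ (inj₂ c))
      where
      tabulate-all : ∀ {A : Set} {P : A → Set} {n} (xs : Vec A n) → (∀ i → P (Vec.lookup xs i)) → VecAll.All P xs
      tabulate-all []       h = []
      tabulate-all (x ∷ xs) h = h zero ∷ tabulate-all xs (h ∘ suc)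

      literal : ∀ c x → to x ≡ inj₂ c → ∀ w w′ → to w ≡ inj₁ w′ → ∀ b → Vec.lookup ν w′ ≡ b → Joined (T⁺ T) (T⁻ T) b w x →
                Any (LiteralTrue ν) (Vec.lookup (clauses φ) c)
      literal c x ex w w′ ew true  eb j = lose (Equivalence.to (edge⁺ w x ew ex) j) eb
      literal c x ex w w′ ew false eb j = lose (Equivalence.to (edge⁻ w x ew ex) j) eb

      clause : ∀ c x → to x ≡ inj₂ c → Any (LiteralTrue ν) (Vec.lookup (clauses φ) c)
      clause c x ex with ok⇒covered (T⁺ T) (T⁻ T) κ (restrict ν) [] g x (cong isVariable ex)
      -- There are no outside contributions at the root, so the other alternative would mean
      -- `true ≡ false`.
      ... | inj₁ (w , k , j) = let (w′ , ew) = isVariable⁻ (to w) k in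
              literal c x ex w w′ ew (val (restrict ν) w) (sym (value ν w ew)) j

    satisfied⁻ : ∀ ν → Satisfies φ ν → good (restrict ν) ≡ true
    satisfied⁻ ν S = covered⇒ok (T⁺ T) (T⁻ T) κ (restrict ν) [] λ x k →
      let (c , ex) = isClause⁻ (to x) k in inj₁ (cover x c ex (find (lookup-all (clauses φ) S c)))
      where
      lookup-all : ∀ {A : Set} {P : A → Set} {n} (xs : Vec A n) → VecAll.All P xs → ∀ i → P (Vec.lookup xs i)
      lookup-all (x ∷ xs) (p ∷ ps) zero    = p
      lookup-all (x ∷ xs) (p ∷ ps) (suc i) = lookup-all xs ps i

      witness : ∀ x w′ b → Vec.lookup ν w′ ≡ b → Joined (T⁺ T) (T⁻ T) b (from (inj₁ w′)) x →
                ∃ λ w → κ w ≡ true × Joined (T⁺ T) (T⁻ T) (val (restrict ν) w) w x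
      witness x w′ b eb j = from (inj₁ w′) , cong isVariable (strictlyInverseˡ (inj₁ w′)) ,
        subst (λ b → Joined (T⁺ T) (T⁻ T) b (from (inj₁ w′)) x) (sym (trans (value ν (from (inj₁ w′)) (strictlyInverseˡ (inj₁ w′))) eb)) j

      cover : ∀ x c → to x ≡ inj₂ c → (∃ λ l → l ∈ Vec.lookup (clauses φ) c × LiteralTrue ν l) →
              ∃ λ w → κ w ≡ true × Joined (T⁺ T) (T⁻ T) (val (restrict ν) w) w x
      cover x c ex (pos w′ , m , e) = witness x w′ true  e (Equivalence.from (edge⁺ (from (inj₁ w′)) x (strictlyInverseˡ (inj₁ w′)) ex) m)
      cover x c ex (neg w′ , m , e) = witness x w′ false e (Equivalence.from (edge⁻ (from (inj₁ w′)) x (strictlyInverseˡ (inj₁ w′)) ex) m)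

    -- `restrict` and `extend` are mutually inverse on assignments whose clause leaves are false.
    -- Each gives an injection between the filtered lists, hence one of the two inequalities.
    models : sumA (shape T) κ (bit ∘ good) ≡ #SAT φ
    models = trans (sumA-list (shape T) κ (bit ∘ good)) (trans (sumL-filter good (allAsg (shape T) κ)) (≤-antisym ≤₁ ≤₂))
      where
      good? = λ a → good a Bool.≟ true

      member : ∀ {a} → a ∈ filter good? (allAsg (shape T) κ) → a ∈ allAsg (shape T) κ × good a ≡ true
      member = ∈-filter⁻ good?

      ≤₁ : length (filter good? (allAsg (shape T) κ)) ≤ #SAT φ
      ≤₁ = unique-≤ (Unique.filter⁺ good? (allAsg-unique (shape T) κ)) extend
        (λ m m′ e → trans (sym (restrict-extend (proj₁ (member m)))) (trans (cong restrict e) (restrict-extend (proj₁ (member m′)))))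
        (λ {a} m → ∈-filter⁺ (satisfies? φ) (∈-assignments (extend a))
          (satisfied (extend a) (trans (cong good (restrict-extend (proj₁ (member m)))) (proj₂ (member m)))))

      ≤₂ : #SAT φ ≤ length (filter good? (allAsg (shape T) κ))
      ≤₂ = unique-≤ (Unique.filter⁺ (satisfies? φ) (assignments-unique (#vars φ))) restrict
        (λ {ν} {ν′} _ _ e → trans (sym (extend-restrict ν)) (trans (cong extend e) (extend-restrict ν′)))
        (λ {ν} m → ∈-filter⁺ good? (restrict-∈ ν) (satisfied⁻ ν (proj₂ (∈-filter⁻ (satisfies? φ) {xs = assignments (#vars φ)} m))))

    open Done

    start : State
    start = initial (encode φ T)

    vertexCode : Leaf (shape T) → ℕ
    vertexCode x = encodeVertex φ (to x)

    kinds : ∀ x → if κ x then vertexCode x < #vars φ else #vars φ ≤ vertexCode x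
    kinds x with to x
    ... | inj₁ w = toℕ<n w
    ... | inj₂ c = m≤m+n (#vars φ) (toℕ c)

    blank : ∀ b j → (b <ᵇ 4) ≡ false → index start b j ≡ 0
    blank (suc (suc (suc (suc b)))) j _ = refl

    r-readout : ∀ {σ L c p} → Before σ L c p → ∀ {d} → index σ 16 0 ≡ d * (Q * Q) → counter σ 0 0 ≡ 0 → Filled σ d (T⁺ T) (T⁻ T) κ →
                Runs readout σ (λ σ′ → output σ′ ≡ #SAT φ)
    r-readout {σ} {L} B {d} e16 e0 F = r-for
      (λ k σ′ → counter σ′ 0 0 ≡ sumN k (λ i → cnt (T⁺ T) (T⁻ T) κ (K L i) []))
      refl refl (count (rfam (bready B))) (size≤ (bready B)) e0
      (λ k σ′ k< kp xk i →
        let rd = ready-agree (keep-agree 15 {compile readout} refl kp) (bready B)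
            adr : index σ′ 16 0 + index σ′ 9 (index σ′ 8 (index σ′ 47 0)) + index σ′ 13 1 ≡ cell² d (K L k) (key [])
            adr = cong₂ _+_ (cong₂ _+_ (trans (ix kp 16 refl 0) e16)
                    (trans (cong (index σ′ 9) (trans (cong (index σ′ 8) xk) (keyAt (rfam rd) k<))) (shift (rows (rfam rd) k<)))) (rfull rd)
        in r-putᶜ (cong₂ _+_ i (trans (cong (counter σ′ 1) adr) (trans (ct kp 1 refl _) (F {K L k} {[]} (key<Q (nth L k)) [])))))
      (λ _ _ i → trans i (trans (total (T⁺ T) (T⁻ T) κ {L} (distinct (rfam (bready B))) (complete B)) models))

    Result : Set
    Result = Σ[ n ∈ ℕ ] Σ[ σ ∈ State ] (⟨ solver , start ⟩⇓[ n ] σ) × output σ ≡ #SAT φ ×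
      n ≤ ⟦ cost setup ⟧ (τ , y) + ((nodes (shape T) * (4 + ⟦ cost body ⟧ (τ , y)) + 4) + ⟦ cost readout ⟧ (τ , y))

    run : Result
    run = prepared (r-setup {start} (λ { false → refl ; true → refl }) blank)
      where
      assemble : ∀ {n₁ n₂ σ₁ σ₂} → ⟨ compile setup , start ⟩⇓[ n₁ ] σ₁ → n₁ ≤ ⟦ cost setup ⟧ (τ , y) →
                 ⟨ WHILE tokenᵉ DO compile body , σ₁ ⟩⇓[ n₂ ] σ₂ → n₂ ≤ nodes (shape T) * (4 + bodyCost) + 4 →
                 Runs readout σ₂ (λ σ → output σ ≡ #SAT φ) → Result
      assemble d₁ b₁ d₂ b₂ (runs d₃ b₃ out) = _ , _ , ⇓seq d₁ (⇓seq d₂ d₃) , out , +-mono-≤ b₁ (+-mono-≤ b₂ b₃)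

      traversed : ∀ {n₁ σ₁ L} → ⟨ compile setup , start ⟩⇓[ n₁ ] σ₁ → n₁ ≤ ⟦ cost setup ⟧ (τ , y) →
                  Done σ₁ L 0 0 (T⁺ T) (T⁻ T) κ (λ _ → []) → Result
      traversed d₁ b₁ D
        with n₂ , d₂ , b₂ ← loops-while (loops D)
               (trans (cong (index (result D) 2) (trans (position (ready′ D) false) (sym (+-identityʳ _)))) (cellAt (streams D false) 0)) =
        assemble d₁ b₁ d₂ b₂ (r-readout (ready′ D) {c′ D} (onTop D) (trans (ct (keep d₂) 0 refl 0) (ct (keep d₁) 0 refl 0)) (filled D))

      prepared : Runs setup start (λ σ → ∃ λ L → Ready σ L × Complete Pure L) → Result
      prepared (runs {_} {σ₁} d₁ b₁ (L , rd , C)) = traversed d₁ b₁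
        (traverse (T⁺ T) (T⁻ T) κ vertexCode (#vars φ) {h = 0} {p = λ _ → 0} (λ _ → []) kinds (ix k₁ 0 refl 2)
          (before rd C (λ s → trans (ix k₁ 15 refl _) (blank 15 (bit s) refl)) (trans (ix k₁ 18 refl 0) refl)) (ix k₁ 17 refl 0)
          (λ { false → reads (λ j → trans (ix k₁ 2 refl j) (cong (λ xs → cell xs j) (sym (++-identityʳ (encodeTree vertexCode (T⁺ T))))))
             ; true  → reads (λ j → trans (ix k₁ 3 refl j) (cong (λ xs → cell xs j) (sym (++-identityʳ (encodeTree vertexCode (T⁻ T)))))) })
          (λ _ _ _ → ct k₁ 1 refl _))
        where
        k₁ : Keep (compile setup) start σ₁
        k₁ = keep d₁

-- The running time

-- As all arguments are positive, lower-order terms are absorbed into the leading one. The token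
-- test costs 4 in each of at most `2 * s` rounds and 4 at the end, and 2 * 4 + 4 is the 2 * 6 in
-- the constant.
steps≤ : ∀ p p′ p″ c {t y k s} → c ≡ coeff p + coeff p″ + 2 * (6 + coeff p′) → (deg𝕋 p ⊔ deg𝕋 p′ ⊔ deg𝕋 p″) ⊔ (deg𝕐 p ⊔ deg𝕐 p′ ⊔ deg𝕐 p″) ≤ 3 →
         0 < t → 0 < y → 0 < k → k ≤ 2 * s →
         ⟦ p ⟧ (t , y) + ((k * (4 + ⟦ p′ ⟧ (t , y)) + 4) + ⟦ p″ ⟧ (t , y)) ≤
         c * (t ^ 3 * y ^ 3) * s
steps≤ p p′ p″ _ {t} {y} {k} {s} refl deg≤ 0<t 0<y 0<k k≤ = begin
  ⟦ p ⟧ (t , y) + ((k * (4 + ⟦ p′ ⟧ (t , y)) + 4) + ⟦ p″ ⟧ (t , y))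
    ≤⟨ +-mono-≤ (poly-bound p (≤-trans (m≤m⊔n _ _) (≤-trans (m≤m⊔n _ _) 𝕋≤)) (≤-trans (m≤m⊔n _ _) (≤-trans (m≤m⊔n _ _) 𝕐≤)))
         (+-mono-≤ (+-mono-≤ (*-mono-≤ k≤ (+-mono-≤ (*-monoʳ-≤ 4 1≤X)
           (poly-bound p′ (≤-trans (m≤n⊔m (deg𝕋 p) _) (≤-trans (m≤m⊔n _ _) 𝕋≤)) (≤-trans (m≤n⊔m (deg𝕐 p) _) (≤-trans (m≤m⊔n _ _) 𝕐≤))))) (*-monoʳ-≤ 4 1≤Xs))
           (poly-bound p″ (≤-trans (m≤n⊔m (deg𝕋 p ⊔ deg𝕋 p′) _) 𝕋≤) (≤-trans (m≤n⊔m (deg𝕐 p ⊔ deg𝕐 p′) _) 𝕐≤))) ⟩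
  a * X + (2 * s * (4 * X + b * X) + 4 * (X * s) + r * X)
    ≤⟨ +-mono-≤ (*-monoʳ-≤ a X≤Xs) (+-monoʳ-≤ (2 * s * (4 * X + b * X) + 4 * (X * s)) (*-monoʳ-≤ r X≤Xs)) ⟩
  a * (X * s) + (2 * s * (4 * X + b * X) + 4 * (X * s) + r * (X * s))
    ≡⟨ collect a b r X s ⟩
  (a + r + 2 * (6 + b)) * X * s ∎
  where
  open ≤-Reasoning
  instance
    _ : NonZero t
    _ = >-nonZero 0<t
    _ : NonZero y
    _ = >-nonZero 0<y
  𝕋≤ : deg𝕋 p ⊔ deg𝕋 p′ ⊔ deg𝕋 p″ ≤ 3
  𝕋≤ = ≤-trans (m≤m⊔n _ _) deg≤
  𝕐≤ : deg𝕐 p ⊔ deg𝕐 p′ ⊔ deg𝕐 p″ ≤ 3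
  𝕐≤ = ≤-trans (m≤n⊔m (deg𝕋 p ⊔ deg𝕋 p′ ⊔ deg𝕋 p″) _) deg≤
  X = t ^ 3 * y ^ 3
  a = coeff p
  b = coeff p′
  r = coeff p″
  1≤X : 1 ≤ X
  1≤X = *-mono-≤ (m^n>0 t 3) (m^n>0 y 3)
  positive : ∀ s → k ≤ 2 * s → 0 < s
  positive zero    k≤0 = contradiction 0<k (≤⇒≯ k≤0)
  positive (suc _) _   = s≤s z≤n
  1≤s : 1 ≤ s
  1≤s = positive s k≤
  X≤Xs : X ≤ X * s
  X≤Xs = subst (_≤ X * s) (*-identityʳ X) (*-monoʳ-≤ X 1≤s)
  1≤Xs : 1 ≤ X * s
  1≤Xs = *-mono-≤ 1≤X 1≤s
  collect : ∀ a b r X s → a * (X * s) + (2 * s * (4 * X + b * X) + 4 * (X * s) + r * (X * s)) ≡ (a + r + 2 * (6 + b)) * X * s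
  collect = solve-∀

triangle-exponent : ∀ t → 3 * t * (t + 1) / 2 ≡ triangle t * 3
triangle-exponent t = trans (cong (_/ 2) (begin
  3 * t * (t + 1)                    ≡⟨ expand t ⟩
  3 * (t * t + t)                    ≡⟨ cong (3 *_) (triangle-double t) ⟨
  3 * (triangle t + triangle t)      ≡⟨ regroup (triangle t) ⟩
  triangle t * 3 * 2                 ∎)) (m*n/n≡m (triangle t * 3) 2)
  where open ≡-Reasoning
        expand : ∀ t → 3 * t * (t + 1) ≡ 3 * (t * t + t)
        expand = solve-∀
        regroup : ∀ a → 3 * (a + a) ≡ a * 3 * 2
        regroup = solve-∀

-- Equality holds for t = 1 and t = 2. This keeps the number of label pairs, up to `2 ^ (t + t)`,
-- within a constant factor of `2 ^ triangle t`, so loops over all vectors cost no more than loops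
-- over the annihilators.
double≤triangle : ∀ t → t + t ≤ 1 + triangle t
double≤triangle zero = z≤n
double≤triangle (suc zero) = ≤-refl
double≤triangle (suc t@(suc _)) = begin
  suc t + suc t                ≡⟨ shuffle t ⟩
  t + t + 2                    ≤⟨ +-mono-≤ (double≤triangle t) (s≤s (s≤s z≤n)) ⟩
  1 + triangle t + suc t       ≡⟨⟩
  1 + (triangle t + suc t)     ∎
  where open ≤-Reasoning
        shuffle : ∀ t → suc t + suc t ≡ t + t + 2
        shuffle = solve-∀

volume≤ : ∀ {τ} t H m → τ ≤ t + t → τ ^ 3 * (H * m) ^ 3 ≤ t ^ 3 * H ^ 3 * (8 * m ^ 3)
volume≤ {τ} t H m τ≤ = begin
  τ ^ 3 * (H * m) ^ 3              ≤⟨ *-monoˡ-≤ ((H * m) ^ 3) (^-monoˡ-≤ 3 τ≤) ⟩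
  (t + t) ^ 3 * (H * m) ^ 3        ≡⟨ expand t H m ⟩
  t ^ 3 * H ^ 3 * (8 * m ^ 3)      ∎
  where open ≤-Reasoning
        expand : ∀ t H m → (t + t) * ((t + t) * ((t + t) * 1)) * (H * m * (H * m * (H * m * 1))) ≡
                           t * (t * (t * 1)) * (H * (H * (H * 1))) * (8 * (m * (m * (m * 1))))
        expand = solve-∀

scale≤ : ∀ c m k {n X E s} → k ≡ c * m → n ≤ c * X * s → X ≤ E * m → n ≤ k * (E * s)
scale≤ c m _ {n} {X} {E} {s} refl n≤ X≤ = begin
  n                      ≤⟨ n≤ ⟩
  c * X * s              ≤⟨ *-monoˡ-≤ s (*-monoʳ-≤ c X≤) ⟩
  c * (E * m) * s        ≡⟨ regroup c E m s ⟩
  c * m * (E * s)        ∎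
  where open ≤-Reasoning
        regroup : ∀ c E m s → c * (E * m) * s ≡ c * m * (E * s)
        regroup = solve-∀

-- A literal factor on the left would be unfolded into a sum by the type checker.
module Bounds (t⁺ t⁻ m : ℕ) (128≤m : 128 ≤ m) where

  t H y : ℕ
  t = t⁺ ⊔ t⁻
  H = 2 ^ triangle t
  y = H * m

  128H≤y : 128 * H ≤ y
  128H≤y = subst (_≤ y) (*-comm H 128) (*-monoʳ-≤ H 128≤m)

  τ≤2t : t⁺ + t⁻ ≤ t + t
  τ≤2t = +-mono-≤ (m≤m⊔n t⁺ t⁻) (m≤n⊔m t⁺ t⁻)

  q≤y : 2 ^ (t⁺ + t⁻) ≤ y
  q≤y = begin
    2 ^ (t⁺ + t⁻)      ≤⟨ ^-monoʳ-≤ 2 (≤-trans τ≤2t (double≤triangle t)) ⟩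
    2 * H              ≤⟨ *-monoˡ-≤ H (≤ᵇ⇒≤ 2 128 tt) ⟩
    128 * H            ≤⟨ 128H≤y ⟩
    y                  ∎
    where open ≤-Reasoning

  galois≤y : ∀ {s} → s ≤ t → galois s * galois s ≤ y
  galois≤y {s} s≤t = ≤-trans (galois-square≤ s) (≤-trans (*-monoʳ-≤ 128 (^-monoʳ-≤ 2 (triangle-mono s≤t))) 128H≤y)

  count≤ : ∀ L → Labels.Distinct t⁺ t⁻ L → Labels.AllPure t⁺ t⁻ L → length L ≤ y
  count≤ L d p = ≤-trans (FamilyBound.family≤ t⁺ t⁻ L d p) (square-cancel-≤ (begin
    galois t⁺ * galois t⁻ * (galois t⁺ * galois t⁻)     ≡⟨ shuffle (galois t⁺) (galois t⁻) ⟩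
    galois t⁺ * galois t⁺ * (galois t⁻ * galois t⁻)     ≤⟨ *-mono-≤ (galois≤y (m≤m⊔n t⁺ t⁻)) (galois≤y (m≤n⊔m t⁺ t⁻)) ⟩
    y * y                                               ∎))
    where open ≤-Reasoning
          shuffle : ∀ a b → a * b * (a * b) ≡ a * a * (b * b)
          shuffle = solve-∀

  total≤ : (t⁺ + t⁻) ^ 3 * y ^ 3 ≤ t ^ 3 * 2 ^ (3 * t * (t + 1) / 2) * (8 * m ^ 3)
  total≤ = subst (λ z → (t⁺ + t⁻) ^ 3 * y ^ 3 ≤ t ^ 3 * z * (8 * m ^ 3))
    (trans (^-*-assoc 2 (triangle t) 3) (cong (2 ^_) (sym (triangle-exponent t)))) (volume≤ t H m τ≤2t)

nodes-positive : ∀ s → 0 < nodes s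
nodes-positive leaf       = s≤s z≤n
nodes-positive (node l r) = ≤-trans (nodes-positive l) (m≤m+n _ _)

-- The constants enter as variables with their defining equations, so that type checking does not
-- expand arithmetic with large numerals.
solves : ∀ c m k → c ≡ coeff (cost setup) + coeff (cost readout) + 2 * (6 + coeff (cost body)) → 128 ≤ m → k ≡ c * (8 * m ^ 3) →
  ∀ (φ : CNF) (t⁺ t⁻ : ℕ) (T : SignedParseTree t⁺ t⁻ (formulaGraph φ)) →
  let t = t⁺ ⊔ t⁻ in
  Σ[ n ∈ ℕ ] Σ[ σ ∈ State ]
  (⟨ solver , initial (encode φ T) ⟩⇓[ n ] σ)
  × output σ ≡ #SAT φ
  × n ≤ k * (t ^ 3 * 2 ^ (3 * t * (t + 1) / 2) * size φ)
solves c m k c≡ 128≤m k≡ φ t⁺ t⁻ T = bounded (Algorithm.run t⁺ t⁻ y (tree-positive (T⁺ T)) (tree-positive (T⁻ T)) q≤y count≤ φ T)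
  where
  open Bounds t⁺ t⁻ m 128≤m
  bounded : Algorithm.Result t⁺ t⁻ y (tree-positive (T⁺ T)) (tree-positive (T⁻ T)) q≤y count≤ φ T → _
  bounded (n , σ , d , out , n≤) = n , σ , d , out , scale≤ c (8 * m ^ 3) k {n} {(t⁺ + t⁻) ^ 3 * y ^ 3} {t ^ 3 * 2 ^ (3 * t * (t + 1) / 2)} {size φ} k≡
    -- The degrees of the three cost polynomials are compared with 3 by evaluation.
    (≤-trans n≤ (steps≤ (cost setup) (cost body) (cost readout) c {t⁺ + t⁻} {y} {nodes (shape T)} {size φ} c≡ (≤ᵇ⇒≤ _ 3 tt)
      (≤-trans (tree-positive (T⁺ T)) (m≤m+n t⁺ t⁻))
      (*-mono-≤ (m^n>0 2 (triangle t)) (≤-trans (s≤s z≤n) 128≤m)) (nodes-positive (shape T)) (nodes≤ φ T))) total≤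

-- The factor 8 comes from cubing `t⁺ + t⁻ ≤ t + t`, and `128 ^ 3` from cubing the bound on the
-- number of annihilators.
constant : ℕ
constant = (coeff (cost setup) + coeff (cost readout) + 2 * (6 + coeff (cost body))) * (8 * 128 ^ 3)

theorem3p1 : Σ[ P ∈ Program ] Σ[ c ∈ ℕ ]
    ∀ (φ : CNF) (t⁺ t⁻ : ℕ) (T : SignedParseTree t⁺ t⁻ (formulaGraph φ)) →
    let t = t⁺ ⊔ t⁻ in
    Σ[ n ∈ ℕ ] Σ[ σ ∈ State ]
    (⟨ P , initial (encode φ T) ⟩⇓[ n ] σ)
    × output σ ≡ #SAT φ
    × n ≤ c * (t ^ 3 * 2 ^ (3 * t * (t + 1) / 2) * size φ)
theorem3p1 = solver , constant ,
  solves (coeff (cost setup) + coeff (cost readout) + 2 * (6 + coeff (cost body))) 128 constant refl ≤-refl refl
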